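{- Let $q_0$ be even. If $s\ge 3$ is odd and satisfies $$q_0^s-q_0^{s/2}\left(\frac{q_0}{2}\right)^{q_0-1}\left(2q_0^2-7q_0+3\right)>\left(\frac{q_0}{2}\right)^{q_0-1}\left(4q_0-2\right)-q_0^2,$$ then $\rho(C_s(q_0))=3$.
   Context: Let $q=q_0^s$ and $H=\{x\in\mathbb{F}_{q^2}: x^{q+1}=1\}$. The code $C_s(q_0)$ is the linear code of length $q+1$ over $\mathbb{F}_{q_0}$ with coordinates indexed by $H$: $C_s(q_0)=\{(c_x)_{x\in H}\in\mathbb{F}_{q_0}^{q+1}: \sum_{x\in H}c_x x=0\}$. $\rho(C)$ denotes the covering radius of a code $C$ (maximum over all vectors of the minimum Hamming distance to the code). -}

module Defs where

open import Level using (0ℓ)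
open import Data.Nat as ℕ using (ℕ; zero; suc)
open import Data.Integer as ℤ using (ℤ; +_)
open import Data.Fin using (Fin)
open import Data.List using (List; map; foldr; length; filter; mapMaybe; allFin)
open import Data.Maybe using (Maybe; just; nothing)
open import Data.Product using (Σ; ∃; _×_; _,_; proj₁)
open import Data.Sum using (_⊎_)
open import Algebra.Core using (Op₁; Op₂)
open import Algebra.Structures using (IsCommutativeRing)
open import Function.Bundles using (_↔_; Inverse)
open import Relation.Binary.PropositionalEquality using (_≡_; _≢_)
open import Relation.Binary.Definitions using (DecidableEquality)
open import Relation.Nullary using (yes; no; ¬?)

record FiniteField : Set₁ where
  field
    Carrier           : Set
    _+_ _*_           : Op₂ Carrier
    -_                : Op₁ Carrier
    0# 1#             : Carrier
    isCommutativeRing : IsCommutativeRing _≡_ _+_ _*_ -_ 0# 1#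
    0≢1               : 0# ≢ 1#
    inverse           : ∀ x → x ≢ 0# → ∃ λ y → x * y ≡ 1#
    _≟_               : DecidableEquality Carrier
    size              : ℕ
    enum              : Fin size ↔ Carrier

-- The code C_s(q0), realised inside a finite field K of order q^2
-- (q = q0^s).  F_{q0} is the subfield {x ∈ K : x^{q0} = x} and
-- H = {x ∈ K : x^{q+1} = 1}.
module Code (K : FiniteField) (q0 q : ℕ) where
  open FiniteField K

  pow : Carrier → ℕ → Carrier
  pow x zero    = 1#
  pow x (suc n) = x * pow x n

  Fq0 : Set
  Fq0 = Σ Carrier (λ x → pow x q0 ≡ x)

  H : Set
  H = Σ Carrier (λ x → pow x (suc q) ≡ 1#)

  elements : List Carrier
  elements = map (Inverse.to enum) (allFin size)

  Hlist : List H
  Hlist = mapMaybe pick elements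
    where
    pick : Carrier → Maybe H
    pick x with pow x (suc q) ≟ 1#
    ... | yes p = just (x , p)
    ... | no  _ = nothing

  Word : Set
  Word = H → Fq0

  InCode : Word → Set
  InCode c = foldr _+_ 0# (map (λ h → proj₁ (c h) * proj₁ h) Hlist) ≡ 0#

  dist : Word → Word → ℕ
  dist v c = length (filter (λ h → ¬? (proj₁ (v h) ≟ proj₁ (c h))) Hlist)

  CoveringRadius : ℕ → Set
  CoveringRadius r =
    (∀ v → ∃ λ c → InCode c × dist v c ℕ.≤ r) ×
    (∃ λ v → ∀ c → InCode c → r ℕ.≤ dist v c)

-- sqrtMulLt n b a  means  √n · b < a   (n : ℕ, a b : ℤ), expressed without reals:
--   (0 < a  or  a² < n b²)  and  (b ≤ 0  or  n b² < a²).
sqrtMulLt : ℕ → ℤ → ℤ → Set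
sqrtMulLt n b a =
  (ℤ.0ℤ ℤ.< a ⊎ a ℤ.* a ℤ.< + n ℤ.* (b ℤ.* b)) ×
  (b ℤ.≤ ℤ.0ℤ ⊎ + n ℤ.* (b ℤ.* b) ℤ.< a ℤ.* a)

{-# OPTIONS --safe #-}

-- Let q = q0^s and let Tr be the trace 𝔽_q → 𝔽_2.  Up to a factor on the circle H, a
-- syndrome is an element r of 𝔽_q, and r = c z + ρ h with z, h ∈ H is solvable as soon as
-- Tr(rc/(r+c+ρ)²) = 1.  Choosing ρ with Tr(r/(r+1+ρ)²) = Tr(1/ρ) = 1 writes r as z + h(x+y),
-- so ρ(C) ≤ 3.  Conversely, r ∉ 𝔽_{q0} is not a combination of two elements of H if it is
-- good: Tr(b r/(r+c)²) = 0 for all b, c ∈ 𝔽_{q0}.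
--
-- The number of good r is an average of the sums Σ_r (-1)^{Tr f(r)}, f = Σ_c b_c x/(x+c)².
-- Modulo trace-zero functions f has a simple pole at every c ≠ 0 with b_c ∉ {0, c}, and
-- at 0 if b_0 ≠ 0.  Each sum is bounded below by Stepanov's method in Bombieri's form on
-- the curve y² + y = f: with q = Q'Q'' (powers of 2), the pigeonhole principle gives a
-- nonzero Φ = Σ c_ij v_j u_i^{Q''} with Σ c_ij^{Q'} v_j^{Q'} ū_i = 0, where ū is the conjugate
-- of u.  Since u^q = ū at the points with Tr f = 1, Φ vanishes there, and its degree bounds
-- their number.  The hypothesis makes the main term of the average dominate; q0 = 4 needs
-- the exact count of the poles, not only the bound by q0.
module Submission where

open import Defs
open import Data.Nat using (ℕ; suc; _^_; _∸_; _≤_; _*_; _+_)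
open import Data.Integer using (ℤ; +_; _-_) renaming (_+_ to _+ℤ_; _*_ to _*ℤ_)
open import Relation.Binary.PropositionalEquality using (_≡_)
open import Algebra.Bundles using (CommutativeRing)
import Algebra.Solver.Ring
open import Algebra.Solver.Ring.AlmostCommutativeRing
  using (AlmostCommutativeRing; _-Raw-AlmostCommutative⟶_; fromCommutativeSemiring)
open import Algebra.Structures using (IsCommutativeRing)
open import Data.Bool using (true; false)
import Data.Bool.Properties as Boolₚ
open import Data.Empty using (⊥; ⊥-elim)
open import Data.Fin using (Fin)
import Data.Fin.Properties as Finₚ
import Data.Integer as ℤ
import Data.Integer.Properties as Int
open import Data.Integer.Tactic.RingSolver using () renaming (solve-∀ to ℤ-ring)
open import Data.List using (List; []; _∷_; map; mapMaybe; foldr; length; filter; _++_; allFin)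
open import Data.List.Membership.Propositional using (_∈_; _∉_; find; lose)
open import Data.List.Membership.Propositional.Properties
  using (∈-map⁺; ∈-map⁻; ∈-filter⁺; ∈-filter⁻; ∈-∃++; ∈-++⁺ˡ; ∈-++⁺ʳ; ∈-++⁻; ∈-allFin)
open import Data.List.Membership.Propositional.Properties.WithK using (unique∧set⇒bag)
open import Data.List.Properties using (map-cong; length-map; length-++; length-filter; length-tabulate)
open import Data.List.Relation.Binary.BagAndSetEquality using (∼bag⇒↭)
open import Data.List.Relation.Binary.Permutation.Propositional
  using (_↭_; ↭-sym; ↭⇒↭ₛ) renaming (refl to ↭refl; prep to ↭prep; swap to ↭swap; trans to ↭trans)
open import Data.List.Relation.Binary.Permutation.Propositional.Properties
  using (↭-length; shift; ∈-resp-↭)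
import Data.List.Relation.Binary.Permutation.Setoid.Properties as ↭ₛ
open import Data.List.Relation.Unary.All as All using (All; []; _∷_)
open import Data.List.Relation.Unary.All.Properties using (¬All⇒Any¬)
open import Data.List.Relation.Unary.AllPairs using ([]; _∷_)
open import Data.List.Relation.Unary.Any as Any using (Any; here; there)
open import Data.List.Relation.Unary.Unique.Propositional using (Unique)
import Data.List.Relation.Unary.Unique.Propositional.Properties as Uniq
open import Data.Maybe using (Maybe; just; nothing)
import Data.Nat as ℕ
open import Data.Nat using (zero; _<_; z≤n; s≤s)
open import Data.Nat.Divisibility using (_∣_; divides; ∣-trans; m∣m*n; ∣1⇒≡1)
open import Data.Nat.Primality using (euclidsLemma; prime?)
import Data.Nat.Properties as Nat
open Nat using (*-mono-≤; *-monoʳ-≤; *-monoˡ-≤; +-cancelʳ-≤; +-mono-≤; +-monoʳ-<; +-monoʳ-≤;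
  +-monoˡ-≤; <⇒≱; ^-*-assoc; ^-distribˡ-+-*; ^-monoʳ-<; ^-monoʳ-≤; m<m+n; m^n>0; m≤m+n; m≤n+m;
  n<1+n; n≤1+n; ≤-pred; ≤-refl; ≤-reflexive; ≤-trans; ≮⇒≥)
open import Data.Nat.Tactic.RingSolver using () renaming (solve-∀ to ℕ-ring)
open import Data.Product using (∃; _×_; _,_; proj₁; proj₂)
open import Data.Product.Function.NonDependent.Propositional using (_×-↔_)
open import Data.Sum using (_⊎_; inj₁; inj₂)
open import Data.Unit using (tt)
open import Data.Vec as Vec using (Vec; []; _∷_; zipWith; replicate)
open import Data.Vec.Properties using (≡-dec)
open import Function using (_↔_; mk↔ₛ′)
open import Function.Bundles using (Inverse; mk⇔)
open import Function.Construct.Composition using (_↔-∘_)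
open import Function.Construct.Symmetry using (↔-sym)
open import Relation.Binary.Definitions using (tri<; tri≈; tri>)
open import Relation.Binary.PropositionalEquality
  using (_≢_; refl; sym; trans; cong; cong₂; subst; subst₂; setoid; module ≡-Reasoning)
open import Relation.Binary.PropositionalEquality.WithK using (≡-irrelevant)
open import Relation.Nullary using (Dec; yes; no; ¬_; ¬?)
open import Relation.Nullary.Decidable using (_×-dec_; toWitness)
open import Relation.Unary using (Decidable)

-- The circle enters through one criterion: a nonzero t ∈ 𝔽_q equals z + z^q with z ∈ H exactly when
-- X² + tX + 1 is irreducible over 𝔽_q, that is, when Tr(1/t) = 1. Taking norms from K to 𝔽_q in r +
-- cz = ρh gives z + z^q = (r+c+ρ)²/(rc), whence the traces above. Goodness is detected because the
-- sum of χ(Σ_c b_c x/(x+c)²) over all families factors over c into sums over b ∈ 𝔽_{q0}, each of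
-- them q0 or 0. Only lower bounds for the exponential sums are needed, so it is enough to bound the
-- number of points with Tr f = 1 from above. With g + 1 poles the curve has genus g and the error
-- is about 2gQ''. As q need not be a square, Q'' can be as large as √(2q), which is worse than the
-- 2g√q of Weil's theorem. Rounding makes good the loss: Q' is a power of two, so once the
-- hypothesis excludes one value of Q' the next one is twice as large. Polynomials are functions on
-- K together with a degree certificate; "nonzero" always means a certificate with nonzero leading
-- coefficient.

-- Counting and integer sums over lists.

module _ {A : Set} where

  extract : ∀ {z : A} {xs} → Unique xs → z ∈ xs →
    ∃ λ rest → xs ↭ z ∷ rest × Unique (z ∷ rest)
  extract {z} u z∈ with ∈-∃++ z∈
  ... | as , bs , refl = as ++ bs , shift z as bs ,
    ↭ₛ.Unique-resp-↭ (setoid A) (↭⇒↭ₛ (shift z as bs)) u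

  unique-⊆⇒length≤ : ∀ {xs ys : List A} → Unique xs → (∀ {z} → z ∈ xs → z ∈ ys) →
    length xs ≤ length ys
  unique-⊆⇒length≤ {[]}     _         _ = z≤n
  unique-⊆⇒length≤ {x ∷ xs} (x∉ ∷ u) sub with ∈-∃++ (sub (here refl))
  ... | as , bs , refl =
    subst (suc (length xs) ≤_) (sym (↭-length (shift x as bs))) (s≤s (unique-⊆⇒length≤ u into))
    where
    into : ∀ {z} → z ∈ xs → z ∈ as ++ bs
    into z∈ with ∈-resp-↭ (shift x as bs) (sub (there z∈))
    ... | here refl = ⊥-elim (All.lookup x∉ z∈ refl)
    ... | there p = p

  unique-↭ : ∀ {xs ys : List A} → Unique xs → Unique ys →
    (∀ {z} → z ∈ xs → z ∈ ys) → (∀ {z} → z ∈ ys → z ∈ xs) → xs ↭ ys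
  unique-↭ u v f g = ∼bag⇒↭ (unique∧set⇒bag u v (mk⇔ f g))

  length-filter-split : ∀ {P : A → Set} (P? : Decidable P) xs →
    length xs ≡ length (filter P? xs) + length (filter (λ x → ¬? (P? x)) xs)
  length-filter-split P? [] = refl
  length-filter-split P? (x ∷ xs) with P? x
  ... | yes _ = cong suc (length-filter-split P? xs)
  ... | no  _ = trans (cong suc (length-filter-split P? xs)) (sym (Nat.+-suc _ _))

  length-fibres : ∀ {B : Set} (_≟B_ : (x y : B) → Dec (x ≡ y)) (φ : A → B) d (ts : List B)
    (xs : List A) → Unique xs → (∀ {x} → x ∈ xs → φ x ∈ ts) →
    (∀ t (ys : List A) → Unique ys → (∀ {y} → y ∈ ys → φ y ≡ t) → length ys ≤ d) →
    length xs ≤ length ts * d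
  length-fibres _≟B_ φ d []       []       _ _    _ = z≤n
  length-fibres _≟B_ φ d []       (x ∷ xs) _ into _ with into (here refl)
  ... | ()
  length-fibres _≟B_ φ d (t ∷ ts) xs u into small = begin
      length xs
    ≡⟨ length-filter-split P? xs ⟩
      length (filter P? xs) + length (filter (λ x → ¬? (P? x)) xs)
    ≤⟨ +-mono-≤
         (small t _ (Uniq.filter⁺ P? u) (λ y∈ → proj₂ (∈-filter⁻ P? {xs = xs} y∈)))
         (length-fibres _≟B_ φ d ts _ (Uniq.filter⁺ _ u) into' small) ⟩
      d + length ts * d
    ∎
    where
    open Nat.≤-Reasoning
    P? : Decidable (λ x → φ x ≡ t)
    P? x = φ x ≟B t
    into' : ∀ {x} → x ∈ filter (λ x → ¬? (P? x)) xs → φ x ∈ ts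
    into' x∈ with ∈-filter⁻ (λ x → ¬? (P? x)) x∈
    ... | x∈xs , φx≢t with into x∈xs
    ...   | here eq = ⊥-elim (φx≢t eq)
    ...   | there p = p

  ∑ : List A → (A → ℤ) → ℤ
  ∑ []       f = ℤ.0ℤ
  ∑ (x ∷ xs) f = f x +ℤ ∑ xs f

  ∑-cong : ∀ xs {f g : A → ℤ} → (∀ {x} → x ∈ xs → f x ≡ g x) → ∑ xs f ≡ ∑ xs g
  ∑-cong []       eq = refl
  ∑-cong (x ∷ xs) eq = cong₂ _+ℤ_ (eq (here refl)) (∑-cong xs (λ p → eq (there p)))

  ∑-zero : ∀ xs {f : A → ℤ} → (∀ {x} → x ∈ xs → f x ≡ ℤ.0ℤ) → ∑ xs f ≡ ℤ.0ℤ
  ∑-zero []       eq = refl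
  ∑-zero (x ∷ xs) eq = cong₂ _+ℤ_ (eq (here refl)) (∑-zero xs (λ p → eq (there p)))

  ∑-distrib-+ : ∀ xs (f g : A → ℤ) → ∑ xs (λ x → f x +ℤ g x) ≡ ∑ xs f +ℤ ∑ xs g
  ∑-distrib-+ []       f g = refl
  ∑-distrib-+ (x ∷ xs) f g =
    trans (cong (f x +ℤ g x +ℤ_) (∑-distrib-+ xs f g)) (interchange (f x) (g x) (∑ xs f) (∑ xs g))
    where
    interchange : ∀ a b c d → a +ℤ b +ℤ (c +ℤ d) ≡ a +ℤ c +ℤ (b +ℤ d)
    interchange = ℤ-ring

  ∑-distribʳ-* : ∀ xs (f : A → ℤ) c → ∑ xs (λ x → f x *ℤ c) ≡ ∑ xs f *ℤ c
  ∑-distribʳ-* []       f c = refl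
  ∑-distribʳ-* (x ∷ xs) f c =
    trans (cong (f x *ℤ c +ℤ_) (∑-distribʳ-* xs f c)) (sym (Int.*-distribʳ-+ c (f x) (∑ xs f)))

  ∑-const : ∀ xs c → ∑ xs (λ _ → c) ≡ + length xs *ℤ c
  ∑-const []       c = refl
  ∑-const (x ∷ xs) c = trans (cong (c +ℤ_) (∑-const xs c)) (sym (Int.suc-* (+ length xs) c))

  ∑-↭ : ∀ {xs ys} (f : A → ℤ) → xs ↭ ys → ∑ xs f ≡ ∑ ys f
  ∑-↭ f ↭refl = refl
  ∑-↭ f (↭prep x p) = cong (f x +ℤ_) (∑-↭ f p)
  ∑-↭ f (↭swap {xs} {ys} x y p) =
    trans (cong (λ s → f x +ℤ (f y +ℤ s)) (∑-↭ f p)) (exchange (f x) (f y) (∑ ys f))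
    where
    exchange : ∀ a b c → a +ℤ (b +ℤ c) ≡ b +ℤ (a +ℤ c)
    exchange = ℤ-ring
  ∑-↭ f (↭trans p q) = trans (∑-↭ f p) (∑-↭ f q)

  ∑-mono-≤ : ∀ xs {f g : A → ℤ} → (∀ {x} → x ∈ xs → f x ℤ.≤ g x) → ∑ xs f ℤ.≤ ∑ xs g
  ∑-mono-≤ []       le = Int.≤-refl
  ∑-mono-≤ (x ∷ xs) le = Int.+-mono-≤ (le (here refl)) (∑-mono-≤ xs (λ p → le (there p)))

∑-map : ∀ {A B : Set} (h : A → B) xs (f : B → ℤ) → ∑ (map h xs) f ≡ ∑ xs (λ x → f (h x))
∑-map h []       f = refl
∑-map h (x ∷ xs) f = cong (f (h x) +ℤ_) (∑-map h xs f)

∑-swap : ∀ {A B : Set} xs ys (f : A → B → ℤ) →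
  ∑ xs (λ x → ∑ ys (f x)) ≡ ∑ ys (λ y → ∑ xs (λ x → f x y))
∑-swap []       ys f = sym (∑-zero ys (λ _ → refl))
∑-swap (x ∷ xs) ys f =
  trans (cong (∑ ys (f x) +ℤ_) (∑-swap xs ys f)) (sym (∑-distrib-+ ys (f x) _))

-- Finite fields: inverses, Fermat's theorem, the characteristic.

module Field (K : FiniteField) where
  open FiniteField K public renaming (_+_ to infixl 6 _⊕_; _*_ to infixl 7 _·_; -_ to ⊖_)
  open IsCommutativeRing isCommutativeRing public
    using (+-assoc; +-comm; +-identityˡ; +-identityʳ; *-assoc; *-comm; *-identityˡ; *-identityʳ;
           zeroˡ; zeroʳ; distribˡ; distribʳ; -‿inverseˡ; -‿inverseʳ)

  commutativeRing : CommutativeRing _ _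
  commutativeRing = record { isCommutativeRing = isCommutativeRing }

  elements : List Carrier
  elements = map (Inverse.to enum) (allFin size)

  ∈-elements : ∀ x → x ∈ elements
  ∈-elements x = subst (_∈ elements) (Inverse.inverseˡ enum refl)
    (∈-map⁺ (Inverse.to enum) (∈-allFin (Inverse.from enum x)))

  elements-unique : Unique elements
  elements-unique = Uniq.map⁺ inj (Uniq.allFin⁺ size)
    where
    inj : ∀ {i j} → Inverse.to enum i ≡ Inverse.to enum j → i ≡ j
    inj {i} {j} eq = trans (sym (Inverse.inverseʳ enum refl)) (Inverse.inverseʳ enum eq)

  length-elements : length elements ≡ size
  length-elements = trans (length-map (Inverse.to enum) (allFin size)) (length-tabulate (λ i → i))

  inv : Carrier → Carrier
  inv x with x ≟ 0#
  ... | yes _ = 0#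
  ... | no x≢0 = proj₁ (inverse x x≢0)

  inv-0 : inv 0# ≡ 0#
  inv-0 with 0# ≟ 0#
  ... | yes _ = refl
  ... | no 0≢0 = ⊥-elim (0≢0 refl)

  inverseʳ : ∀ {x} → x ≢ 0# → x · inv x ≡ 1#
  inverseʳ {x} x≢0 with x ≟ 0#
  ... | yes x≡0 = ⊥-elim (x≢0 x≡0)
  ... | no  p = proj₂ (inverse x p)

  *-cancelˡ : ∀ {x y z} → x ≢ 0# → x · y ≡ x · z → y ≡ z
  *-cancelˡ {x} {y} {z} x≢0 eq = begin
    y ≡⟨ step y ⟨
    inv x · (x · y) ≡⟨ cong (inv x ·_) eq ⟩
    inv x · (x · z) ≡⟨ step z ⟩
    z ∎
    where
    open ≡-Reasoning
    step : ∀ w → inv x · (x · w) ≡ w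
    step w = trans (sym (*-assoc _ _ _))
      (trans (cong (_· w) (trans (*-comm _ _) (inverseʳ x≢0))) (*-identityˡ w))

  *-nonzero : ∀ {x y} → x ≢ 0# → y ≢ 0# → x · y ≢ 0#
  *-nonzero {x} x≢0 y≢0 eq = y≢0 (*-cancelˡ x≢0 (trans eq (sym (zeroʳ x))))

  *-zero-split : ∀ {x y} → x · y ≡ 0# → x ≡ 0# ⊎ y ≡ 0#
  *-zero-split {x} {y} eq with x ≟ 0# | y ≟ 0#
  ... | yes p | _ = inj₁ p
  ... | no  _ | yes q = inj₂ q
  ... | no  p | no q = ⊥-elim (*-nonzero p q eq)

  pow : Carrier → ℕ → Carrier
  pow x zero = 1#
  pow x (suc n) = x · pow x n

  nonzero? : Decidable (λ x → x ≢ 0#)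
  nonzero? x = ¬? (x ≟ 0#)

  nonzeros : List Carrier
  nonzeros = filter nonzero? elements

  nonzeros-unique : Unique nonzeros
  nonzeros-unique = Uniq.filter⁺ nonzero? elements-unique

  ∈-nonzeros : ∀ {x} → x ≢ 0# → x ∈ nonzeros
  ∈-nonzeros x≢0 = ∈-filter⁺ nonzero? (∈-elements _) x≢0

  ∈-nonzeros⁻ : ∀ {x} → x ∈ nonzeros → x ≢ 0#
  ∈-nonzeros⁻ x∈ = proj₂ (∈-filter⁻ nonzero? {xs = elements} x∈)

  size-nonzeros : size ≡ suc (length nonzeros)
  size-nonzeros = trans (sym length-elements) (↭-length
    (unique-↭ elements-unique
      (All.tabulate (λ x∈ 0≡x → ∈-nonzeros⁻ x∈ (sym 0≡x)) ∷ nonzeros-unique) to (λ _ → ∈-elements _)))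
    where
    to : ∀ {z} → z ∈ elements → z ∈ 0# ∷ nonzeros
    to {z} _ with z ≟ 0#
    ... | yes z≡0 = here z≡0
    ... | no z≢0 = there (∈-nonzeros z≢0)

  product : List Carrier → Carrier
  product = foldr _·_ 1#

  product-↭ : ∀ {xs ys} → xs ↭ ys → product xs ≡ product ys
  product-↭ ↭refl = refl
  product-↭ (↭prep x p) = cong (x ·_) (product-↭ p)
  product-↭ (↭swap x y p) = trans (sym (*-assoc x y _))
    (trans (cong₂ _·_ (*-comm x y) (product-↭ p)) (*-assoc y x _))
  product-↭ (↭trans p q) = trans (product-↭ p) (product-↭ q)

  product-nonzero : ∀ xs → (∀ {x} → x ∈ xs → x ≢ 0#) → product xs ≢ 0#
  product-nonzero []       _ = λ 1≡0 → 0≢1 (sym 1≡0)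
  product-nonzero (x ∷ xs) nz = *-nonzero (nz (here refl)) (product-nonzero xs (λ p → nz (there p)))

  product-map-· : ∀ a xs → product (map (a ·_) xs) ≡ pow a (length xs) · product xs
  product-map-· a [] = sym (*-identityˡ _)
  product-map-· a (x ∷ xs) = begin
    (a · x) · product (map (a ·_) xs) ≡⟨ cong ((a · x) ·_) (product-map-· a xs) ⟩
    (a · x) · (pow a (length xs) · product xs) ≡⟨ interchange a x _ _ ⟩
    (a · pow a (length xs)) · (x · product xs) ∎
    where
    open ≡-Reasoning
    interchange : ∀ a b c d → (a · b) · (c · d) ≡ (a · c) · (b · d)
    interchange a b c d = begin
      (a · b) · (c · d) ≡⟨ *-assoc a b _ ⟩
      a · (b · (c · d)) ≡⟨ cong (a ·_) (*-assoc b c d) ⟨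
      a · ((b · c) · d) ≡⟨ cong (λ t → a · (t · d)) (*-comm b c) ⟩
      a · ((c · b) · d) ≡⟨ cong (a ·_) (*-assoc c b d) ⟩
      a · (c · (b · d)) ≡⟨ *-assoc a c _ ⟨
      (a · c) · (b · d) ∎

  -- Multiplication by a permutes the nonzero elements, so their product absorbs the factor
  -- a^{size-1}.
  pow-nonzeros : ∀ {x} → x ≢ 0# → pow x (length nonzeros) ≡ 1#
  pow-nonzeros {a} a≢0 = *-cancelˡ (product-nonzero nonzeros ∈-nonzeros⁻) (begin
      product nonzeros · pow a (length nonzeros) ≡⟨ *-comm _ _ ⟩
      pow a (length nonzeros) · product nonzeros ≡⟨ product-map-· a nonzeros ⟨
      product (map (a ·_) nonzeros) ≡⟨ product-↭ permuted ⟩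
      product nonzeros ≡⟨ *-identityʳ _ ⟨
      product nonzeros · 1# ∎)
    where
    open ≡-Reasoning
    from : ∀ {z} → z ∈ map (a ·_) nonzeros → z ∈ nonzeros
    from z∈ with ∈-map⁻ (a ·_) z∈
    ... | x , x∈ , refl = ∈-nonzeros (*-nonzero a≢0 (∈-nonzeros⁻ x∈))
    to : ∀ {z} → z ∈ nonzeros → z ∈ map (a ·_) nonzeros
    to {z} z∈ = subst (_∈ map (a ·_) nonzeros) back
      (∈-map⁺ (a ·_) (∈-nonzeros (*-nonzero inv≢0 (∈-nonzeros⁻ z∈))))
      where
      inv≢0 : inv a ≢ 0#
      inv≢0 eq = 0≢1 (trans (sym (zeroʳ a)) (trans (cong (a ·_) (sym eq)) (inverseʳ a≢0)))
      back : a · (inv a · z) ≡ z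
      back = trans (sym (*-assoc _ _ _)) (trans (cong (_· z) (inverseʳ a≢0)) (*-identityˡ z))
    permuted : map (a ·_) nonzeros ↭ nonzeros
    permuted = unique-↭ (Uniq.map⁺ (*-cancelˡ a≢0) nonzeros-unique) nonzeros-unique from to

  fermat : ∀ x → pow x size ≡ x
  fermat x = subst (λ k → pow x k ≡ x) (sym size-nonzeros) go
    where
    go : x · pow x (length nonzeros) ≡ x
    go with x ≟ 0#
    ... | yes refl = zeroˡ _
    ... | no x≢0 = trans (cong (x ·_) (pow-nonzeros x≢0)) (*-identityʳ x)

  ⊖1-sq : ⊖ 1# · ⊖ 1# ≡ 1#
  ⊖1-sq = begin
    ⊖ 1# · ⊖ 1# ≡⟨ +-identityʳ _ ⟨
    ⊖ 1# · ⊖ 1# ⊕ 0# ≡⟨ cong (⊖ 1# · ⊖ 1# ⊕_) (-‿inverseˡ 1#) ⟨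
    ⊖ 1# · ⊖ 1# ⊕ (⊖ 1# ⊕ 1#) ≡⟨ +-assoc _ _ _ ⟨
    ⊖ 1# · ⊖ 1# ⊕ ⊖ 1# ⊕ 1# ≡⟨ cong (_⊕ 1#) (cong (⊖ 1# · ⊖ 1# ⊕_) (*-identityʳ _)) ⟨
    ⊖ 1# · ⊖ 1# ⊕ ⊖ 1# · 1# ⊕ 1# ≡⟨ cong (_⊕ 1#) (distribˡ _ _ _) ⟨
    ⊖ 1# · (⊖ 1# ⊕ 1#) ⊕ 1# ≡⟨ cong (λ t → ⊖ 1# · t ⊕ 1#) (-‿inverseˡ 1#) ⟩
    ⊖ 1# · 0# ⊕ 1# ≡⟨ cong (_⊕ 1#) (zeroʳ _) ⟩
    0# ⊕ 1# ≡⟨ +-identityˡ 1# ⟩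
    1# ∎
    where open ≡-Reasoning

  pow-⊖1-even : ∀ m → pow (⊖ 1#) (m + m) ≡ 1#
  pow-⊖1-even zero = refl
  pow-⊖1-even (suc m) = begin
    ⊖ 1# · pow (⊖ 1#) (m + suc m) ≡⟨ cong (λ k → ⊖ 1# · pow (⊖ 1#) k) (Nat.+-suc m m) ⟩
    ⊖ 1# · (⊖ 1# · pow (⊖ 1#) (m + m)) ≡⟨ *-assoc _ _ _ ⟨
    ⊖ 1# · ⊖ 1# · pow (⊖ 1#) (m + m) ≡⟨ cong₂ _·_ ⊖1-sq (pow-⊖1-even m) ⟩
    1# · 1# ≡⟨ *-identityˡ 1# ⟩
    1# ∎
    where open ≡-Reasoning

  -- By `fermat`, -1 equals its own power with even exponent `size`, which is 1.
  even-size⇒char2 : ∀ m → size ≡ m + m → 1# ⊕ 1# ≡ 0#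
  even-size⇒char2 m eq = trans (cong (1# ⊕_) 1≡-1) (-‿inverseʳ 1#)
    where
    1≡-1 : 1# ≡ ⊖ 1#
    1≡-1 = trans (sym (pow-⊖1-even m)) (trans (cong (pow (⊖ 1#)) (sym eq)) (fermat (⊖ 1#)))

  pow-+ : ∀ x m n → pow x (m + n) ≡ pow x m · pow x n
  pow-+ x zero    n = sym (*-identityˡ _)
  pow-+ x (suc m) n = trans (cong (x ·_) (pow-+ x m n)) (sym (*-assoc x _ _))

  1<size : 1 < size
  1<size = subst (1 <_) (sym size-nonzeros) (s≤s (nonempty (∈-nonzeros (λ 1≡0 → 0≢1 (sym 1≡0)))))
    where
    nonempty : ∀ {x} {xs : List Carrier} → x ∈ xs → 0 < length xs
    nonempty (here _) = s≤s z≤n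
    nonempty (there _) = s≤s z≤n

-- Pigeonhole principle and elementary arithmetic.

Vec-↔ : ∀ {A : Set} {c} n → A ↔ Fin c → Vec A n ↔ Fin (c ^ n)
Vec-↔ zero    A↔ = mk↔ₛ′ (λ _ → Fin.zero) (λ _ → []) (λ { Fin.zero → refl ; (Fin.suc ()) }) (λ { [] → refl })
Vec-↔ (suc n) A↔ = ↔-sym Finₚ.*↔× ↔-∘ ((A↔ ×-↔ Vec-↔ n A↔) ↔-∘ uncons)
  where
  uncons = mk↔ₛ′ (λ { (x ∷ xs) → x , xs }) (λ { (x , xs) → x ∷ xs }) (λ { (x , xs) → refl }) (λ { (x ∷ xs) → refl })

pigeonhole-↔ : ∀ {A B : Set} {m k} → A ↔ Fin m → B ↔ Fin k → k < m → (f : A → B) →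
  ∃ λ a → ∃ λ a' → a ≢ a' × f a ≡ f a'
pigeonhole-↔ A↔ B↔ k<m f
  with i , j , i<j , eq ← Finₚ.pigeonhole k<m (λ i → Inverse.to B↔ (f (Inverse.from A↔ i)))
  = Inverse.from A↔ i , Inverse.from A↔ j
  , (λ a≡a' → Finₚ.<⇒≢ i<j (injective (↔-sym A↔) a≡a'))
  , injective B↔ eq
  where
  injective : ∀ {X Y : Set} (F : X ↔ Y) {x y} → Inverse.to F x ≡ Inverse.to F y → x ≡ y
  injective F {x} eq = trans (sym (Inverse.inverseʳ F refl)) (Inverse.inverseʳ F eq)

≤-by : ∀ {m n} k → m + k ≡ n → m ≤ n
≤-by {m} k refl = m≤m+n m k

-- Modulo 2q the left side has its residue in [0, q) and the right side in [q, 2q).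
residue-≢ : ∀ {a0 a1 i k q} → a0 < q → a1 < q → a0 + (q + q) * i ≢ a1 + ((q + q) * k + q)
residue-≢ {a0} {a1} {i} {k} {q} a0< a1< eq with i Nat.≤? k
... | yes i≤k = Nat.<-irrefl eq (begin-strict
    a0 + (q + q) * i <⟨ Nat.+-mono-<-≤ a0< (*-monoʳ-≤ (q + q) i≤k) ⟩
    q + (q + q) * k ≡⟨ Nat.+-comm q _ ⟩
    (q + q) * k + q ≤⟨ m≤n+m _ a1 ⟩
    a1 + ((q + q) * k + q) ∎)
  where open Nat.≤-Reasoning
... | no i≰k = Nat.<-irrefl (sym eq) (begin-strict
    a1 + ((q + q) * k + q) <⟨ Nat.+-monoˡ-< _ a1< ⟩
    q + ((q + q) * k + q) ≡⟨ regroup q k ⟩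
    (q + q) * suc k ≤⟨ *-monoʳ-≤ (q + q) (Nat.≰⇒> i≰k) ⟩
    (q + q) * i ≤⟨ m≤n+m _ a0 ⟩
    a0 + (q + q) * i ∎)
  where
  open Nat.≤-Reasoning
  regroup : ∀ q k → q + ((q + q) * k + q) ≡ (q + q) * suc k
  regroup = ℕ-ring

2^suc : ∀ k → 2 ^ suc k ≡ 2 ^ k + 2 ^ k
2^suc k = cong (λ u → 2 ^ k + u) (Nat.+-identityʳ (2 ^ k))

2^>0 : ∀ k → 0 < 2 ^ k
2^>0 k = m^n>0 2 k

-- Characteristic 2: Frobenius and its fixed subfields.

HasChar2 : FiniteField → Set
HasChar2 K = FiniteField._+_ K (FiniteField.1# K) (FiniteField.1# K) ≡ FiniteField.0# K

module Char2 (K : FiniteField) (char2 : HasChar2 K) where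
  open Field K public

  private
    carrierRing : AlmostCommutativeRing _ _
    carrierRing = fromCommutativeSemiring (CommutativeRing.commutativeSemiring commutativeRing)

    fromBool : CommutativeRing.rawRing Boolₚ.xor-∧-commutativeRing -Raw-AlmostCommutative⟶ carrierRing
    fromBool = record
      { ⟦_⟧ = λ { true → 1# ; false → 0# }
      ; +-homo = λ { true true → sym char2 ; true false → sym (+-identityʳ _)
                   ; false _ → sym (+-identityˡ _) }
      ; *-homo = λ { true _ → sym (*-identityˡ _) ; false _ → sym (zeroˡ _) }
      ; -‿homo = λ _ → refl
      ; 0-homo = refl
      ; 1-homo = refl
      }

    coefficient-≟ : ∀ a b → Maybe (_-Raw-AlmostCommutative⟶_.⟦_⟧ fromBool a ≡ _-Raw-AlmostCommutative⟶_.⟦_⟧ fromBool b)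
    coefficient-≟ true  true = just refl
    coefficient-≟ false false = just refl
    coefficient-≟ _     _ = nothing

  -- Coefficients in GF(2), so that the ring solver knows x ⊕ x ≡ 0#.
  open Algebra.Solver.Ring (CommutativeRing.rawRing Boolₚ.xor-∧-commutativeRing) carrierRing fromBool
    coefficient-≟ public
    using (solve; _:=_; _:+_; _:*_; con)

  x⊕x : ∀ x → x ⊕ x ≡ 0#
  x⊕x = solve 1 (λ x → x :+ x := con false) refl

  ⊕-≡0⇒≡ : ∀ {x y} → x ⊕ y ≡ 0# → x ≡ y
  ⊕-≡0⇒≡ {x} {y} eq = trans (solve 2 (λ x y → x := (x :+ y) :+ y) refl x y)
    (trans (cong (_⊕ y) eq) (+-identityˡ y))

  ≡⇒⊕-≡0 : ∀ {x y} → x ≡ y → x ⊕ y ≡ 0#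
  ≡⇒⊕-≡0 {x} refl = x⊕x x

  ⊕-cancelˡ : ∀ x {y z} → x ⊕ y ≡ x ⊕ z → y ≡ z
  ⊕-cancelˡ x {y} {z} eq = ⊕-≡0⇒≡ (trans
    (solve 3 (λ x y z → y :+ z := (x :+ y) :+ (x :+ z)) refl x y z)
    (≡⇒⊕-≡0 eq))

  ⊕-shift : ∀ {x y z} → x ⊕ y ≡ z → x ≡ z ⊕ y
  ⊕-shift {x} {y} refl = solve 2 (λ x y → x := (x :+ y) :+ y) refl x y

  sq : Carrier → Carrier
  sq x = x · x

  sq-injective : ∀ {x y} → sq x ≡ sq y → x ≡ y
  sq-injective {x} {y} eq with *-zero-split
    (trans (solve 2 (λ x y → (x :+ y) :* (x :+ y) := x :* x :+ y :* y) refl x y) (≡⇒⊕-≡0 eq))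
  ... | inj₁ p = ⊕-≡0⇒≡ p
  ... | inj₂ p = ⊕-≡0⇒≡ p

  sq-fixed : ∀ {x} → sq x ≡ x → x ≡ 0# ⊎ x ≡ 1#
  sq-fixed {x} eq with *-zero-split {x} {x ⊕ 1#}
    (trans (solve 1 (λ x → x :* (x :+ con true) := x :* x :+ x) refl x) (≡⇒⊕-≡0 eq))
  ... | inj₁ p = inj₁ p
  ... | inj₂ p = inj₂ (⊕-≡0⇒≡ p)

  -- The power x^{2^k}, by repeated squaring so that additivity and multiplicativity follow by
  -- induction on k.
  fr : ℕ → Carrier → Carrier
  fr zero    x = x
  fr (suc k) x = sq (fr k x)

  fr-0 : ∀ k → fr k 0# ≡ 0#
  fr-0 zero = refl
  fr-0 (suc k) = trans (cong sq (fr-0 k)) (zeroˡ 0#)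

  fr-1 : ∀ k → fr k 1# ≡ 1#
  fr-1 zero = refl
  fr-1 (suc k) = trans (cong sq (fr-1 k)) (*-identityˡ 1#)

  fr-⊕ : ∀ k x y → fr k (x ⊕ y) ≡ fr k x ⊕ fr k y
  fr-⊕ zero    x y = refl
  fr-⊕ (suc k) x y = trans (cong sq (fr-⊕ k x y))
    (solve 2 (λ x y → (x :+ y) :* (x :+ y) := x :* x :+ y :* y) refl _ _)

  fr-· : ∀ k x y → fr k (x · y) ≡ fr k x · fr k y
  fr-· zero    x y = refl
  fr-· (suc k) x y = trans (cong sq (fr-· k x y))
    (solve 2 (λ x y → (x :* y) :* (x :* y) := (x :* x) :* (y :* y)) refl _ _)

  fr-+ : ∀ j k x → fr (j + k) x ≡ fr j (fr k x)
  fr-+ zero    k x = refl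
  fr-+ (suc j) k x = cong sq (fr-+ j k x)

  fr-sq : ∀ k x → fr k (sq x) ≡ sq (fr k x)
  fr-sq k x = fr-· k x x

  fr-injective : ∀ k {x y} → fr k x ≡ fr k y → x ≡ y
  fr-injective zero    eq = eq
  fr-injective (suc k) eq = fr-injective k (sq-injective eq)

  fr-nonzero : ∀ k {x} → x ≢ 0# → fr k x ≢ 0#
  fr-nonzero k x≢0 eq = x≢0 (fr-injective k (trans eq (sym (fr-0 k))))

  pow-2^ : ∀ k x → pow x (2 ^ k) ≡ fr k x
  pow-2^ zero    x = *-identityʳ x
  pow-2^ (suc k) x = trans (cong (pow x) (2^suc k))
    (trans (pow-+ x (2 ^ k) (2 ^ k)) (cong sq (pow-2^ k x)))

  fr-fixed-* : ∀ k j {x} → fr k x ≡ x → fr (j * k) x ≡ x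
  fr-fixed-* k zero    eq = refl
  fr-fixed-* k (suc j) {x} eq = trans (fr-+ k (j * k) x) (trans (cong (fr k) (fr-fixed-* k j eq)) eq)

  -- Membership in 𝔽_{2^k}, when k divides the degree of K. Subfields get no carrier type of their
  -- own; all computation stays inside K.
  Fixed : ℕ → Carrier → Set
  Fixed k x = fr k x ≡ x

  fixed-0 : ∀ k → Fixed k 0#
  fixed-0 k = fr-0 k

  fixed-1 : ∀ k → Fixed k 1#
  fixed-1 k = fr-1 k

  fixed-⊕ : ∀ k {x y} → Fixed k x → Fixed k y → Fixed k (x ⊕ y)
  fixed-⊕ k {x} {y} p q = trans (fr-⊕ k x y) (cong₂ _⊕_ p q)

  fixed-· : ∀ k {x y} → Fixed k x → Fixed k y → Fixed k (x · y)
  fixed-· k {x} {y} p q = trans (fr-· k x y) (cong₂ _·_ p q)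

  fixed-inv : ∀ k {x} → Fixed k x → Fixed k (inv x)
  fixed-inv k {x} p with x ≟ 0#
  fixed-inv k {x} p | yes _ = fr-0 k
  fixed-inv k {x} p | no x≢0 = *-cancelˡ x≢0 (begin
      x · fr k y ≡⟨ cong (_· fr k y) p ⟨
      fr k x · fr k y ≡⟨ fr-· k x y ⟨
      fr k (x · y) ≡⟨ cong (fr k) (proj₂ (inverse x x≢0)) ⟩
      fr k 1# ≡⟨ fr-1 k ⟩
      1# ≡⟨ proj₂ (inverse x x≢0) ⟨
      x · y ∎)
    where
    open ≡-Reasoning
    y = proj₁ (inverse x x≢0)

  inverseˡ : ∀ {x} → x ≢ 0# → inv x · x ≡ 1#
  inverseˡ x≢0 = trans (*-comm _ _) (inverseʳ x≢0)

  inv-nonzero : ∀ {x} → x ≢ 0# → inv x ≢ 0#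
  inv-nonzero {x} x≢0 eq = 0≢1 (trans (sym (zeroʳ x)) (trans (cong (x ·_) (sym eq)) (inverseʳ x≢0)))

  inv-unique : ∀ {x y} → x · y ≡ 1# → y ≡ inv x
  inv-unique {x} {y} eq = *-cancelˡ x≢0 (trans eq (sym (inverseʳ x≢0)))
    where
    x≢0 : x ≢ 0#
    x≢0 refl = 0≢1 (trans (sym (zeroˡ y)) eq)

  inv-involutive : ∀ x → inv (inv x) ≡ x
  inv-involutive x with x ≟ 0#
  inv-involutive x | yes refl = inv-0
  inv-involutive x | no x≢0 =
    sym (inv-unique (trans (*-comm _ x) (proj₂ (inverse x x≢0))))

  Fix : ℕ → List Carrier
  Fix k = filter (λ x → fr k x ≟ x) elements

  Fix-unique : ∀ k → Unique (Fix k)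
  Fix-unique k = Uniq.filter⁺ _ elements-unique

  ∈-Fix⁺ : ∀ k {x} → Fixed k x → x ∈ Fix k
  ∈-Fix⁺ k p = ∈-filter⁺ (λ x → fr k x ≟ x) (∈-elements _) p

  ∈-Fix⁻ : ∀ k {x} → x ∈ Fix k → Fixed k x
  ∈-Fix⁻ k p = proj₂ (∈-filter⁻ (λ x → fr k x ≟ x) {xs = elements} p)

  _∈?_ : ∀ x xs → Dec (x ∈ xs)
  x ∈? xs = Any.any? (x ≟_) xs

  -- Additive subgroups and the order of K.

  record Subgroup (i : ℕ) : Set where
    field
      list : List Carrier
      unique : Unique list
      closed : ∀ {x y} → x ∈ list → y ∈ list → x ⊕ y ∈ list
      has-0 : 0# ∈ list
      card : length list ≡ 2 ^ i

  open Subgroup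

  double : ∀ {i} (S : Subgroup i) a → a ∉ list S → Subgroup (suc i)
  double {i} S a a∉ = record
    { list = list S ++ coset
    ; unique = Uniq.++⁺ (unique S) (Uniq.map⁺ (⊕-cancelˡ a) (unique S)) disjoint
    ; closed = closed'
    ; has-0 = ∈-++⁺ˡ (has-0 S)
    ; card = trans (length-++ (list S))
        (trans (cong₂ _+_ (card S) (trans (length-map _ (list S)) (card S))) (sym (2^suc i)))
    }
    where
    coset = map (a ⊕_) (list S)
    disjoint : ∀ {z} → ¬ (z ∈ list S × z ∈ coset)
    disjoint (z∈ , z∈') with ∈-map⁻ (a ⊕_) z∈'
    ... | x , x∈ , refl = a∉ (subst (_∈ list S)
      (solve 2 (λ a x → (a :+ x) :+ x := a) refl a x) (closed S z∈ x∈))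
    closed' : ∀ {x y} → x ∈ list S ++ coset → y ∈ list S ++ coset → x ⊕ y ∈ list S ++ coset
    closed' x∈ y∈ with ∈-++⁻ (list S) x∈ | ∈-++⁻ (list S) y∈
    ... | inj₁ p | inj₁ q = ∈-++⁺ˡ (closed S p q)
    ... | inj₁ p | inj₂ q with ∈-map⁻ (a ⊕_) q
    ...   | y , y∈S , refl = ∈-++⁺ʳ (list S) (subst (_∈ coset)
            (solve 3 (λ a x y → a :+ (x :+ y) := x :+ (a :+ y)) refl a _ y)
            (∈-map⁺ (a ⊕_) (closed S p y∈S)))
    closed' x∈ y∈ | inj₂ p | inj₁ q with ∈-map⁻ (a ⊕_) p
    ...   | x , x∈S , refl = ∈-++⁺ʳ (list S) (subst (_∈ coset)
            (solve 3 (λ a x y → a :+ (x :+ y) := (a :+ x) :+ y) refl a x _)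
            (∈-map⁺ (a ⊕_) (closed S x∈S q)))
    closed' x∈ y∈ | inj₂ p | inj₂ q with ∈-map⁻ (a ⊕_) p | ∈-map⁻ (a ⊕_) q
    ...   | x , x∈S , refl | y , y∈S , refl = ∈-++⁺ˡ (subst (_∈ list S)
            (solve 3 (λ a x y → x :+ y := (a :+ x) :+ (a :+ y)) refl a x y)
            (closed S x∈S y∈S))

  trivial-subgroup : Subgroup 0
  trivial-subgroup = record
    { list = 0# ∷ []
    ; unique = [] ∷ []
    ; closed = λ { (here refl) (here refl) → here (+-identityˡ 0#) }
    ; has-0 = here refl
    ; card = refl
    }

  -- An additive subgroup that misses an element can be doubled by a coset; once it is everything,
  -- its order is the size. The fuel cannot run out because i < 2^i ≤ size.
  size-power-of-2 : ∃ λ N → size ≡ 2 ^ N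
  size-power-of-2 = grow size trivial-subgroup ≤-refl
    where
    i<2^i : ∀ i → i < 2 ^ i
    i<2^i zero = s≤s z≤n
    i<2^i (suc i) = subst (suc (suc i) ≤_) (sym (2^suc i)) (+-mono-≤ (2^>0 i) (i<2^i i))
    grow : ∀ fuel {i} (S : Subgroup i) → size ≤ i + fuel → ∃ λ N → size ≡ 2 ^ N
    grow fuel {i} S le with All.all? (λ x → x ∈? list S) elements
    ... | yes all = i , (begin
        size ≡⟨ length-elements ⟨
        length elements ≡⟨ ↭-length (unique-↭ elements-unique (unique S)
                              (All.lookup all) (λ _ → ∈-elements _)) ⟩
        length (list S) ≡⟨ card S ⟩
        2 ^ i ∎)
      where open ≡-Reasoning
    grow zero {i} S le | no _ = ⊥-elim (Nat.<-irrefl refl (begin-strict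
        i <⟨ i<2^i i ⟩
        2 ^ i ≡⟨ card S ⟨
        length (list S) ≤⟨ unique-⊆⇒length≤ (unique S) (λ _ → ∈-elements _) ⟩
        length elements ≡⟨ length-elements ⟩
        size ≤⟨ le ⟩
        i + 0 ≡⟨ Nat.+-identityʳ i ⟩
        i ∎))
      where open Nat.≤-Reasoning
    grow (suc fuel) {i} S le | no ¬all with Any.satisfied (¬All⇒Any¬ (λ x → x ∈? list S) elements ¬all)
    ... | a , a∉ = grow fuel (double S a a∉) (subst (size ≤_) (Nat.+-suc i fuel) le)

  -- Polynomial functions, degrees and roots.

  -- Poly n a f: the function f is given by a polynomial of degree at most n, with a
  -- (possibly zero) as its coefficient of xⁿ.
  data Poly : ℕ → Carrier → (Carrier → Carrier) → Set where
    const : ∀ {a f} → (∀ x → f x ≡ a) → Poly 0 a f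
    step : ∀ {n a f} c g → Poly n a g → (∀ x → f x ≡ c ⊕ x · g x) → Poly (suc n) a f

  poly-ext : ∀ {n a f g} → (∀ x → f x ≡ g x) → Poly n a g → Poly n a f
  poly-ext eq (const p) = const (λ x → trans (eq x) (p x))
  poly-ext eq (step c h p r) = step c h p (λ x → trans (eq x) (r x))

  poly-coef : ∀ {n a b f} → a ≡ b → Poly n a f → Poly n b f
  poly-coef refl p = p

  poly-deg : ∀ {n m a f} → n ≡ m → Poly n a f → Poly m a f
  poly-deg refl p = p

  poly-0 : ∀ n → Poly n 0# (λ _ → 0#)
  poly-0 zero = const (λ _ → refl)
  poly-0 (suc n) = step 0# _ (poly-0 n) (λ x → sym (trans (+-identityˡ _) (zeroʳ x)))

  poly-id : Poly 1 1# (λ x → x)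
  poly-id = step 0# (λ _ → 1#) (const (λ _ → refl)) (λ x → sym (trans (+-identityˡ _) (*-identityʳ x)))

  poly-raise : ∀ {n a f} → Poly n a f → Poly (suc n) 0# f
  poly-raise {a = a} (const p) = step a _ (poly-0 0)
    (λ x → trans (p x) (sym (trans (cong (a ⊕_) (zeroʳ x)) (+-identityʳ a))))
  poly-raise (step c g p r) = step c g (poly-raise p) r

  poly-⊕ : ∀ {n a b f g} → Poly n a f → Poly n b g → Poly n (a ⊕ b) (λ x → f x ⊕ g x)
  poly-⊕ (const p)      (const q) = const (λ x → cong₂ _⊕_ (p x) (q x))
  poly-⊕ (step c h p r) (step d k q s) = step (c ⊕ d) _ (poly-⊕ p q) (λ x → trans (cong₂ _⊕_ (r x) (s x))
    (solve 5 (λ c d x u v → (c :+ x :* u) :+ (d :+ x :* v) := (c :+ d) :+ x :* (u :+ v)) refl c d x _ _))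

  poly-scale : ∀ {n a f} c → Poly n a f → Poly n (c · a) (λ x → c · f x)
  poly-scale c (const p) = const (λ x → cong (c ·_) (p x))
  poly-scale c (step d g p r) = step (c · d) _ (poly-scale c p) (λ x → trans (cong (c ·_) (r x))
    (solve 4 (λ c d x u → c :* (d :+ x :* u) := c :* d :+ x :* (c :* u)) refl c d x _))

  poly-shift : ∀ {n a f} → Poly n a f → Poly (suc n) a (λ x → x · f x)
  poly-shift {f = f} p = step 0# f p (λ x → sym (+-identityˡ _))

  poly-mono-< : ∀ {n m a f} → n < m → Poly n a f → Poly m 0# f
  poly-mono-< {n} {suc m} (s≤s n≤m) p with Nat.m≤n⇒m<n∨m≡n n≤m
  ... | inj₁ n<m = poly-raise (poly-mono-< n<m p)
  ... | inj₂ refl = poly-raise p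

  poly-⊕-lower : ∀ {n m a b f g} → m < n → Poly n a f → Poly m b g → Poly n a (λ x → f x ⊕ g x)
  poly-⊕-lower m<n p q = poly-coef (+-identityʳ _) (poly-⊕ p (poly-mono-< m<n q))

  poly-· : ∀ {n m a b f g} → Poly n a f → Poly m b g → Poly (n + m) (a · b) (λ x → f x · g x)
  poly-· {a = a} {g = g} (const p) q = poly-ext (λ x → cong (_· g x) (p x)) (poly-scale a q)
  poly-· {suc n} {m} {g = g} (step c h p r) q =
    poly-ext (λ x → trans (cong (_· g x) (r x))
      (solve 4 (λ c x u v → (c :+ x :* u) :* v := x :* (u :* v) :+ c :* v) refl c x (h x) (g x)))
      (poly-⊕-lower (s≤s (m≤n+m m n)) (poly-shift (poly-· p q)) (poly-scale c q))

  poly-fr : ∀ k {n a f} → Poly n a f → Poly (2 ^ k * n) (fr k a) (λ x → fr k (f x))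
  poly-fr zero    {n} p = poly-deg (sym (Nat.+-identityʳ n)) p
  poly-fr (suc k) {n} p = poly-deg
    (trans (sym (Nat.*-distribʳ-+ n (2 ^ k) (2 ^ k))) (cong (_* n) (sym (2^suc k))))
    (poly-· (poly-fr k p) (poly-fr k p))

  poly-divide : ∀ {n a f} → Poly (suc n) a f → ∀ r →
    ∃ λ g → Poly n a g × ∀ x → f x ≡ (x ⊕ r) · g x ⊕ f r
  poly-divide {zero} {a} {f} (step c g (const p) s) r = g , const p , λ x → begin
      f x ≡⟨ at x ⟩
      c ⊕ x · a ≡⟨ solve 4 (λ c x r a → c :+ x :* a := (x :+ r) :* a :+ (c :+ r :* a)) refl c x r a ⟩
      (x ⊕ r) · a ⊕ (c ⊕ r · a) ≡⟨ cong₂ (λ u v → (x ⊕ r) · u ⊕ v) (p x) (at r) ⟨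
      (x ⊕ r) · g x ⊕ f r ∎
    where
    open ≡-Reasoning
    at : ∀ x → f x ≡ c ⊕ x · a
    at x = trans (s x) (cong (λ u → c ⊕ x · u) (p x))
  poly-divide {suc n} {a} {f} (step c g p s) r with poly-divide p r
  ... | h , q , t = (λ x → x · h x ⊕ g r) , step (g r) h q (λ x → +-comm _ _) , λ x → begin
      f x ≡⟨ trans (s x) (cong (λ u → c ⊕ x · u) (t x)) ⟩
      c ⊕ x · ((x ⊕ r) · h x ⊕ g r) ≡⟨ solve 5 (λ c x r u v → c :+ x :* ((x :+ r) :* u :+ v)
                                                     := (x :+ r) :* (x :* u :+ v) :+ (c :+ r :* v)) refl c x r (h x) (g r) ⟩
      (x ⊕ r) · (x · h x ⊕ g r) ⊕ (c ⊕ r · g r) ≡⟨ cong ((x ⊕ r) · (x · h x ⊕ g r) ⊕_) (s r) ⟨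
      (x ⊕ r) · (x · h x ⊕ g r) ⊕ f r ∎
    where open ≡-Reasoning

  length-roots : ∀ {n a f} → Poly n a f → a ≢ 0# → ∀ {xs} → Unique xs →
    (∀ {x} → x ∈ xs → f x ≡ 0#) → length xs ≤ n
  length-roots p         a≢0 {[]}     _        _ = z≤n
  length-roots (const p) a≢0 {x ∷ xs} _        root = ⊥-elim (a≢0 (trans (sym (p x)) (root (here refl))))
  length-roots {suc n} {f = f} p@(step _ _ _ _) a≢0 {r ∷ xs} (r∉ ∷ u) root with poly-divide p r
  ... | g , q , eq = s≤s (length-roots q a≢0 u root')
    where
    root' : ∀ {x} → x ∈ xs → g x ≡ 0#
    root' {x} x∈ with *-zero-split {x ⊕ r} {g x} (trans (sym (trans (eq x)
                        (trans (cong ((x ⊕ r) · g x ⊕_) (root (here refl))) (+-identityʳ _)))) (root (there x∈)))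
    ... | inj₁ x⊕r≡0 = ⊥-elim (All.lookup r∉ x∈ (sym (⊕-≡0⇒≡ x⊕r≡0)))
    ... | inj₂ gx≡0 = gx≡0

  Deg≤ : ℕ → (Carrier → Carrier) → Set
  Deg≤ n f = ∃ λ a → Poly n a f

  -- A property of a representation: since x^size = x on K, one function may have several degrees.
  -- What is drawn from it is a bound on the number of roots, and this holds for every
  -- representation with nonzero leading coefficient.
  Degree : ℕ → (Carrier → Carrier) → Set
  Degree n f = ∃ λ a → a ≢ 0# × Poly n a f

  degree-cast : ∀ {n m f} → n ≡ m → Degree n f → Degree m f
  degree-cast refl d = d

  degree⇒deg≤ : ∀ {n f} → Degree n f → Deg≤ n f
  degree⇒deg≤ (a , _ , p) = a , p

  deg≤-mono : ∀ {n m f} → n ≤ m → Deg≤ n f → Deg≤ m f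
  deg≤-mono n≤m (a , p) with Nat.m≤n⇒m<n∨m≡n n≤m
  ... | inj₁ n<m = 0# , poly-mono-< n<m p
  ... | inj₂ refl = a , p

  deg≤-⊕ : ∀ {n f g} → Deg≤ n f → Deg≤ n g → Deg≤ n (λ x → f x ⊕ g x)
  deg≤-⊕ (a , p) (b , q) = a ⊕ b , poly-⊕ p q

  deg≤-· : ∀ {n m f g} → Deg≤ n f → Deg≤ m g → Deg≤ (n + m) (λ x → f x · g x)
  deg≤-· (a , p) (b , q) = a · b , poly-· p q

  deg≤-fr : ∀ k {n f} → Deg≤ n f → Deg≤ (2 ^ k * n) (λ x → fr k (f x))
  deg≤-fr k (a , p) = fr k a , poly-fr k p

  deg≤-ext : ∀ {n f g} → (∀ x → f x ≡ g x) → Deg≤ n g → Deg≤ n f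
  deg≤-ext eq (a , p) = a , poly-ext eq p

  degree-⊕-lower : ∀ {n m f g} → m < n → Degree n f → Deg≤ m g → Degree n (λ x → f x ⊕ g x)
  degree-⊕-lower m<n (a , a≢0 , p) (b , q) = a , a≢0 , poly-⊕-lower m<n p q

  degree-· : ∀ {n m f g} → Degree n f → Degree m g → Degree (n + m) (λ x → f x · g x)
  degree-· (a , a≢0 , p) (b , b≢0 , q) = a · b , *-nonzero a≢0 b≢0 , poly-· p q

  degree-ext : ∀ {n f g} → (∀ x → f x ≡ g x) → Degree n g → Degree n f
  degree-ext eq (a , a≢0 , p) = a , a≢0 , poly-ext eq p

  degree-fr-id : ∀ k → Degree (2 ^ k) (fr k)
  degree-fr-id k = 1# , (λ 1≡0 → 0≢1 (sym 1≡0)) ,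
    poly-coef (fr-1 k) (poly-deg (Nat.*-identityʳ (2 ^ k)) (poly-fr k poly-id))

  degree-roots : ∀ {n f} → Degree n f → ∀ {xs} → Unique xs →
    (∀ {x} → x ∈ xs → f x ≡ 0#) → length xs ≤ n
  degree-roots (_ , a≢0 , p) = length-roots p a≢0

  evaluate : ∀ {n} → Vec Carrier n → Carrier → Carrier
  evaluate []       x = 0#
  evaluate (c ∷ cs) x = c ⊕ x · evaluate cs x

  poly-coefficients : ∀ {n a f} → Poly n a f → ∃ λ (cs : Vec Carrier (suc n)) → ∀ x → f x ≡ evaluate cs x
  poly-coefficients {a = a} (const p) = a ∷ [] , λ x →
    trans (p x) (sym (trans (cong (a ⊕_) (zeroʳ x)) (+-identityʳ a)))
  poly-coefficients (step c g p r) with poly-coefficients p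
  ... | cs , eq = c ∷ cs , λ x → trans (r x) (cong (λ u → c ⊕ x · u) (eq x))

  length-Fix≤ : ∀ k → 1 ≤ k → length (Fix k) ≤ 2 ^ k
  length-Fix≤ k 1≤k = degree-roots
    (degree-⊕-lower (^-monoʳ-< 2 (s≤s (s≤s z≤n)) 1≤k) (degree-fr-id k) (1# , poly-id))
    (Fix-unique k) (λ x∈ → ≡⇒⊕-≡0 (∈-Fix⁻ k x∈))

  -- Traces and Artin-Schreier equations.

  -- The trace polynomial v + v² + ... + v^{2^{n-1}} on all of K; its values are guaranteed to be 0
  -- or 1 only on `Fixed n`.
  Tr : ℕ → Carrier → Carrier
  Tr zero    v = 0#
  Tr (suc n) v = Tr n v ⊕ fr n v

  Tr-0 : ∀ n → Tr n 0# ≡ 0#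
  Tr-0 zero = refl
  Tr-0 (suc n) = trans (cong₂ _⊕_ (Tr-0 n) (fr-0 n)) (+-identityˡ 0#)

  Tr-⊕ : ∀ n u v → Tr n (u ⊕ v) ≡ Tr n u ⊕ Tr n v
  Tr-⊕ zero    u v = sym (+-identityˡ 0#)
  Tr-⊕ (suc n) u v = trans (cong₂ _⊕_ (Tr-⊕ n u v) (fr-⊕ n u v))
    (solve 4 (λ a b c d → (a :+ b) :+ (c :+ d) := (a :+ c) :+ (b :+ d)) refl _ _ _ _)

  Tr-sq : ∀ n v → Tr n (sq v) ≡ sq (Tr n v)
  Tr-sq zero    v = sym (zeroˡ 0#)
  Tr-sq (suc n) v = trans (cong₂ _⊕_ (Tr-sq n v) (fr-sq n v))
    (solve 2 (λ a b → a :* a :+ b :* b := (a :+ b) :* (a :+ b)) refl _ _)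

  Tr-telescope : ∀ n y → Tr n (sq y ⊕ y) ≡ fr n y ⊕ y
  Tr-telescope zero    y = sym (x⊕x y)
  Tr-telescope (suc n) y = trans (cong₂ _⊕_ (Tr-telescope n y) (trans (fr-⊕ n _ _) (cong (_⊕ fr n y) (fr-sq n y))))
    (solve 3 (λ a b y → (a :+ y) :+ (b :+ a) := b :+ y) refl (fr n y) (fr (suc n) y) y)

  Tr-suc : ∀ n v → Tr (suc n) v ≡ v ⊕ sq (Tr n v)
  Tr-suc zero    v = trans (+-identityˡ v) (sym (trans (cong (v ⊕_) (zeroˡ 0#)) (+-identityʳ v)))
  Tr-suc (suc n) v = trans (cong (_⊕ fr (suc n) v) (Tr-suc n v))
    (solve 3 (λ v a b → (v :+ a :* a) :+ b :* b := v :+ (a :+ b) :* (a :+ b)) refl v (Tr n v) (fr n v))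

  Tr-+ : ∀ m n v → Tr (m + n) v ≡ Tr m v ⊕ Tr n (fr m v)
  Tr-+ m zero    v = trans (cong (λ k → Tr k v) (Nat.+-identityʳ m)) (sym (+-identityʳ _))
  Tr-+ m (suc n) v = trans (cong (λ k → Tr k v) (Nat.+-suc m n))
    (trans (cong₂ _⊕_ (Tr-+ m n v) (trans (cong (λ k → fr k v) (Nat.+-comm m n)) (fr-+ n m v)))
      (+-assoc _ _ _))

  Tr-fixed-sq : ∀ n {v} → Fixed n v → Tr n (sq v) ≡ Tr n v
  Tr-fixed-sq n {v} p = ⊕-≡0⇒≡ (trans (sym (Tr-⊕ n _ _)) (trans (Tr-telescope n v) (≡⇒⊕-≡0 p)))

  Tr-binary : ∀ n {v} → Fixed n v → Tr n v ≡ 0# ⊎ Tr n v ≡ 1#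
  Tr-binary n {v} p = sq-fixed (trans (sym (Tr-sq n v)) (Tr-fixed-sq n p))

  degree-Tr : ∀ n → Degree (2 ^ n) (Tr (suc n))
  degree-Tr zero = degree-ext (λ v → +-identityˡ v) (degree-fr-id 0)
  degree-Tr (suc n) = degree-ext (λ v → +-comm _ _)
    (degree-⊕-lower (^-monoʳ-< 2 (s≤s (s≤s z≤n)) (n<1+n n)) (degree-fr-id (suc n)) (degree⇒deg≤ (degree-Tr n)))

  -- The explicit solution is y = Σ_{i<N} (v + v² + … + v^{2^{i-1}}) θ^{2^i}.
  additive-hilbert90 : ∀ N θ → fr N θ ≡ θ → Tr N θ ≡ 1# → ∀ v → Tr N v ≡ 0# → ∃ λ y → sq y ⊕ y ≡ v
  additive-hilbert90 N θ θ-fixed Trθ v Trv = y N , (begin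
      sq (y N) ⊕ y N ≡⟨ partial N ⟩
      Tr N v · fr N θ ⊕ v · sq (Tr N θ) ≡⟨ cong₂ (λ a b → a · fr N θ ⊕ v · sq b) Trv Trθ ⟩
      0# · fr N θ ⊕ v · sq 1# ≡⟨ solve 2 (λ t v → con false :* t :+ v :* (con true :* con true) := v) refl (fr N θ) v ⟩
      v ∎)
    where
    open ≡-Reasoning
    y : ℕ → Carrier
    y zero = 0#
    y (suc k) = y k ⊕ Tr k v · fr k θ
    partial : ∀ k → sq (y k) ⊕ y k ≡ Tr k v · fr k θ ⊕ v · sq (Tr k θ)
    partial zero = solve 2 (λ t v → con false :* con false :+ con false
      := con false :* t :+ v :* (con false :* con false)) refl θ v
    partial (suc k) = begin
      sq (y k ⊕ s · t) ⊕ (y k ⊕ s · t) ≡⟨ solve 3 (λ y s t → (y :+ s :* t) :* (y :+ s :* t) :+ (y :+ s :* t)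
                                                       := (y :* y :+ y) :+ ((s :* s) :* (t :* t) :+ s :* t)) refl (y k) s t ⟩
      (sq (y k) ⊕ y k) ⊕ (sq s · sq t ⊕ s · t) ≡⟨ cong (_⊕ (sq s · sq t ⊕ s · t)) (partial k) ⟩
      (s · t ⊕ v · sq u) ⊕ (sq s · sq t ⊕ s · t) ≡⟨ solve 4 (λ s t u v → (s :* t :+ v :* (u :* u)) :+ ((s :* s) :* (t :* t) :+ s :* t)
                                                       := (v :+ s :* s) :* (t :* t) :+ v :* ((u :+ t) :* (u :+ t))) refl s t u v ⟩
      (v ⊕ sq s) · sq t ⊕ v · sq (u ⊕ t) ≡⟨ cong (λ a → a · sq t ⊕ v · sq (u ⊕ t)) (Tr-suc k v) ⟨
      Tr (suc k) v · sq t ⊕ v · sq (u ⊕ t) ∎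
      where
      s = Tr k v
      t = fr k θ
      u = Tr k θ

  module Finite (N : ℕ) (N>0 : 0 < N) (size≡ : size ≡ 2 ^ N) where

    fixed-all : ∀ x → Fixed N x
    fixed-all x = trans (sym (pow-2^ N x)) (subst (λ k → pow x k ≡ x) size≡ (fermat x))

    -- As a polynomial of degree 2^{N-1}, `Tr N` cannot vanish at all 2^N elements.
    trace-one : ∃ λ θ → Tr N θ ≡ 1#
    trace-one with All.all? (λ x → Tr N x ≟ 0#) elements
    ... | yes all = ⊥-elim (nonzero N N>0 size≡ all)
      where
      nonzero : ∀ N → 0 < N → size ≡ 2 ^ N → ¬ All (λ x → Tr N x ≡ 0#) elements
      nonzero (suc m) _ size≡ all = <⇒≱ (^-monoʳ-< 2 (s≤s (s≤s z≤n)) (n<1+n m))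
        (subst (_≤ 2 ^ m) (trans length-elements size≡)
          (degree-roots (degree-Tr m) elements-unique (All.lookup all)))
    ... | no ¬all with Any.satisfied (¬All⇒Any¬ (λ x → Tr N x ≟ 0#) elements ¬all)
    ...   | θ , Trθ≢0 with Tr-binary N (fixed-all θ)
    ...     | inj₁ Trθ≡0 = ⊥-elim (Trθ≢0 Trθ≡0)
    ...     | inj₂ Trθ≡1 = θ , Trθ≡1

    artin-schreier : ∀ v → Tr N v ≡ 0# → ∃ λ y → sq y ⊕ y ≡ v
    artin-schreier = additive-hilbert90 N (proj₁ trace-one) (fixed-all _) (proj₂ trace-one)

    -- The fibres of the trace onto the subfield Fix k have at most 2^{jk} elements.
    length-Fix≥ : ∀ k j → 1 ≤ k → N ≡ suc j * k → 2 ^ k ≤ length (Fix k)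
    length-Fix≥ k j 1≤k N≡ = Nat.*-cancelʳ-≤ (2 ^ k) (length (Fix k)) (2 ^ (j * k)) {{Nat.m^n≢0 2 (j * k)}} (begin
        2 ^ k * 2 ^ (j * k) ≡⟨ ^-distribˡ-+-* 2 k (j * k) ⟨
        2 ^ (suc j * k) ≡⟨ cong (2 ^_) N≡ ⟨
        2 ^ N ≡⟨ trans length-elements size≡ ⟨
        length elements ≤⟨ length-fibres _≟_ (rel (suc j)) (2 ^ (j * k)) (Fix k) elements elements-unique
                                        (λ {x} _ → ∈-Fix⁺ k (rel-fixed x)) fibre ⟩
        length (Fix k) * 2 ^ (j * k) ∎)
      where
      open Nat.≤-Reasoning
      -- `rel (suc j)` is the relative trace from K to 𝔽_{2^k}, a polynomial of degree 2^{jk}.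
      rel : ℕ → Carrier → Carrier
      rel zero    x = 0#
      rel (suc i) x = rel i x ⊕ fr (i * k) x
      fr-rel : ∀ i x → fr k (rel i x) ≡ rel i x ⊕ x ⊕ fr (i * k) x
      fr-rel zero    x = trans (fr-0 k) (sym (trans (cong (_⊕ x) (+-identityˡ x)) (x⊕x x)))
      fr-rel (suc i) x = trans (fr-⊕ k _ _) (trans (cong₂ _⊕_ (fr-rel i x) (sym (fr-+ k (i * k) x)))
        (solve 4 (λ a b c d → a :+ b :+ c :+ d := a :+ c :+ b :+ d) refl (rel i x) x (fr (i * k) x) (fr (suc i * k) x)))
      rel-fixed : ∀ x → Fixed k (rel (suc j) x)
      rel-fixed x = trans (fr-rel (suc j) x) (trans
        (cong (rel (suc j) x ⊕ x ⊕_) (subst (λ m → fr m x ≡ x) N≡ (fixed-all x)))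
        (solve 2 (λ a x → a :+ x :+ x := a) refl (rel (suc j) x) x))
      degree-rel : ∀ i → Degree (2 ^ (i * k)) (rel (suc i))
      degree-rel zero = degree-ext (λ v → +-identityˡ v) (degree-fr-id 0)
      degree-rel (suc i) = degree-ext (λ v → +-comm _ _)
        (degree-⊕-lower (^-monoʳ-< 2 (s≤s (s≤s z≤n)) (Nat.m<n+m (i * k) 1≤k))
          (degree-fr-id (suc i * k)) (degree⇒deg≤ (degree-rel i)))
      fibre : ∀ t ys → Unique ys → (∀ {y} → y ∈ ys → rel (suc j) y ≡ t) → length ys ≤ 2 ^ (j * k)
      fibre t ys u eq with degree-rel j
      ... | a , a≢0 , p with 2 ^ (j * k) in 2^≡ | 2^>0 (j * k)
      ...   | suc d | _ = length-roots (poly-⊕-lower (s≤s z≤n) p (const {t} (λ _ → refl))) a≢0 u (λ y∈ → ≡⇒⊕-≡0 (eq y∈))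

  -- Coefficient arrays for Stepanov's auxiliary function.

  evaluate-deg≤ : ∀ {j} (cs : Vec Carrier (suc j)) → Deg≤ j (evaluate cs)
  evaluate-deg≤ {zero}  (c ∷ []) = c , const (λ x → trans (cong (c ⊕_) (zeroʳ x)) (+-identityʳ c))
  evaluate-deg≤ {suc j} (c ∷ cs) with evaluate-deg≤ cs
  ... | a , p = a , step c _ p (λ _ → refl)

  evaluate-0 : ∀ n x → evaluate (replicate n 0#) x ≡ 0#
  evaluate-0 zero    x = refl
  evaluate-0 (suc n) x = trans (+-identityˡ _) (trans (cong (x ·_) (evaluate-0 n x)) (zeroʳ x))

  evaluate-degree : ∀ {n} (cs : Vec Carrier n) →
    cs ≡ replicate n 0# ⊎ ∃ λ a → a < n × Degree a (evaluate cs)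
  evaluate-degree [] = inj₁ refl
  evaluate-degree {suc n} (c ∷ cs) with evaluate-degree cs
  ... | inj₂ (a , a<n , k , k≢0 , p) = inj₂ (suc a , s≤s a<n , k , k≢0 , step c _ p (λ _ → refl))
  ... | inj₁ refl with c ≟ 0#
  ...   | yes refl = inj₁ refl
  ...   | no c≢0 = inj₂ (0 , s≤s z≤n , c , c≢0 , const (λ x →
            trans (cong (λ u → c ⊕ x · u) (evaluate-0 n x))
              (trans (cong (c ⊕_) (zeroʳ x)) (+-identityʳ c))))

  evaluate-⊕ : ∀ {n} (cs ds : Vec Carrier n) x →
    evaluate (zipWith _⊕_ cs ds) x ≡ evaluate cs x ⊕ evaluate ds x
  evaluate-⊕ []       []       x = sym (+-identityˡ 0#)
  evaluate-⊕ (c ∷ cs) (d ∷ ds) x = trans (cong (λ u → c ⊕ d ⊕ x · u) (evaluate-⊕ cs ds x))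
    (solve 5 (λ c d x u v → c :+ d :+ x :* (u :+ v) := (c :+ x :* u) :+ (d :+ x :* v)) refl c d x _ _)

  ⊕-vec-≡0 : ∀ {n} (cs ds : Vec Carrier n) → zipWith _⊕_ cs ds ≡ replicate n 0# → cs ≡ ds
  ⊕-vec-≡0 []       []       _ = refl
  ⊕-vec-≡0 (c ∷ cs) (d ∷ ds) eq = cong₂ _∷_ (⊕-≡0⇒≡ (cong Vec.head eq)) (⊕-vec-≡0 cs ds (cong Vec.tail eq))

  Array : ℕ → ℕ → Set
  Array J I = Vec (Vec Carrier J) I

  0-array : ∀ J I → Array J I
  0-array J I = replicate I (replicate J 0#)

  infixl 6 _⊞_
  _⊞_ : ∀ {J I} → Array J I → Array J I → Array J I
  _⊞_ = zipWith (zipWith _⊕_)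

  ⊞-≡0 : ∀ {J I} (R R' : Array J I) → R ⊞ R' ≡ 0-array J I → R ≡ R'
  ⊞-≡0 []      []        _ = refl
  ⊞-≡0 (V ∷ R) (V' ∷ R') eq =
    cong₂ _∷_ (⊕-vec-≡0 V V' (cong Vec.head eq)) (⊞-≡0 R R' (cong Vec.tail eq))

  -- With rows V_i:  spread ν R = Σ V_i x^{i 2^ν}  and  twist μ R = Σ V_i^{2^μ} x^i.
  spread : ∀ {J I} → ℕ → Array J I → Carrier → Carrier
  spread ν []      x = 0#
  spread ν (V ∷ R) x = evaluate V x ⊕ fr ν x · spread ν R x

  twist : ∀ {J I} → ℕ → Array J I → Carrier → Carrier
  twist μ []      x = 0#
  twist μ (V ∷ R) x = fr μ (evaluate V x) ⊕ x · twist μ R x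

  -- Raising to the power 2^μ turns x^{i 2^ν} into x^{i 2^{μ+ν}}, which is x^i for x in 𝔽_{2^{μ+ν}}.
  fr-spread : ∀ {J I} μ ν (R : Array J I) {x} → Fixed (μ + ν) x → fr μ (spread ν R x) ≡ twist μ R x
  fr-spread μ ν []      fix = fr-0 μ
  fr-spread μ ν (V ∷ R) {x} fix = trans (fr-⊕ μ _ _) (cong (fr μ (evaluate V x) ⊕_)
    (trans (fr-· μ _ _) (cong₂ _·_ (trans (sym (fr-+ μ ν x)) fix) (fr-spread μ ν R fix))))

  twist-⊞ : ∀ {J I} μ (R R' : Array J I) x → twist μ (R ⊞ R') x ≡ twist μ R x ⊕ twist μ R' x
  twist-⊞ μ []      []        x = sym (+-identityˡ 0#)
  twist-⊞ μ (V ∷ R) (V' ∷ R') x = trans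
    (cong₂ (λ a b → a ⊕ x · b) (trans (cong (fr μ) (evaluate-⊕ V V' x)) (fr-⊕ μ _ _)) (twist-⊞ μ R R' x))
    (solve 5 (λ a b x c d → (a :+ b) :+ x :* (c :+ d) := (a :+ x :* c) :+ (b :+ x :* d)) refl _ _ x _ _)

  twist-deg≤ : ∀ {j i} μ (R : Array (suc j) (suc i)) → Deg≤ (2 ^ μ * j + i) (twist μ R)
  twist-deg≤ {j} {zero} μ (V ∷ []) = deg≤-mono (m≤m+n _ 0)
    (deg≤-ext (λ x → trans (cong (fr μ (evaluate V x) ⊕_) (zeroʳ x)) (+-identityʳ _))
      (deg≤-fr μ (evaluate-deg≤ V)))
  twist-deg≤ {j} {suc i} μ (V ∷ R) = deg≤-⊕ (deg≤-mono (m≤m+n _ (suc i)) (deg≤-fr μ (evaluate-deg≤ V)))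
    (deg≤-mono (≤-reflexive (sym (Nat.+-suc (2 ^ μ * j) i))) (deg≤-· (1# , poly-id) (twist-deg≤ μ R)))

  spread-0 : ∀ ν J I x → spread ν (0-array J I) x ≡ 0#
  spread-0 ν J zero    x = refl
  spread-0 ν J (suc I) x = trans (cong₂ (λ a b → a ⊕ fr ν x · b) (evaluate-0 J x) (spread-0 ν J I x))
    (solve 1 (λ y → con false :+ y :* con false := con false) refl (fr ν x))

  -- Rows have degree below J ≤ 2^ν, so the terms V_i x^{i 2^ν} occupy disjoint ranges of degrees
  -- and the last nonzero row decides.
  spread-degree : ∀ {J I} ν (R : Array J I) → J ≤ 2 ^ ν →
    R ≡ 0-array J I ⊎ ∃ λ a → ∃ λ i → a < J × i < I × Degree (a + 2 ^ ν * i) (spread ν R)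
  spread-degree ν [] _ = inj₁ refl
  spread-degree {suc j} {suc I} ν (V ∷ R) J≤ with spread-degree ν R J≤
  ... | inj₂ (a , i , a<J , i<I , p) = inj₂ (a , suc i , a<J , s≤s i<I ,
          degree-ext (λ x → +-comm _ _) (degree-⊕-lower j< (degree-cast (index (2 ^ ν) a i)
            (degree-· (degree-fr-id ν) p)) (evaluate-deg≤ V)))
    where
    index : ∀ Q a i → Q + (a + Q * i) ≡ a + Q * suc i
    index = ℕ-ring
    j< : j < a + 2 ^ ν * suc i
    j< = ≤-trans J≤ (≤-trans (Nat.m≤m*n (2 ^ ν) (suc i)) (m≤n+m _ a))
  ... | inj₁ refl with evaluate-degree V
  ...   | inj₁ refl = inj₁ refl
  ...   | inj₂ (a , a<J , p) = inj₂ (a , 0 , a<J , s≤s z≤n ,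
            degree-cast (sym (trans (cong (λ u → a + u) (Nat.*-zeroʳ (2 ^ ν))) (Nat.+-identityʳ a)))
              (degree-ext (λ x → trans (cong (λ u → evaluate V x ⊕ fr ν x · u) (spread-0 ν (suc j) I x))
                (solve 2 (λ v y → v :+ y :* con false := v) refl _ _)) p))
  spread-degree {zero} ν (V ∷ R) J≤ with spread-degree ν R J≤
  spread-degree {zero} ν ([] ∷ R) J≤ | inj₁ refl = inj₁ refl
  spread-degree {zero} ν ([] ∷ R) J≤ | inj₂ (_ , _ , () , _)

  Array-↔ : ∀ J I → Array J I ↔ Fin (size ^ (J * I))
  Array-↔ J I = subst (λ m → Array J I ↔ Fin m) (^-*-assoc size J I)
    (Vec-↔ I (Vec-↔ J (↔-sym enum)))

  -- Stepanov's method on the curve z² = D z + E.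

  -- On the curve z² = D z + E one has z^{2^k} = G k + H k z.
  module FrobeniusPowers (D E : Carrier → Carrier) where

    G H : ℕ → Carrier → Carrier
    G zero    x = 0#
    G (suc k) x = sq (G k x) ⊕ sq (H k x) · E x
    H zero    x = 1#
    H (suc k) x = sq (H k x) · D x

    fr-z : ∀ k {x z} → sq z ≡ D x · z ⊕ E x → fr k z ≡ G k x ⊕ H k x · z
    fr-z zero    {z = z} eq = sym (trans (+-identityˡ _) (*-identityˡ z))
    fr-z (suc k) {x} {z} eq = begin
        sq (fr k z) ≡⟨ cong sq (fr-z k eq) ⟩
        sq (G k x ⊕ H k x · z) ≡⟨ solve 3 (λ g h z → (g :+ h :* z) :* (g :+ h :* z)
                                                           := g :* g :+ (h :* h) :* (z :* z)) refl (G k x) (H k x) z ⟩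
        sq (G k x) ⊕ sq (H k x) · sq z ≡⟨ cong (λ u → sq (G k x) ⊕ sq (H k x) · u) eq ⟩
        sq (G k x) ⊕ sq (H k x) · (D x · z ⊕ E x) ≡⟨ solve 5 (λ g h d z e → g :+ h :* (d :* z :+ e)
                                                           := (g :+ h :* e) :+ h :* d :* z) refl (sq (G k x)) (sq (H k x)) (D x) z (E x) ⟩
        G (suc k) x ⊕ H (suc k) x · z ∎
      where open ≡-Reasoning

    -- The degree bound (2^k - 1) g for `H k` = D^{2^k - 1}, written without subtraction.
    degH : ℕ → ℕ → ℕ
    degH g zero = 0
    degH g (suc k) = degH g k + degH g k + g

    degH-+ : ∀ g k → degH g k + g ≡ 2 ^ k * g
    degH-+ g zero = sym (Nat.+-identityʳ g)
    degH-+ g (suc k) = trans (regroup (degH g k) g) (trans (cong₂ _+_ (degH-+ g k) (degH-+ g k))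
      (trans (sym (Nat.*-distribʳ-+ g (2 ^ k) (2 ^ k))) (cong (_* g) (sym (2^suc k)))))
      where
      regroup : ∀ d g → d + d + g + g ≡ d + g + (d + g)
      regroup = ℕ-ring

    module _ {g : ℕ} (D-deg : Deg≤ g D) (E-deg : Degree (suc (g + g)) E) where

      H-deg : ∀ k → Deg≤ (degH g k) (H k)
      H-deg zero = 1# , const (λ _ → refl)
      H-deg (suc k) = deg≤-· (deg≤-· (H-deg k) (H-deg k)) D-deg

      -- At the single point at infinity x has pole order 2 and z has 2g + 1. For k ≥ 1 the order
      -- 2^k(2g + 1) of z^{2^k} is even and exceeds that of `H k` z, so it is twice the degree of
      -- `G k`.
      G-deg : ∀ k → Degree (2 ^ suc k * g + 2 ^ k) (G (suc k))
      G-deg zero = degree-cast (index g) (degree-ext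
        (λ x → solve 1 (λ e → con false :* con false :+ con true :* con true :* e := e) refl (E x)) E-deg)
        where
        index : ∀ g → suc (g + g) ≡ 2 * g + 1
        index = ℕ-ring
      G-deg (suc k) = degree-⊕-lower lower
        (degree-cast index (degree-· (G-deg k) (G-deg k)))
        (deg≤-· (deg≤-· (H-deg (suc k)) (H-deg (suc k))) (degree⇒deg≤ E-deg))
        where
        h = degH g (suc k)
        index : 2 ^ suc k * g + 2 ^ k + (2 ^ suc k * g + 2 ^ k) ≡ 2 ^ suc (suc k) * g + 2 ^ suc k
        index = trans (rearrange (2 ^ suc k) g (2 ^ k))
          (cong₂ (λ a b → a * g + b) (sym (2^suc (suc k))) (sym (2^suc k)))
          where
          rearrange : ∀ Q g q → Q * g + q + (Q * g + q) ≡ (Q + Q) * g + (q + q)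
          rearrange = ℕ-ring
        lower : h + h + suc (g + g) < 2 ^ suc (suc k) * g + 2 ^ suc k
        lower = begin-strict
          h + h + suc (g + g) ≡⟨ rearrange h g ⟩
          h + g + (h + g) + 1 ≡⟨ cong (λ u → u + u + 1) (degH-+ g (suc k)) ⟩
          2 ^ suc k * g + 2 ^ suc k * g + 1 ≡⟨ cong (_+ 1) (trans (sym (Nat.*-distribʳ-+ g (2 ^ suc k) (2 ^ suc k)))
                                                       (cong (_* g) (sym (2^suc (suc k))))) ⟩
          2 ^ suc (suc k) * g + 1 <⟨ +-monoʳ-< _ (^-monoʳ-< 2 (s≤s (s≤s z≤n)) (s≤s (z≤n {k}))) ⟩
          2 ^ suc (suc k) * g + 2 ^ suc k ∎
          where
          open Nat.≤-Reasoning
          rearrange : ∀ h g → h + h + suc (g + g) ≡ h + g + (h + g) + 1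
          rearrange = ℕ-ring

  -- A point where the curve z² = D z + E has no rational z: Frobenius swaps the two roots.
  InertPoint : ℕ → (D E : Carrier → Carrier) → Carrier → Set
  InertPoint n D E x = Fixed n x × D x ≢ 0# × Fixed n (D x) ×
    ∃ λ z → sq z ≡ D x · z ⊕ E x × fr n z ≡ z ⊕ D x

  -- An exact degree r is demanded, and not just the bound, because it also certifies that the
  -- polynomial is nonzero.
  Bounded : ℕ → (Carrier → Carrier) → Set
  Bounded B f = ∃ λ r → r ≤ B × Degree r f

  -- Both roots z and z + D of the quadratic lie over x and satisfy the same conditions, so p + q w
  -- vanishes at both of them; the difference is q D with D ≠ 0.
  inert-vanish : ∀ n D E k {x p q s t} → s ≡ 0# → t ≡ 0# → InertPoint n D E x →
    (∀ {w} → sq w ≡ D x · w ⊕ E x → fr n w ≡ w ⊕ D x → fr k (p ⊕ q · w) ≡ s ⊕ t · w) →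
    p ≡ 0# × q ≡ 0#
  inert-vanish n D E k {x} {p} {q} refl refl (_ , D≢0 , D-fix , z , curve , inert) power =
      trans (sym (trans (cong (λ u → p ⊕ u · z) q≡0)
        (solve 2 (λ p z → p :+ con false :* z := p) refl p z))) (at curve inert)
    , q≡0
    where
    at : ∀ {w} → sq w ≡ D x · w ⊕ E x → fr n w ≡ w ⊕ D x → p ⊕ q · w ≡ 0#
    at {w} c i = fr-injective k (trans (power c i)
      (trans (solve 1 (λ w → con false :+ con false :* w := con false) refl w) (sym (fr-0 k))))
    curve' : sq (z ⊕ D x) ≡ D x · (z ⊕ D x) ⊕ E x
    curve' = trans (solve 2 (λ z d → (z :+ d) :* (z :+ d) := z :* z :+ d :* d) refl z (D x))
      (trans (cong (_⊕ D x · D x) curve)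
        (solve 3 (λ z d e → d :* z :+ e :+ d :* d := d :* (z :+ d) :+ e) refl z (D x) (E x)))
    q≡0 : q ≡ 0#
    q≡0 with *-zero-split {q} {D x} (trans
      (solve 4 (λ p q z d → q :* d := (p :+ q :* z) :+ (p :+ q :* (z :+ d))) refl p q z (D x))
      (trans (cong₂ _⊕_ (at curve inert) (at curve' (trans (fr-⊕ n z (D x)) (cong₂ _⊕_ inert D-fix)))) (+-identityˡ 0#)))
    ... | inj₁ e = e
    ... | inj₂ e = ⊥-elim (D≢0 e)

  -- With Q' = 2^μ = 2h, the v_j are the monomials x^i, x^i z of pole order at most 2h - 1, and the
  -- u_i those of order at most 2h + 2g, where x has order 2 and z has 2g + 1. Here `q` is 2^b, half
  -- of Q'' = 2^ν, and not the order of the field. `B` is half the largest order of a product v_j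
  -- u_i^{Q''}, rounded down.
  module Auxiliary (D E : Carrier → Carrier) {g : ℕ} (D-deg : Deg≤ g D) (E-deg : Degree (suc (g + g)) E)
    (a b : ℕ) (a≤b : a ≤ b) (j : ℕ) (2^a≡ : 2 ^ a ≡ suc (j + g)) (large : suc g * suc g < suc (j + g) + suc (j + g))
    where
    open FrobeniusPowers D E

    h j1 I1 q μ ν B : ℕ
    h = suc (j + g)
    j1 = j + g
    I1 = suc (h + g)
    q = 2 ^ b
    μ = suc a
    ν = suc b
    B = j1 + (q + q) * (h + g)

    2^μ≡ : 2 ^ μ ≡ h + h
    2^μ≡ = trans (2^suc a) (cong₂ _+_ 2^a≡ 2^a≡)

    h≤q : h ≤ q
    h≤q = subst (_≤ q) 2^a≡ (^-monoʳ-≤ 2 a≤b)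

    -- The four arrays carry the coefficients of v_j u_i with u, v ∈ {xⁱ , xⁱ z}.
    data Arrays4 : Set where
      arrays : Array h I1 → Array h h → Array (suc j) I1 → Array (suc j) h → Arrays4

    α β P1 P2 : Arrays4 → Carrier → Carrier
    α (arrays R00 R10 R01 R11) x =
      (twist μ R00 x ⊕ twist μ R10 x · D x) ⊕
      (twist μ R01 x · G μ x ⊕ twist μ R11 x · (H μ x · E x ⊕ D x · G μ x))
    β (arrays R00 R10 R01 R11) x =
      twist μ R10 x ⊕ (twist μ R01 x · H μ x ⊕ twist μ R11 x · G μ x)
    P1 (arrays R00 R10 R01 R11) x =
      spread ν R00 x ⊕ (spread ν R10 x · G ν x ⊕ spread ν R11 x · (H ν x · E x))
    P2 (arrays R00 R10 R01 R11) x =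
      spread ν R01 x ⊕ (spread ν R11 x · (G ν x ⊕ H ν x · D x) ⊕ spread ν R10 x · H ν x)

    fr-P : ∀ R {x z} → Fixed (μ + ν) x → sq z ≡ D x · z ⊕ E x → fr (μ + ν) z ≡ z ⊕ D x →
      fr μ (P1 R x ⊕ P2 R x · z) ≡ α R x ⊕ β R x · z
    fr-P R@(arrays R00 R10 R01 R11) {x} {z} fix curve inert = begin
        fr μ (P1 R x ⊕ P2 R x · z)
      ≡⟨ cong (fr μ) (trans expand (cong (λ u → t00 ⊕ t10 · u ⊕ t01 · z ⊕ t11 · (u · z)) (sym (fr-z ν curve)))) ⟩
        fr μ (t00 ⊕ t10 · fr ν z ⊕ t01 · z ⊕ t11 · (fr ν z · z))
      ≡⟨ trans (fr-⊕ μ _ _) (cong₂ _⊕_ (trans (fr-⊕ μ _ _) (cong₂ _⊕_ (trans (fr-⊕ μ _ _)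
           (cong (fr μ t00 ⊕_) (fr-· μ _ _))) (fr-· μ _ _)))
           (trans (fr-· μ _ _) (cong (fr μ t11 ·_) (fr-· μ _ _)))) ⟩
        fr μ t00 ⊕ fr μ t10 · fr μ (fr ν z) ⊕ fr μ t01 · fr μ z ⊕ fr μ t11 · (fr μ (fr ν z) · fr μ z)
      ≡⟨ cong₂ (λ u v → fr μ t00 ⊕ fr μ t10 · u ⊕ fr μ t01 · v ⊕ fr μ t11 · (u · v))
           (trans (sym (fr-+ μ ν z)) inert) (fr-z μ curve) ⟩
        fr μ t00 ⊕ fr μ t10 · (z ⊕ d) ⊕ fr μ t01 · (g' ⊕ h' · z) ⊕ fr μ t11 · ((z ⊕ d) · (g' ⊕ h' · z))
      ≡⟨ cong₂ (λ u v → u ⊕ fr μ t11 · v) (cong₂ (λ u v → u ⊕ v · (g' ⊕ h' · z))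
           (cong₂ (λ u v → u ⊕ v · (z ⊕ d)) (fr-spread μ ν R00 fix) (fr-spread μ ν R10 fix))
           (fr-spread μ ν R01 fix))
           (trans (solve 4 (λ z d g h → (z :+ d) :* (g :+ h :* z) := z :* g :+ h :* (z :* z) :+ d :* g :+ d :* h :* z) refl z d g' h')
             (cong (λ u → z · g' ⊕ h' · u ⊕ d · g' ⊕ d · h' · z) curve)) ⟩
        s00 ⊕ s10 · (z ⊕ d) ⊕ s01 · (g' ⊕ h' · z) ⊕ fr μ t11 · (z · g' ⊕ h' · (d · z ⊕ e) ⊕ d · g' ⊕ d · h' · z)
      ≡⟨ cong (λ u → s00 ⊕ s10 · (z ⊕ d) ⊕ s01 · (g' ⊕ h' · z) ⊕ u · (z · g' ⊕ h' · (d · z ⊕ e) ⊕ d · g' ⊕ d · h' · z))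
           (fr-spread μ ν R11 fix) ⟩
        s00 ⊕ s10 · (z ⊕ d) ⊕ s01 · (g' ⊕ h' · z) ⊕ s11 · (z · g' ⊕ h' · (d · z ⊕ e) ⊕ d · g' ⊕ d · h' · z)
      ≡⟨ solve 9 (λ s00 s10 s01 s11 z d e g h →
           s00 :+ s10 :* (z :+ d) :+ s01 :* (g :+ h :* z) :+ s11 :* (z :* g :+ h :* (d :* z :+ e) :+ d :* g :+ d :* h :* z)
           := ((s00 :+ s10 :* d) :+ (s01 :* g :+ s11 :* (h :* e :+ d :* g))) :+ (s10 :+ (s01 :* h :+ s11 :* g)) :* z)
           refl s00 s10 s01 s11 z d e g' h' ⟩
        α R x ⊕ β R x · z
      ∎
      where
      open ≡-Reasoning
      d e g' h' t00 t10 t01 t11 s00 s10 s01 s11 : Carrier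
      d = D x
      e = E x
      g' = G μ x
      h' = H μ x
      t00 = spread ν R00 x
      t10 = spread ν R10 x
      t01 = spread ν R01 x
      t11 = spread ν R11 x
      s00 = twist μ R00 x
      s10 = twist μ R10 x
      s01 = twist μ R01 x
      s11 = twist μ R11 x
      expand : P1 R x ⊕ P2 R x · z ≡
        t00 ⊕ t10 · (G ν x ⊕ H ν x · z) ⊕ t01 · z ⊕ t11 · ((G ν x ⊕ H ν x · z) · z)
      expand = begin
          P1 R x ⊕ P2 R x · z
        ≡⟨ solve 9 (λ t00 t10 t01 t11 z d e g h →
             (t00 :+ (t10 :* g :+ t11 :* (h :* e))) :+ (t01 :+ (t11 :* (g :+ h :* d) :+ t10 :* h)) :* z
             := t00 :+ t10 :* (g :+ h :* z) :+ t01 :* z :+ t11 :* (g :* z :+ h :* (d :* z :+ e)))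
             refl t00 t10 t01 t11 z d e (G ν x) (H ν x) ⟩
          t00 ⊕ t10 · (G ν x ⊕ H ν x · z) ⊕ t01 · z ⊕ t11 · (G ν x · z ⊕ H ν x · (d · z ⊕ e))
        ≡⟨ cong (λ u → t00 ⊕ t10 · (G ν x ⊕ H ν x · z) ⊕ t01 · z ⊕ t11 · u)
             (trans (cong (λ u → G ν x · z ⊕ H ν x · u) (sym curve))
               (solve 3 (λ g h z → g :* z :+ h :* (z :* z) := (g :+ h :* z) :* z) refl (G ν x) (H ν x) z)) ⟩
          t00 ⊕ t10 · (G ν x ⊕ H ν x · z) ⊕ t01 · z ⊕ t11 · ((G ν x ⊕ H ν x · z) · z)
        ∎

    P-vanish : ∀ R → (∀ x → α R x ≡ 0#) → (∀ x → β R x ≡ 0#) → ∀ {x} → InertPoint (μ + ν) D E x →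
      P1 R x ≡ 0# × P2 R x ≡ 0#
    P-vanish R α≡0 β≡0 {x} pt = inert-vanish (μ + ν) D E μ (α≡0 x) (β≡0 x) pt (fr-P R (proj₁ pt))

    -- The products v_j^{Q'} ū_i have pole order at most 2h(2h - 1) + 2h + 2g = 4h² + 2g. Hence
    -- degree at most 2h² + g in the component at 1, and 2h² - 1 in the component at z.
    Nα Nβ : ℕ
    Nα = h * h + h * h + g
    Nβ = j1 + j1 * h + h * h

    twist' : ∀ {j i} (R : Array (suc j) (suc i)) → Deg≤ ((h + h) * j + i) (twist μ R)
    twist' {j} {i} R = subst (λ m → Deg≤ (m * j + i) (twist μ R)) 2^μ≡ (twist-deg≤ μ R)

    Gμ : Deg≤ ((h + h) * g + h) (G μ)
    Gμ = subst (λ m → Deg≤ m (G μ)) (cong₂ (λ u v → u * g + v) 2^μ≡ 2^a≡) (degree⇒deg≤ (G-deg D-deg E-deg a))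

    dμ+g : degH g μ + g ≡ (h + h) * g
    dμ+g = trans (degH-+ g μ) (cong (_* g) 2^μ≡)

    α-deg : ∀ R → Deg≤ Nα (α R)
    α-deg (arrays R00 R10 R01 R11) = deg≤-⊕
      (deg≤-⊕ (deg≤-mono (≤-by h (e1 j g)) (twist' R00)) (deg≤-mono (≤-by (suc h) (e2 j g)) (deg≤-· (twist' R10) D-deg)))
      (deg≤-⊕ (deg≤-mono (≤-reflexive (e3 j g)) (deg≤-· (twist' R01) Gμ))
        (deg≤-mono (≤-by 1 (e4 j g)) (deg≤-· (twist' R11)
          (deg≤-⊕ (deg≤-mono HE≤ (deg≤-· (H-deg D-deg E-deg μ) (degree⇒deg≤ E-deg))) (deg≤-· D-deg Gμ)))))
      where
      e1 : ∀ j g → (let h = suc (j + g)) → (h + h) * (j + g) + (h + g) + h ≡ h * h + h * h + g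
      e1 = ℕ-ring
      e2 : ∀ j g → (let h = suc (j + g)) → (h + h) * (j + g) + (j + g) + g + suc h ≡ h * h + h * h + g
      e2 = ℕ-ring
      e3 : ∀ j g → (let h = suc (j + g)) → (h + h) * j + (h + g) + ((h + h) * g + h) ≡ h * h + h * h + g
      e3 = ℕ-ring
      e4 : ∀ j g → (let h = suc (j + g)) → (h + h) * j + (j + g) + (g + ((h + h) * g + h)) + 1 ≡ h * h + h * h + g
      e4 = ℕ-ring
      HE≤ : degH g μ + suc (g + g) ≤ g + ((h + h) * g + h)
      HE≤ = ≤-by (j + g) (trans (e₅ (degH g μ) j g) (trans (cong (λ u → g + (u + h)) dμ+g) refl))
        where
        e₅ : ∀ d j g → d + suc (g + g) + (j + g) ≡ g + ((d + g) + suc (j + g))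
        e₅ = ℕ-ring

    β-deg : ∀ R → Deg≤ Nβ (β R)
    β-deg (arrays R00 R10 R01 R11) = deg≤-⊕
      (deg≤-mono (≤-by h (e1 j g)) (twist' R10))
      (deg≤-⊕ (deg≤-mono (≤-by j1 (trans (e2 j g (degH g μ)) (trans (cong (λ u → (h + h) * j + h + u + j1) dμ+g) (e3 j g))))
          (deg≤-· (twist' R01) (H-deg D-deg E-deg μ)))
        (deg≤-mono (≤-reflexive (e4 j g)) (deg≤-· (twist' R11) Gμ)))
      where
      e1 : ∀ j g → (let h = suc (j + g)) → (h + h) * (j + g) + (j + g) + h ≡ (j + g) + (j + g) * h + h * h
      e1 = ℕ-ring
      e2 : ∀ j g d → (let h = suc (j + g)) → (h + h) * j + (h + g) + d + (j + g) ≡ (h + h) * j + h + (d + g) + (j + g)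
      e2 = ℕ-ring
      e3 : ∀ j g → (let h = suc (j + g)) → (h + h) * j + h + (h + h) * g + (j + g) ≡ (j + g) + (j + g) * h + h * h
      e3 = ℕ-ring
      e4 : ∀ j g → (let h = suc (j + g)) → (h + h) * j + (j + g) + ((h + h) * g + h) ≡ (j + g) + (j + g) * h + h * h
      e4 = ℕ-ring

    Q≡ : 2 ^ ν ≡ q + q
    Q≡ = 2^suc b

    Shape : ℕ → ℕ → (Carrier → Carrier) → Set
    Shape J I f = ∃ λ c → ∃ λ i → c < J × i < I × Degree (c + (q + q) * i) f

    shape : ∀ {J I} (R : Array J I) → J ≤ q → R ≡ 0-array J I ⊎ Shape J I (spread ν R)
    shape R J≤q with spread-degree ν R (≤-trans J≤q (≤-trans (m≤m+n q q) (≤-reflexive (sym Q≡))))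
    ... | inj₁ eq = inj₁ eq
    ... | inj₂ (c , i , c<J , i<I , p) = inj₂ (c , i , c<J , i<I , degree-cast (cong (λ m → c + m * i) Q≡) p)

    Gν : Degree ((q + q) * g + q) (G ν)
    Gν = subst (λ m → Degree (m * g + q) (G ν)) Q≡ (G-deg D-deg E-deg b)

    dν+g : degH g ν + g ≡ (q + q) * g
    dν+g = trans (degH-+ g ν) (cong (_* g) Q≡)

    q>0 : 0 < q
    q>0 = 2^>0 b

    j<q : suc j ≤ q
    j<q = ≤-trans (s≤s (m≤m+n j g)) h≤q

    zero-⊕ : ∀ (f k : Carrier → Carrier) → (∀ x → f x ≡ 0#) → ∀ {n} → Degree n k → Degree n (λ x → f x ⊕ k x)
    zero-⊕ f k f≡0 d = degree-ext (λ x → trans (cong (_⊕ k x) (f≡0 x)) (+-identityˡ _)) d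

    ⊕-zero : ∀ (f k : Carrier → Carrier) → (∀ x → k x ≡ 0#) → ∀ {n} → Degree n f → Degree n (λ x → f x ⊕ k x)
    ⊕-zero f k k≡0 d = degree-ext (λ x → trans (cong (f x ⊕_) (k≡0 x)) (+-identityʳ _)) d

    index : ∀ c i → c + (q + q) * i + ((q + q) * g + q) ≡ c + ((q + q) * (i + g) + q)
    index c i = identity q c i g
      where
      identity : ∀ q c i g → c + (q + q) * i + ((q + q) * g + q) ≡ c + ((q + q) * (i + g) + q)
      identity = ℕ-ring

    degree-≤B : ∀ c i → c < h → i < h → c + (q + q) * i + ((q + q) * g + q) ≤ B
    degree-≤B c i c<h i<h = begin
      c + (q + q) * i + ((q + q) * g + q) ≡⟨ index c i ⟩
      c + ((q + q) * (i + g) + q) ≤⟨ +-mono-≤ (≤-pred c<h) (+-monoʳ-≤ _ (m≤m+n q q)) ⟩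
      j1 + ((q + q) * (i + g) + (q + q)) ≡⟨ identity j1 (q + q) i g ⟩
      j1 + (q + q) * (suc i + g) ≤⟨ +-monoʳ-≤ j1 (*-monoʳ-≤ (q + q) (+-monoˡ-≤ g i<h)) ⟩
      B ∎
      where
      open Nat.≤-Reasoning
      identity : ∀ j Q i g → j + (Q * (i + g) + Q) ≡ j + Q * (suc i + g)
      identity = ℕ-ring

    -- The left summand has a degree with residue < q modulo 2q, the right one has
    -- residue ≥ q, so their leading terms cannot cancel.
    combine : ∀ {J f k} (R : Array J I1) → J ≤ h → (∀ x → f x ≡ spread ν R x) →
      ∀ c i → c < h → i < h → Degree (c + (q + q) * i + ((q + q) * g + q)) k →
      Bounded B (λ x → f x ⊕ k x)
    combine {J} {f} {k} R J≤h f≡ c i c<h i<h k-deg with shape R (≤-trans J≤h h≤q)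
    ... | inj₁ refl = _ , degree-≤B c i c<h i<h , zero-⊕ f k (λ x → trans (f≡ x) (spread-0 ν J I1 x)) k-deg
    ... | inj₂ (c0 , i0 , c0<J , i0<I , f-deg₀) = distinct (Nat.<-cmp (c0 + (q + q) * i0) (c + (q + q) * i + ((q + q) * g + q)))
      where
      f-deg : Degree (c0 + (q + q) * i0) f
      f-deg = degree-ext f≡ f-deg₀
      f≤B : c0 + (q + q) * i0 ≤ B
      f≤B = +-mono-≤ (≤-pred (≤-trans c0<J J≤h)) (*-monoʳ-≤ (q + q) (≤-pred i0<I))
      distinct : _ → Bounded B (λ x → f x ⊕ k x)
      distinct (tri< lt _ _) = _ , degree-≤B c i c<h i<h , degree-ext (λ x → +-comm _ _) (degree-⊕-lower lt k-deg (degree⇒deg≤ f-deg))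
      distinct (tri> _ _ gt) = _ , f≤B , degree-⊕-lower gt f-deg (degree⇒deg≤ k-deg)
      distinct (tri≈ _ eq _) = ⊥-elim (residue-≢ {k = i + g} (≤-trans c0<J (≤-trans J≤h h≤q)) (≤-trans c<h h≤q)
        (trans eq (index c i)))

    0-arrays : Arrays4
    0-arrays = arrays (0-array h I1) (0-array h h) (0-array (suc j) I1) (0-array (suc j) h)

    -- The terms with z^{Q''} come from R10 and R11. If R10 has the larger pole order it survives in
    -- P1 (`first`), otherwise R11 survives in P2 (`second`); `combine` keeps it apart from R00 or
    -- R01. If both are zero, P1 and P2 reduce to R00 and R01.
    nonvanishing : ∀ R → R ≢ 0-arrays → Bounded B (P1 R) ⊎ Bounded B (P2 R)
    nonvanishing (arrays R00 R10 R01 R11) R≢0 = cases (shape R10 h≤q) (shape R11 j<q)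
      where
      p1 p2 : Carrier → Carrier
      p1 x = spread ν R10 x · G ν x ⊕ spread ν R11 x · (H ν x · E x)
      p2 x = spread ν R11 x · (G ν x ⊕ H ν x · D x) ⊕ spread ν R10 x · H ν x

      Goal : Set
      Goal = Bounded B (λ x → spread ν R00 x ⊕ p1 x) ⊎ Bounded B (λ x → spread ν R01 x ⊕ p2 x)

      J2≤h : suc j ≤ h
      J2≤h = s≤s (m≤m+n j g)

      HE : Deg≤ (degH g ν + suc (g + g)) (λ x → H ν x · E x)
      HE = deg≤-· (H-deg D-deg E-deg ν) (degree⇒deg≤ E-deg)

      G+HD : Degree ((q + q) * g + q) (λ x → G ν x ⊕ H ν x · D x)
      G+HD = degree-⊕-lower (subst (_< (q + q) * g + q) (sym dν+g)
               (≤-trans (≤-reflexive (Nat.+-comm 1 _)) (+-monoʳ-≤ _ q>0)))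
             Gν (deg≤-· (H-deg D-deg E-deg ν) D-deg)

      first : ∀ c i → c < h → i < h → Degree (c + (q + q) * i) (spread ν R10) →
        (R11 ≡ 0-array (suc j) h ⊎ ∃ λ m → m + g < c + (q + q) * i × Degree m (spread ν R11)) → Goal
      first c i c<h i<h d rest = inj₁ (combine R00 ≤-refl (λ _ → refl) c i c<h i<h (p1-deg rest))
        where
        p1-deg : _ → Degree (c + (q + q) * i + ((q + q) * g + q)) p1
        p1-deg (inj₁ refl) = ⊕-zero (λ x → spread ν R10 x · G ν x) (λ x → spread ν (0-array (suc j) h) x · (H ν x · E x))
            (λ x → trans (cong (_· (H ν x · E x)) (spread-0 ν (suc j) h x)) (zeroˡ _)) (degree-· d Gν)
        p1-deg (inj₂ (m , m< , m-deg)) = degree-⊕-lower lower (degree-· d Gν) (deg≤-· (degree⇒deg≤ m-deg) HE)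
          where
          open Nat.≤-Reasoning
          identity : ∀ m d g → m + (d + suc (g + g)) ≡ suc (m + g) + (d + g)
          identity = ℕ-ring
          lower : m + (degH g ν + suc (g + g)) < c + (q + q) * i + ((q + q) * g + q)
          lower = begin-strict
            m + (degH g ν + suc (g + g)) ≡⟨ identity m (degH g ν) g ⟩
            suc (m + g) + (degH g ν + g) ≤⟨ +-monoˡ-≤ _ m< ⟩
            c + (q + q) * i + (degH g ν + g) ≡⟨ cong (λ u → c + (q + q) * i + u) dν+g ⟩
            c + (q + q) * i + (q + q) * g <⟨ +-monoʳ-< _ (m<m+n ((q + q) * g) q>0) ⟩
            c + (q + q) * i + ((q + q) * g + q) ∎

      second : ∀ c i → c < h → i < h → Degree (c + (q + q) * i) (spread ν R11) →
        (R10 ≡ 0-array h h ⊎ ∃ λ m → m ≤ c + (q + q) * i + g × Degree m (spread ν R10)) → Goal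
      second c i c<h i<h d rest = inj₂ (combine R01 J2≤h (λ _ → refl) c i c<h i<h (p2-deg rest))
        where
        p2-deg : _ → Degree (c + (q + q) * i + ((q + q) * g + q)) p2
        p2-deg (inj₁ refl) = ⊕-zero (λ x → spread ν R11 x · (G ν x ⊕ H ν x · D x)) (λ x → spread ν (0-array h h) x · H ν x)
            (λ x → trans (cong (_· H ν x) (spread-0 ν h h x)) (zeroˡ _)) (degree-· d G+HD)
        p2-deg (inj₂ (m , m≤ , m-deg)) = degree-⊕-lower lower (degree-· d G+HD) (deg≤-· (degree⇒deg≤ m-deg) (H-deg D-deg E-deg ν))
          where
          open Nat.≤-Reasoning
          lower : m + degH g ν < c + (q + q) * i + ((q + q) * g + q)
          lower = begin-strict
            m + degH g ν ≤⟨ +-monoˡ-≤ _ m≤ ⟩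
            c + (q + q) * i + g + degH g ν ≡⟨ Nat.+-assoc (c + (q + q) * i) g _ ⟩
            c + (q + q) * i + (g + degH g ν) ≡⟨ cong (λ u → c + (q + q) * i + u) (trans (Nat.+-comm g _) dν+g) ⟩
            c + (q + q) * i + (q + q) * g <⟨ +-monoʳ-< _ (m<m+n ((q + q) * g) q>0) ⟩
            c + (q + q) * i + ((q + q) * g + q) ∎

      spread-≤B : ∀ {J} (R : Array J I1) → J ≤ h → R ≢ 0-array J I1 → Bounded B (spread ν R)
      spread-≤B R J≤h R≢ with shape R (≤-trans J≤h h≤q)
      ... | inj₁ eq = ⊥-elim (R≢ eq)
      ... | inj₂ (c , i , c<J , i<I , d) =
        _ , +-mono-≤ (≤-pred (≤-trans c<J J≤h)) (*-monoʳ-≤ (q + q) (≤-pred i<I)) , d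

      cases : R10 ≡ 0-array h h ⊎ Shape h h (spread ν R10) →
        R11 ≡ 0-array (suc j) h ⊎ Shape (suc j) h (spread ν R11) → Goal
      cases (inj₂ (c , i , c<h , i<h , d)) (inj₁ eq) = first c i c<h i<h d (inj₁ eq)
      cases (inj₁ eq) (inj₂ (c , i , c<J , i<h , d)) = second c i (≤-trans c<J J2≤h) i<h d (inj₁ eq)
      cases (inj₂ (c , i , c<h , i<h , d)) (inj₂ (c' , i' , c'<J , i'<h , d'))
        -- With d' and d the degrees of `spread ν R11` and `spread ν R10`, this compares the pole
        -- orders 2d' + 2g + 1 and 2d; a tie is excluded by parity.
        with c' + (q + q) * i' + g Nat.<? c + (q + q) * i
      ... | yes lt = first c i c<h i<h d (inj₂ (_ , lt , d'))
      ... | no ¬lt = second c' i' (≤-trans c'<J J2≤h) i'<h d' (inj₂ (_ , ≮⇒≥ ¬lt , d))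
      cases (inj₁ refl) (inj₁ refl) with ≡-dec (≡-dec _≟_) R00 (0-array h I1) | ≡-dec (≡-dec _≟_) R01 (0-array (suc j) I1)
      ... | yes refl | yes refl = ⊥-elim (R≢0 refl)
      ... | no R00≢  | _ with spread-≤B R00 ≤-refl R00≢
      ...   | r , r≤B , d = inj₁ (r , r≤B , ⊕-zero (spread ν R00) p1 (λ x →
                trans (cong₂ (λ u v → u · G ν x ⊕ v · (H ν x · E x)) (spread-0 ν h h x) (spread-0 ν (suc j) h x))
                  (solve 2 (λ u v → con false :* u :+ con false :* v := con false) refl (G ν x) (H ν x · E x))) d)
      cases (inj₁ refl) (inj₁ refl) | yes _ | no R01≢ with spread-≤B R01 J2≤h R01≢
      ...   | r , r≤B , d = inj₂ (r , r≤B , ⊕-zero (spread ν R01) p2 (λ x →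
                trans (cong₂ (λ u v → v · (G ν x ⊕ H ν x · D x) ⊕ u · H ν x) (spread-0 ν h h x) (spread-0 ν (suc j) h x))
                  (solve 2 (λ u v → con false :* u :+ con false :* v := con false) refl (G ν x ⊕ H ν x · D x) (H ν x))) d)

    coefficients : Arrays4 → Vec Carrier (suc Nα) × Vec Carrier (suc Nβ)
    coefficients R = proj₁ (poly-coefficients (proj₂ (α-deg R))) , proj₁ (poly-coefficients (proj₂ (β-deg R)))

    _⊞₄_ : Arrays4 → Arrays4 → Arrays4
    (arrays R00 R10 R01 R11) ⊞₄ (arrays S00 S10 S01 S11) =
      arrays (R00 ⊞ S00) (R10 ⊞ S10) (R01 ⊞ S01) (R11 ⊞ S11)

    arrays-injective : ∀ {R R' S S' T T' U U'} → arrays R S T U ≡ arrays R' S' T' U' →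
      R ≡ R' × S ≡ S' × T ≡ T' × U ≡ U'
    arrays-injective refl = refl , refl , refl , refl

    ⊞₄-≡0 : ∀ R S → R ⊞₄ S ≡ 0-arrays → R ≡ S
    ⊞₄-≡0 (arrays R00 R10 R01 R11) (arrays S00 S10 S01 S11) eq with arrays-injective eq
    ... | e0₀ , e1₀ , e0₁ , e1₁
      with ⊞-≡0 R00 S00 e0₀ | ⊞-≡0 R10 S10 e1₀ | ⊞-≡0 R01 S01 e0₁ | ⊞-≡0 R11 S11 e1₁
    ... | refl | refl | refl | refl = refl

    α-⊞ : ∀ R S x → α (R ⊞₄ S) x ≡ α R x ⊕ α S x
    α-⊞ (arrays R00 R10 R01 R11) (arrays S00 S10 S01 S11) x = trans
      (cong₂ _⊕_
        (cong₂ (λ u v → u ⊕ v · D x) (twist-⊞ μ R00 S00 x) (twist-⊞ μ R10 S10 x))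
        (cong₂ (λ u v → u · G μ x ⊕ v · k) (twist-⊞ μ R01 S01 x) (twist-⊞ μ R11 S11 x)))
      (trans (cong₂ _⊕_
        (bilinear (twist μ R00 x) (twist μ S00 x) (twist μ R10 x) (twist μ S10 x) (D x))
        (bilinear2 (twist μ R01 x) (twist μ S01 x) (twist μ R11 x) (twist μ S11 x) (G μ x) k))
        (solve 4 (λ a b c d → (a :+ b) :+ (c :+ d) := (a :+ c) :+ (b :+ d)) refl _ _ _ _))
      where
      k : Carrier
      k = H μ x · E x ⊕ D x · G μ x
      bilinear : ∀ a a' b b' d → (a ⊕ a') ⊕ (b ⊕ b') · d ≡ (a ⊕ b · d) ⊕ (a' ⊕ b' · d)
      bilinear = solve 5 (λ a a' b b' d → (a :+ a') :+ (b :+ b') :* d := (a :+ b :* d) :+ (a' :+ b' :* d)) refl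
      bilinear2 : ∀ a a' b b' c d → (a ⊕ a') · c ⊕ (b ⊕ b') · d ≡ (a · c ⊕ b · d) ⊕ (a' · c ⊕ b' · d)
      bilinear2 = solve 6 (λ a a' b b' c d → (a :+ a') :* c :+ (b :+ b') :* d := (a :* c :+ b :* d) :+ (a' :* c :+ b' :* d)) refl

    β-⊞ : ∀ R S x → β (R ⊞₄ S) x ≡ β R x ⊕ β S x
    β-⊞ (arrays R00 R10 R01 R11) (arrays S00 S10 S01 S11) x = trans
      (cong₂ _⊕_ (twist-⊞ μ R10 S10 x)
        (cong₂ (λ u v → u · H μ x ⊕ v · G μ x) (twist-⊞ μ R01 S01 x) (twist-⊞ μ R11 S11 x)))
      (regroup (twist μ R10 x) (twist μ S10 x) (twist μ R01 x) (twist μ S01 x) (twist μ R11 x) (twist μ S11 x) (H μ x) (G μ x))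
      where
      regroup : ∀ a a' b b' c c' h g → (a ⊕ a') ⊕ ((b ⊕ b') · h ⊕ (c ⊕ c') · g) ≡
        (a ⊕ (b · h ⊕ c · g)) ⊕ (a' ⊕ (b' · h ⊕ c' · g))
      regroup = solve 8 (λ a a' b b' c c' h g → (a :+ a') :+ ((b :+ b') :* h :+ (c :+ c') :* g) :=
        (a :+ (b :* h :+ c :* g)) :+ (a' :+ (b' :* h :+ c' :* g))) refl

    Arrays4-↔ : Arrays4 ↔ Fin ((size ^ (h * I1) * size ^ (h * h)) * (size ^ (suc j * I1) * size ^ (suc j * h)))
    Arrays4-↔ = ↔-sym Finₚ.*↔× ↔-∘
      (((↔-sym Finₚ.*↔× ↔-∘ (Array-↔ h I1 ×-↔ Array-↔ h h)) ×-↔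
       (↔-sym Finₚ.*↔× ↔-∘ (Array-↔ (suc j) I1 ×-↔ Array-↔ (suc j) h)))
        ↔-∘ mk↔ₛ′ (λ { (arrays R S T U) → (R , S) , (T , U) }) (λ { ((R , S) , (T , U)) → arrays R S T U })
              (λ { ((R , S) , (T , U)) → refl }) (λ { (arrays _ _ _ _) → refl }))

    coefficients-↔ : (Vec Carrier (suc Nα) × Vec Carrier (suc Nβ)) ↔ Fin (size ^ suc Nα * size ^ suc Nβ)
    coefficients-↔ = ↔-sym Finₚ.*↔× ↔-∘ (Vec-↔ (suc Nα) (↔-sym enum) ×-↔ Vec-↔ (suc Nβ) (↔-sym enum))

    -- There are (2h - g)(2h + g + 1) unknowns against Nα + Nβ + 2 = 4h² + g + 1 conditions, a
    -- surplus of 2h - (g + 1)².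
    fewer : size ^ suc Nα * size ^ suc Nβ <
      (size ^ (h * I1) * size ^ (h * h)) * (size ^ (suc j * I1) * size ^ (suc j * h))
    fewer = subst₂ _<_ (^-distribˡ-+-* size (suc Nα) (suc Nβ))
        (trans (^-distribˡ-+-* size (h * I1 + h * h) (suc j * I1 + suc j * h))
          (cong₂ _*_ (^-distribˡ-+-* size (h * I1) (h * h)) (^-distribˡ-+-* size (suc j * I1) (suc j * h))))
        (^-monoʳ-< size 1<size exponents)
      where
      identity : ∀ j g → (let h = suc (j + g)) → suc (h * h + h * h + g) + suc ((j + g) + (j + g) * h + h * h) + (h + h)
        ≡ (h * suc (h + g) + h * h + (suc j * suc (h + g) + suc j * h)) + suc g * suc g
      identity = ℕ-ring
      exponents : suc Nα + suc Nβ < h * I1 + h * h + (suc j * I1 + suc j * h)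
      exponents = Nat.+-cancelʳ-< (suc g * suc g) _ _
        (Nat.<-≤-trans (+-monoʳ-< (suc Nα + suc Nβ) large) (≤-reflexive (identity j g)))

    sum-vanishes : ∀ {n} (f : Arrays4 → Carrier → Carrier) (cs : Arrays4 → Vec Carrier n) →
      (∀ R x → f R x ≡ evaluate (cs R) x) → (∀ R S x → f (R ⊞₄ S) x ≡ f R x ⊕ f S x) →
      ∀ R S → cs R ≡ cs S → ∀ x → f (R ⊞₄ S) x ≡ 0#
    sum-vanishes f cs f≡ f-⊞ R S eq x = trans (f-⊞ R S x)
      (≡⇒⊕-≡0 (trans (f≡ R x) (trans (cong (λ v → evaluate v x) eq) (sym (f≡ S x)))))

    -- The conditions are additive in the arrays but only semilinear over K, so a collision takes
    -- the place of a rank argument: two distinct arrays with equal coefficient vectors have a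
    -- nonzero sum for which α = β = 0.
    inert-count : ∀ {xs} → Unique xs → (∀ {x} → x ∈ xs → InertPoint (μ + ν) D E x) → length xs ≤ B
    inert-count {xs} u pts = conclude (pigeonhole-↔ Arrays4-↔ coefficients-↔ fewer coefficients)
      where
      conclude : (∃ λ R → ∃ λ S → R ≢ S × coefficients R ≡ coefficients S) → length xs ≤ B
      conclude (R , S , R≢S , eq) = bound (nonvanishing (R ⊞₄ S) (λ e → R≢S (⊞₄-≡0 R S e)))
        where
        vanish : ∀ {x} → x ∈ xs → P1 (R ⊞₄ S) x ≡ 0# × P2 (R ⊞₄ S) x ≡ 0#
        vanish x∈ = P-vanish (R ⊞₄ S)
          (sum-vanishes α (λ T → proj₁ (coefficients T)) (λ T → proj₂ (poly-coefficients (proj₂ (α-deg T)))) α-⊞ R S (cong proj₁ eq))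
          (sum-vanishes β (λ T → proj₂ (coefficients T)) (λ T → proj₂ (poly-coefficients (proj₂ (β-deg T)))) β-⊞ R S (cong proj₂ eq))
          (pts x∈)
        bound : Bounded B (P1 (R ⊞₄ S)) ⊎ Bounded B (P2 (R ⊞₄ S)) → length xs ≤ B
        bound (inj₁ (r , r≤B , d)) = ≤-trans (degree-roots d u (λ x∈ → proj₁ (vanish x∈))) r≤B
        bound (inj₂ (r , r≤B , d)) = ≤-trans (degree-roots d u (λ x∈ → proj₂ (vanish x∈))) r≤B

  -- With Q' = 2^{a+1}, Q'' = 2^{b+1} and q = Q'Q'', the bound reads q/2 + g Q'' + Q'/2. The
  -- strictness comes from the v_j having order at most Q' - 1.
  stepanov : ∀ {D E g} → Deg≤ g D → Degree (suc (g + g)) E → ∀ {a b} → a ≤ b →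
    suc g * suc g < 2 ^ a + 2 ^ a → ∀ {xs} → Unique xs →
    (∀ {x} → x ∈ xs → InertPoint (suc a + suc b) D E x) →
    suc (length xs) ≤ 2 ^ a + 2 ^ suc b * (2 ^ a + g)
  stepanov {D} {E} {g} D-deg E-deg {a} {b} a≤b large {xs} u pts =
      subst₂ (λ h Q → suc (length xs) ≤ h + Q * (h + g)) (sym 2^a≡) (sym (2^suc b))
        (s≤s (Auxiliary.inert-count D E D-deg E-deg a b a≤b j 2^a≡ (subst (λ h → suc g * suc g < h + h) 2^a≡ large) u pts))
    where
    g<2^a : suc g ≤ 2 ^ a
    g<2^a = ≮⇒≥ λ lt → Nat.<-irrefl refl (begin-strict
      suc g * suc g <⟨ large ⟩
      2 ^ a + 2 ^ a ≤⟨ +-mono-≤ (≤-pred lt) (≤-pred lt) ⟩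
      g + g ≤⟨ ≤-by (g * g + 1) (identity g) ⟩
      suc g * suc g ∎)
      where
      open Nat.≤-Reasoning
      identity : ∀ g → g + g + (g * g + 1) ≡ suc g * suc g
      identity = ℕ-ring
    j : ℕ
    j = 2 ^ a ∸ suc g
    2^a≡ : 2 ^ a ≡ suc (j + g)
    2^a≡ = trans (sym (Nat.m∸n+n≡m g<2^a)) (Nat.+-suc j g)

-- The circle in 𝔽_{q²} and representations by circle elements, with q = 2^n.

module Syndromes (K : FiniteField) (char2 : HasChar2 K)
  (n : ℕ) (n>0 : 0 < n) (size≡ : FiniteField.size K ≡ 2 ^ (n + n)) where
  open Char2 K char2 public
  open Finite (n + n) (≤-trans n>0 (m≤m+n n n)) size≡ public

  1≢0 : 1# ≢ 0#
  1≢0 eq = 0≢1 (sym eq)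

  fr-involutive : ∀ x → fr n (fr n x) ≡ x
  fr-involutive x = trans (sym (fr-+ n n x)) (fixed-all x)

  fixed-Tr₂ : ∀ {v} → Fixed n v → Tr (n + n) v ≡ 0#
  fixed-Tr₂ {v} p = trans (Tr-+ n n v) (trans (cong (λ u → Tr n v ⊕ Tr n u) p) (x⊕x _))

  trace-one-fixed : ∃ λ u → Fixed n u × Tr n u ≡ 1#
  trace-one-fixed with trace-one
  ... | θ , Trθ = θ ⊕ fr n θ
    , trans (fr-⊕ n _ _) (trans (cong (fr n θ ⊕_) (fr-involutive θ)) (+-comm _ _))
    , trans (Tr-⊕ n _ _) (trans (sym (Tr-+ n n θ)) Trθ)

  -- Over 𝔽_{q²} every element of 𝔽_q has trace 0, so a root y exists in K; telescoping then gives
  -- y^q + y = Tr v = 1.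
  inert-root : ∀ {v} → Fixed n v → Tr n v ≡ 1# → ∃ λ y → sq y ⊕ y ≡ v × fr n y ≡ y ⊕ 1#
  inert-root {v} fix Trv with artin-schreier v (fixed-Tr₂ fix)
  ... | y , eq = y , eq , trans (⊕-shift (trans (sym (Tr-telescope n y)) (trans (cong (Tr n) eq) Trv))) (+-comm 1# y)

  OnCircle : Carrier → Set
  OnCircle x = x · fr n x ≡ 1#

  circle-1 : OnCircle 1#
  circle-1 = trans (*-identityˡ _) (fr-1 n)

  circle-· : ∀ {x y} → OnCircle x → OnCircle y → OnCircle (x · y)
  circle-· {x} {y} p q = trans (cong (x · y ·_) (fr-· n x y))
    (trans (solve 4 (λ x y u v → x :* y :* (u :* v) := (x :* u) :* (y :* v)) refl x y _ _)
      (trans (cong₂ _·_ p q) (*-identityˡ 1#)))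

  nonzero-factorˡ : ∀ {x y} → x · y ≢ 0# → x ≢ 0#
  nonzero-factorˡ {y = y} xy≢0 refl = xy≢0 (zeroˡ y)

  nonzero-factorʳ : ∀ {x y} → x · y ≢ 0# → y ≢ 0#
  nonzero-factorʳ {x} xy≢0 refl = xy≢0 (zeroʳ x)

  Tr-nonzero : ∀ {v} → Tr n v ≡ 1# → v ≢ 0#
  Tr-nonzero Trv refl = 0≢1 (trans (sym (Tr-0 n)) Trv)

  -- z = y / v with y² + y = v².
  circle-point : ∀ {v} → Fixed n v → Tr n v ≡ 1# → ∃ λ z → OnCircle z × v · (z ⊕ fr n z) ≡ 1#
  circle-point {v} v-fix Trv = from-root (inert-root {sq v} (trans (fr-sq n v) (cong sq v-fix)) (trans (Tr-fixed-sq n v-fix) Trv))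
    where
    t : Carrier
    t = inv v
    vt : v · t ≡ 1#
    vt = inverseʳ (Tr-nonzero Trv)
    from-root : (∃ λ y → sq y ⊕ y ≡ sq v × fr n y ≡ y ⊕ 1#) → ∃ λ z → OnCircle z × v · (z ⊕ fr n z) ≡ 1#
    from-root (y , y-eq , y-inert) = t · y
      , (begin
          t · y · fr n (t · y) ≡⟨ cong (t · y ·_) z̄≡ ⟩
          t · y · (t · (y ⊕ 1#)) ≡⟨ solve 2 (λ t y → t :* y :* (t :* (y :+ con true)) := t :* t :* (y :* y :+ y)) refl t y ⟩
          t · t · (sq y ⊕ y) ≡⟨ cong (t · t ·_) y-eq ⟩
          t · t · sq v ≡⟨ solve 2 (λ t v → t :* t :* (v :* v) := (v :* t) :* (v :* t)) refl t v ⟩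
          sq (v · t) ≡⟨ trans (cong sq vt) (*-identityˡ 1#) ⟩
          1# ∎)
      , trans (cong (λ u → v · (t · y ⊕ u)) z̄≡)
          (trans (solve 3 (λ v t y → v :* (t :* y :+ t :* (y :+ con true)) := v :* t) refl v t y) vt)
      where
      open ≡-Reasoning
      z̄≡ : fr n (t · y) ≡ t · (y ⊕ 1#)
      z̄≡ = trans (fr-· n t y) (cong₂ _·_ (fixed-inv n v-fix) y-inert)

  norm-square⇒multiple : ∀ {u ρ} → Fixed n ρ → u · fr n u ≡ sq ρ → ∃ λ h → OnCircle h × u ≡ ρ · h
  norm-square⇒multiple {u} {ρ} ρ-fix norm with ρ ≟ 0#
  ... | yes ρ≡0 = 1# , circle-1 , trans u≡0 (sym (trans (*-identityʳ ρ) ρ≡0))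
    where
    u≡0 : u ≡ 0#
    u≡0 with *-zero-split (trans norm (trans (cong (_· ρ) ρ≡0) (zeroˡ ρ)))
    ... | inj₁ p = p
    ... | inj₂ p = fr-injective n (trans p (sym (fr-0 n)))
  ... | no ρ≢0 = u · k
    , (begin
        u · k · fr n (u · k) ≡⟨ cong (u · k ·_) (trans (fr-· n u k) (cong (fr n u ·_) (fixed-inv n ρ-fix))) ⟩
        u · k · (fr n u · k) ≡⟨ solve 3 (λ a b k → a :* k :* (b :* k) := (a :* b) :* (k :* k)) refl u (fr n u) k ⟩
        u · fr n u · sq k ≡⟨ cong (_· sq k) norm ⟩
        sq ρ · sq k ≡⟨ solve 2 (λ ρ k → (ρ :* ρ) :* (k :* k) := (ρ :* k) :* (ρ :* k)) refl ρ k ⟩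
        sq (ρ · k) ≡⟨ trans (cong sq (inverseʳ ρ≢0)) (*-identityˡ 1#) ⟩
        1# ∎)
    , (begin
        u ≡⟨ *-identityʳ u ⟨
        u · 1# ≡⟨ cong (u ·_) (inverseʳ ρ≢0) ⟨
        u · (ρ · k) ≡⟨ solve 3 (λ u ρ k → u :* (ρ :* k) := ρ :* (u :* k)) refl u ρ k ⟩
        ρ · (u · k) ∎)
    where
    open ≡-Reasoning
    k : Carrier
    k = inv ρ

  TwoTerm : (c ρ r : Carrier) → Set
  TwoTerm c ρ r = ∃ λ z → ∃ λ h → OnCircle z × OnCircle h × r ≡ c · z ⊕ ρ · h

  -- With z on the circle and z + z̄ = (r+c+ρ)²/(rc), the norm of r + c z is ρ².
  decompose : ∀ {r c ρ} → Fixed n r → Fixed n c → Fixed n ρ →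
    Tr n (r · c · sq (inv (r ⊕ c ⊕ ρ))) ≡ 1# →
    TwoTerm c ρ r
  decompose {r} {c} {ρ} r-fix c-fix ρ-fix Trv = go (inv w) refl Trv
    where
    open ≡-Reasoning
    w : Carrier
    w = r ⊕ c ⊕ ρ
    go : ∀ i → inv w ≡ i → Tr n (r · c · sq i) ≡ 1# →
      TwoTerm c ρ r
    go i i≡ Trv = from-z (circle-point (fixed-· n (fixed-· n r-fix c-fix) (trans (fr-sq n i) (cong sq i-fix))) Trv)
      where
      i-fix : Fixed n i
      i-fix = subst (Fixed n) i≡ (fixed-inv n (fixed-⊕ n (fixed-⊕ n r-fix c-fix) ρ-fix))
      w≢0 : w ≢ 0#
      w≢0 eq = nonzero-factorˡ (nonzero-factorʳ (Tr-nonzero Trv)) (trans (sym i≡) (trans (cong inv eq) inv-0))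
      from-z : (∃ λ z → OnCircle z × r · c · sq i · (z ⊕ fr n z) ≡ 1#) →
        TwoTerm c ρ r
      from-z (z , z-circle , vt) with norm-square⇒multiple {r ⊕ c · z} ρ-fix norm
        where
        t : Carrier
        t = z ⊕ fr n z
        rct : r · c · t ≡ sq w
        rct = begin
          r · c · t ≡⟨ *-identityʳ _ ⟨
          r · c · t · 1# ≡⟨ cong (r · c · t ·_) (trans (cong sq (trans (cong (w ·_) (sym i≡)) (inverseʳ w≢0))) (*-identityˡ 1#)) ⟨
          r · c · t · sq (w · i) ≡⟨ solve 5 (λ r c t w i → r :* c :* t :* ((w :* i) :* (w :* i))
                                                       := (r :* c :* (i :* i)) :* t :* (w :* w)) refl r c t w i ⟩
          r · c · sq i · t · sq w ≡⟨ cong (_· sq w) vt ⟩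
          1# · sq w ≡⟨ *-identityˡ _ ⟩
          sq w ∎
        norm : (r ⊕ c · z) · fr n (r ⊕ c · z) ≡ sq ρ
        norm = begin
          (r ⊕ c · z) · fr n (r ⊕ c · z)
            ≡⟨ cong ((r ⊕ c · z) ·_) (trans (fr-⊕ n _ _) (cong₂ _⊕_ r-fix (trans (fr-· n c z) (cong (_· fr n z) c-fix)))) ⟩
          (r ⊕ c · z) · (r ⊕ c · fr n z)
            ≡⟨ solve 4 (λ r c z z̄ → (r :+ c :* z) :* (r :+ c :* z̄) := r :* r :+ r :* c :* (z :+ z̄) :+ c :* c :* (z :* z̄)) refl r c z (fr n z) ⟩
          sq r ⊕ r · c · t ⊕ c · c · (z · fr n z)
            ≡⟨ cong₂ (λ a b → sq r ⊕ a ⊕ c · c · b) rct z-circle ⟩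
          sq r ⊕ sq w ⊕ c · c · 1#
            ≡⟨ solve 3 (λ r c ρ → r :* r :+ (r :+ c :+ ρ) :* (r :+ c :+ ρ) :+ c :* c :* con true := ρ :* ρ) refl r c ρ ⟩
          sq ρ ∎
      ... | h , h-circle , eq = z , h , z-circle , h-circle , trans (⊕-shift eq) (+-comm _ _)

  -- Norms in r + ax = by give ar(x + x̄) = (r+a+b)², so v = ar/(r+a+b)² is the inverse of x + x̄.
  -- Then xv is a root of Y² + Y = v². If v had trace 0, the root xv and with it x would lie in 𝔽_q,
  -- making x + x̄ zero.
  two-term⇒trace : ∀ {r a b x y} → Fixed n r → Fixed n a → Fixed n b → OnCircle x → OnCircle y →
    r ≡ a · x ⊕ b · y → r ⊕ (a ⊕ b) ≢ 0# → Tr n (a · (r · sq (inv (r ⊕ (a ⊕ b))))) ≢ 0#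
  two-term⇒trace {r} {a} {b} {x} {y} r-fix a-fix b-fix x-circle y-circle r≡ w≢0 Trv = t≢0 (≡⇒⊕-≡0 (sym x̄≡x))
    where
    open ≡-Reasoning
    w i v t : Carrier
    w = r ⊕ (a ⊕ b)
    i = inv w
    v = a · (r · sq i)
    t = x ⊕ fr n x
    r≡' : r ≡ a · fr n x ⊕ b · fr n y
    r≡' = begin
      r ≡⟨ r-fix ⟨
      fr n r ≡⟨ cong (fr n) r≡ ⟩
      fr n (a · x ⊕ b · y) ≡⟨ trans (fr-⊕ n _ _) (cong₂ _⊕_ (fr-· n a x) (fr-· n b y)) ⟩
      fr n a · fr n x ⊕ fr n b · fr n y ≡⟨ cong₂ (λ c d → c · fr n x ⊕ d · fr n y) a-fix b-fix ⟩
      a · fr n x ⊕ b · fr n y ∎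
    tar : t · (a · r) ≡ sq w
    tar = begin
      t · (a · r)
        ≡⟨ solve 4 (λ x x̄ a r → (x :+ x̄) :* (a :* r) := (r :+ a :* x) :* (r :+ a :* x̄) :+ (r :* r :+ a :* a :* (x :* x̄))) refl x (fr n x) a r ⟩
      (r ⊕ a · x) · (r ⊕ a · fr n x) ⊕ (sq r ⊕ a · a · (x · fr n x))
        ≡⟨ cong₂ (λ c d → c · d ⊕ (sq r ⊕ a · a · (x · fr n x)))
             (trans (cong (_⊕ a · x) r≡) (solve 2 (λ u v → u :+ v :+ u := v) refl (a · x) (b · y)))
             (trans (cong (_⊕ a · fr n x) r≡') (solve 2 (λ u v → u :+ v :+ u := v) refl (a · fr n x) (b · fr n y))) ⟩
      (b · y) · (b · fr n y) ⊕ (sq r ⊕ a · a · (x · fr n x))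
        ≡⟨ cong₂ (λ c d → c ⊕ (sq r ⊕ a · a · d))
             (trans (solve 3 (λ b y ȳ → (b :* y) :* (b :* ȳ) := b :* b :* (y :* ȳ)) refl b y (fr n y)) (cong (b · b ·_) y-circle)) x-circle ⟩
      b · b · 1# ⊕ (sq r ⊕ a · a · 1#)
        ≡⟨ solve 3 (λ r a b → b :* b :* con true :+ (r :* r :+ a :* a :* con true) := (r :+ (a :+ b)) :* (r :+ (a :+ b))) refl r a b ⟩
      sq w ∎
    tv : t · v ≡ 1#
    tv = begin
      t · (a · (r · sq i)) ≡⟨ solve 4 (λ t a r i → t :* (a :* (r :* (i :* i))) := t :* (a :* r) :* (i :* i)) refl t a r i ⟩
      t · (a · r) · sq i ≡⟨ cong (_· sq i) tar ⟩
      sq w · sq i ≡⟨ solve 2 (λ w i → (w :* w) :* (i :* i) := (w :* i) :* (w :* i)) refl w i ⟩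
      sq (w · i) ≡⟨ trans (cong sq (inverseʳ w≢0)) (*-identityˡ 1#) ⟩
      1# ∎
    t≢0 : t ≢ 0#
    t≢0 = nonzero-factorˡ (λ eq → 1≢0 (trans (sym tv) eq))
    v≢0 : v ≢ 0#
    v≢0 = nonzero-factorʳ {t} (λ eq → 1≢0 (trans (sym tv) eq))
    v-fix : Fixed n v
    v-fix = fixed-· n a-fix (fixed-· n r-fix (trans (fr-sq n i) (cong sq
      (fixed-inv n (fixed-⊕ n r-fix (fixed-⊕ n a-fix b-fix))))))
    xv : sq (x · v) ⊕ x · v ≡ sq v
    xv = begin
      sq (x · v) ⊕ x · v
        ≡⟨ solve 3 (λ x x̄ v → (x :* v) :* (x :* v) :+ x :* v
             := x :* v :* ((x :+ x̄) :* v) :+ (x :* x̄) :* (v :* v) :+ x :* v) refl x (fr n x) v ⟩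
      x · v · (t · v) ⊕ x · fr n x · sq v ⊕ x · v
        ≡⟨ cong₂ (λ c d → x · v · c ⊕ d · sq v ⊕ x · v) tv x-circle ⟩
      x · v · 1# ⊕ 1# · sq v ⊕ x · v
        ≡⟨ solve 2 (λ u v → u :* con true :+ con true :* v :+ u := v) refl (x · v) (sq v) ⟩
      sq v ∎
    xv-fix : fr n (x · v) ≡ x · v
    xv-fix = ⊕-≡0⇒≡ (begin
      fr n (x · v) ⊕ x · v ≡⟨ Tr-telescope n (x · v) ⟨
      Tr n (sq (x · v) ⊕ x · v) ≡⟨ cong (Tr n) xv ⟩
      Tr n (sq v) ≡⟨ Tr-fixed-sq n v-fix ⟩
      Tr n v ≡⟨ Trv ⟩
      0# ∎)
    x̄≡x : fr n x ≡ x
    x̄≡x = *-cancelˡ v≢0 (begin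
      v · fr n x ≡⟨ *-comm v _ ⟩
      fr n x · v ≡⟨ cong (fr n x ·_) v-fix ⟨
      fr n x · fr n v ≡⟨ fr-· n x v ⟨
      fr n (x · v) ≡⟨ xv-fix ⟩
      x · v ≡⟨ *-comm x v ⟩
      v · x ∎)

  -- Additive characters and their sums.

  sign : Carrier → ℤ
  sign v with v ≟ 0#
  ... | yes _ = ℤ.1ℤ
  ... | no  _ = ℤ.-1ℤ

  χ : Carrier → ℤ
  χ v = sign (Tr n v)

  sign-0 : ∀ {v} → v ≡ 0# → sign v ≡ ℤ.1ℤ
  sign-0 {v} v≡0 with v ≟ 0#
  ... | yes _ = refl
  ... | no v≢0 = ⊥-elim (v≢0 v≡0)

  sign-≢0 : ∀ {v} → v ≢ 0# → sign v ≡ ℤ.-1ℤ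
  sign-≢0 {v} v≢0 with v ≟ 0#
  ... | yes v≡0 = ⊥-elim (v≢0 v≡0)
  ... | no _ = refl

  sign-≥ : ∀ v → ℤ.-1ℤ ℤ.≤ sign v
  sign-≥ v with v ≟ 0#
  ... | yes _ = ℤ.-≤+
  ... | no _ = Int.≤-refl

  sign-⊕ : ∀ {u v} → u ≡ 0# ⊎ u ≡ 1# → v ≡ 0# ⊎ v ≡ 1# → sign (u ⊕ v) ≡ sign u *ℤ sign v
  sign-⊕ {v = v} (inj₁ refl) _ = trans (cong sign (+-identityˡ v))
    (sym (trans (cong (_*ℤ sign v) (sign-0 refl)) (Int.*-identityˡ (sign v))))
  sign-⊕ (inj₂ refl) (inj₁ refl) = trans (cong sign (+-identityʳ 1#))
    (sym (trans (cong (sign 1# *ℤ_) (sign-0 refl)) (Int.*-identityʳ (sign 1#))))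
  sign-⊕ (inj₂ refl) (inj₂ refl) = trans (sign-0 (x⊕x 1#)) (sym (cong₂ _*ℤ_ (sign-≢0 1≢0) (sign-≢0 1≢0)))

  χ-⊕ : ∀ {u v} → Fixed n u → Fixed n v → χ (u ⊕ v) ≡ χ u *ℤ χ v
  χ-⊕ {u} {v} p q = trans (cong sign (Tr-⊕ n u v)) (sign-⊕ (Tr-binary n p) (Tr-binary n q))

  χ-0 : χ 0# ≡ ℤ.1ℤ
  χ-0 = sign-0 (Tr-0 n)

  ≡-neg⇒≡0 : ∀ {a} → a ≡ ℤ.-1ℤ *ℤ a → a ≡ ℤ.0ℤ
  ≡-neg⇒≡0 {+ zero}      _ = refl
  ≡-neg⇒≡0 {+ suc k}     ()
  ≡-neg⇒≡0 {ℤ.-[1+ k ]}  ()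

  -- Translating b by an element with χ (b0 h) = -1 changes the sign of the sum.
  ∑-χ-linear : ∀ k h → (∀ {b} → Fixed k b → Fixed n b) → Fixed n h →
    (∃ λ b0 → Fixed k b0 × Tr n (b0 · h) ≢ 0#) → ∑ (Fix k) (λ b → χ (b · h)) ≡ ℤ.0ℤ
  ∑-χ-linear k h k⇒n h-fix (b0 , b0-fix , Tr≢0) = ≡-neg⇒≡0 (begin
      ∑ (Fix k) (λ b → χ (b · h)) ≡⟨ ∑-↭ (λ b → χ (b · h)) shifted ⟨
      ∑ (map (b0 ⊕_) (Fix k)) (λ b → χ (b · h)) ≡⟨ ∑-map (b0 ⊕_) (Fix k) (λ b → χ (b · h)) ⟩
      ∑ (Fix k) (λ b → χ ((b0 ⊕ b) · h)) ≡⟨ ∑-cong (Fix k) flip ⟩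
      ∑ (Fix k) (λ b → χ (b · h) *ℤ ℤ.-1ℤ) ≡⟨ ∑-distribʳ-* (Fix k) (λ b → χ (b · h)) ℤ.-1ℤ ⟩
      ∑ (Fix k) (λ b → χ (b · h)) *ℤ ℤ.-1ℤ ≡⟨ Int.*-comm _ ℤ.-1ℤ ⟩
      ℤ.-1ℤ *ℤ ∑ (Fix k) (λ b → χ (b · h)) ∎)
    where
    open ≡-Reasoning
    flip : ∀ {b} → b ∈ Fix k → χ ((b0 ⊕ b) · h) ≡ χ (b · h) *ℤ ℤ.-1ℤ
    flip {b} b∈ = trans (cong χ (trans (distribʳ h b0 b) (+-comm _ _)))
      (trans (χ-⊕ (fixed-· n (k⇒n (∈-Fix⁻ k b∈)) h-fix) (fixed-· n (k⇒n b0-fix) h-fix))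
        (cong (χ (b · h) *ℤ_) (sign-≢0 Tr≢0)))
    into : ∀ {z} → z ∈ map (b0 ⊕_) (Fix k) → z ∈ Fix k
    into z∈ with ∈-map⁻ (b0 ⊕_) z∈
    ... | b , b∈ , refl = ∈-Fix⁺ k (fixed-⊕ k b0-fix (∈-Fix⁻ k b∈))
    back : ∀ {z} → z ∈ Fix k → z ∈ map (b0 ⊕_) (Fix k)
    back {z} z∈ = subst (_∈ map (b0 ⊕_) (Fix k)) (solve 2 (λ b z → b :+ (b :+ z) := z) refl b0 z)
      (∈-map⁺ (b0 ⊕_) (∈-Fix⁺ k (fixed-⊕ k b0-fix (∈-Fix⁻ k z∈))))
    shifted : map (b0 ⊕_) (Fix k) ↭ Fix k
    shifted = unique-↭ (Uniq.map⁺ (⊕-cancelˡ b0) (Fix-unique k)) (Fix-unique k) into back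

  unique-⊆-length⇒⊇ : ∀ {xs ys : List Carrier} → Unique xs → (∀ {z} → z ∈ xs → z ∈ ys) →
    length ys ≤ length xs → ∀ {z} → z ∈ ys → z ∈ xs
  unique-⊆-length⇒⊇ {xs} {ys} u sub len {z} z∈ with z ∈? xs
  ... | yes z∈xs = z∈xs
  ... | no z∉xs = ⊥-elim (<⇒≱ (unique-⊆⇒length≤ (All.tabulate (λ x∈ z≡x → z∉xs (subst (_∈ xs) (sym z≡x) x∈)) ∷ u)
          (λ { (here refl) → z∈ ; (there p) → sub p })) len)

  ∑-reindex : ∀ (φ : Carrier → Carrier) → (∀ {x y} → φ x ≡ φ y → x ≡ y) →
    (∀ {x} → Fixed n x → Fixed n (φ x)) → ∀ f → ∑ (Fix n) (λ x → f (φ x)) ≡ ∑ (Fix n) f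
  ∑-reindex φ φ-inj φ-fix f = trans (sym (∑-map φ (Fix n) f)) (∑-↭ f
      (unique-↭ φ-unique (Fix-unique n) into
        (unique-⊆-length⇒⊇ φ-unique into (≤-reflexive (sym (length-map φ (Fix n)))))))
    where
    φ-unique : Unique (map φ (Fix n))
    φ-unique = Uniq.map⁺ φ-inj (Fix-unique n)
    into : ∀ {z} → z ∈ map φ (Fix n) → z ∈ Fix n
    into z∈ with ∈-map⁻ φ z∈
    ... | x , x∈ , refl = ∈-Fix⁺ n (φ-fix (∈-Fix⁻ n x∈))

  inv-injective : ∀ {x y} → inv x ≡ inv y → x ≡ y
  inv-injective {x} {y} eq = trans (sym (inv-involutive x)) (trans (cong inv eq) (inv-involutive y))

  ∑-χ-scaled : ∀ {h} → Fixed n h → h ≢ 0# → ∑ (Fix n) (λ b → χ (b · h)) ≡ ℤ.0ℤ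
  ∑-χ-scaled {h} h-fix h≢0 with trace-one-fixed
  ... | u , u-fix , Tru = ∑-χ-linear n h (λ p → p) h-fix
    ( u · inv h , fixed-· n u-fix (fixed-inv n h-fix)
    , λ eq → 1≢0 (trans (sym Tru) (trans (cong (Tr n) (sym (trans (*-assoc u (inv h) h)
        (trans (cong (u ·_) (inverseˡ h≢0)) (*-identityʳ u))))) eq)))

  -- Every syndrome is a sum of at most three circle elements.

  -- Otherwise the two characters below never take the value -1 simultaneously;
  -- both have sum 0 over 𝔽_q, and both are +1 at ρ = 0.
  auxiliary-element : ∀ {r} → Fixed n r → r ≢ 0# → r ⊕ 1# ≢ 0# →
    ∃ λ ρ → Fixed n ρ × Tr n (r · 1# · sq (inv (r ⊕ 1# ⊕ ρ))) ≡ 1# × Tr n (inv ρ) ≡ 1#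
  auxiliary-element {r} r-fix r≢0 r+1≢0 = search (Any.any? (λ ρ → (Tr n (f ρ) ≟ 1#) ×-dec (Tr n (inv ρ) ≟ 1#)) (Fix n))
    where
    f : Carrier → Carrier
    f ρ = r · 1# · sq (inv (r ⊕ 1# ⊕ ρ))
    f-fix : ∀ {ρ} → Fixed n ρ → Fixed n (f ρ)
    f-fix ρ-fix = fixed-· n (fixed-· n r-fix (fixed-1 n)) (trans (fr-sq n _)
      (cong sq (fixed-inv n (fixed-⊕ n (fixed-⊕ n r-fix (fixed-1 n)) ρ-fix))))
    total : Carrier → ℤ
    total ρ = χ (f ρ) +ℤ χ (inv ρ)
    sum-inv : ∑ (Fix n) (λ ρ → χ (inv ρ)) ≡ ℤ.0ℤ
    sum-inv = trans (∑-reindex inv inv-injective (fixed-inv n) χ)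
      (trans (∑-cong (Fix n) (λ {b} _ → cong χ (sym (*-identityʳ b)))) (∑-χ-scaled (fixed-1 n) 1≢0))
    sum-f : ∑ (Fix n) (λ ρ → χ (f ρ)) ≡ ℤ.0ℤ
    sum-f = trans (∑-cong (Fix n) (λ {ρ} _ → cong χ (trans (cong (_· sq (inv (r ⊕ 1# ⊕ ρ))) (*-identityʳ r)) (*-comm r _))))
      (trans (∑-reindex (λ ρ → sq (inv (r ⊕ 1# ⊕ ρ))) (λ eq → ⊕-cancelˡ (r ⊕ 1#) (inv-injective (sq-injective eq)))
          (λ p → trans (fr-sq n _) (cong sq (fixed-inv n (fixed-⊕ n (fixed-⊕ n r-fix (fixed-1 n)) p)))) (λ b → χ (b · r)))
        (∑-χ-scaled r-fix r≢0))
    total≡0 : ∑ (Fix n) total ≡ ℤ.0ℤ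
    total≡0 = trans (∑-distrib-+ (Fix n) _ _) (cong₂ _+ℤ_ sum-f sum-inv)
    χ≡1 : ∀ {v} → Fixed n v → Tr n v ≢ 1# → χ v ≡ ℤ.1ℤ
    χ≡1 v-fix ≢1 with Tr-binary n v-fix
    ... | inj₁ eq = sign-0 eq
    ... | inj₂ eq = ⊥-elim (≢1 eq)
    Found : Carrier → Set
    Found ρ = Tr n (f ρ) ≡ 1# × Tr n (inv ρ) ≡ 1#
    total≥0 : ¬ Any Found (Fix n) → ∀ {ρ} → Fixed n ρ → ℤ.0ℤ ℤ.≤ total ρ
    total≥0 ¬p {ρ} ρ-fix with Tr n (f ρ) ≟ 1# | Tr n (inv ρ) ≟ 1#
    ... | yes p | yes q = ⊥-elim (¬p (lose (∈-Fix⁺ n ρ-fix) (p , q)))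
    ... | no p  | _ = subst (λ c → ℤ.0ℤ ℤ.≤ c +ℤ χ (inv ρ)) (sym (χ≡1 (f-fix ρ-fix) p))
            (Int.+-monoʳ-≤ ℤ.1ℤ (sign-≥ (Tr n (inv ρ))))
    ... | yes _ | no q = subst (λ c → ℤ.0ℤ ℤ.≤ χ (f ρ) +ℤ c) (sym (χ≡1 (fixed-inv n ρ-fix) q))
            (Int.+-monoˡ-≤ ℤ.1ℤ (sign-≥ (Tr n (f ρ))))
    -- At ρ = 0 the argument is r/(r+1)² = i² + i with i = 1/(r+1), which has trace 0.
    f0 : Tr n (f 0#) ≡ 0#
    f0 = trans (cong (Tr n) (begin
        r · 1# · sq (inv (r ⊕ 1# ⊕ 0#)) ≡⟨ cong (λ u → r · 1# · sq (inv u)) (+-identityʳ (r ⊕ 1#)) ⟩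
        r · 1# · sq i ≡⟨ solve 2 (λ r i → r :* con true :* (i :* i) := i :* i :+ ((r :+ con true) :* i) :* i) refl r i ⟩
        sq i ⊕ (r ⊕ 1#) · i · i ≡⟨ cong (λ u → sq i ⊕ u · i) (inverseʳ r+1≢0) ⟩
        sq i ⊕ 1# · i ≡⟨ cong (sq i ⊕_) (*-identityˡ i) ⟩
        sq i ⊕ i ∎))
      (trans (Tr-telescope n i) (≡⇒⊕-≡0 (fixed-inv n (fixed-⊕ n r-fix (fixed-1 n)))))
      where
      open ≡-Reasoning
      i : Carrier
      i = inv (r ⊕ 1#)
    total-0 : total 0# ≡ + 2
    total-0 = cong₂ _+ℤ_ (sign-0 f0) (trans (cong χ inv-0) χ-0)
    positive : ¬ Any Found (Fix n) → ¬ (∃ λ rest → Fix n ↭ 0# ∷ rest × Unique (0# ∷ rest))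
    positive ¬p (rest , perm , _) = 2≰0 (begin
        + 2 ≤⟨ Int.+-monoʳ-≤ (+ 2) {ℤ.0ℤ} {∑ rest total} (subst (ℤ._≤ ∑ rest total)
                                       (∑-zero rest {λ _ → ℤ.0ℤ} (λ _ → refl))
                                       (∑-mono-≤ rest (λ x∈ → total≥0 ¬p (∈-Fix⁻ n (∈-resp-↭ (↭-sym perm) (there x∈)))))) ⟩
        + 2 +ℤ ∑ rest total ≡⟨ cong (_+ℤ ∑ rest total) total-0 ⟨
        ∑ (0# ∷ rest) total ≡⟨ ∑-↭ total perm ⟨
        ∑ (Fix n) total ≡⟨ total≡0 ⟩
        ℤ.0ℤ ∎)
      where
      open Int.≤-Reasoning
      2≰0 : ¬ (+ 2 ℤ.≤ ℤ.0ℤ)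
      2≰0 (ℤ.+≤+ ())
    search : Dec (Any Found (Fix n)) → ∃ λ ρ → Fixed n ρ × Found ρ
    search (yes p) with find p
    ... | ρ , ρ∈ , found = ρ , ∈-Fix⁻ n ρ∈ , found
    search (no ¬p) = ⊥-elim (positive ¬p (extract (Fix-unique n) (∈-Fix⁺ n (fixed-0 n))))

  sumK : List Carrier → Carrier
  sumK = foldr _⊕_ 0#

  ThreeSum : Carrier → Set
  ThreeSum w = ∃ λ L → All OnCircle L × length L ≤ 3 × sumK L ≡ w

  -- `decompose` with both coefficients equal to 1: then ρ + 1 + 1 = ρ, and the trace condition
  -- becomes one on ρ/ρ² = 1/ρ.
  trace-inv⇒two-sum : ∀ {ρ} → Fixed n ρ → Tr n (inv ρ) ≡ 1# →
    TwoTerm 1# 1# ρ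
  trace-inv⇒two-sum {ρ} ρ-fix Tr-ρ = decompose ρ-fix (fixed-1 n) (fixed-1 n) (trans (cong (Tr n) (begin
      ρ · 1# · sq (inv (ρ ⊕ 1# ⊕ 1#)) ≡⟨ cong (λ u → ρ · 1# · sq (inv u)) (solve 1 (λ ρ → ρ :+ con true :+ con true := ρ) refl ρ) ⟩
      ρ · 1# · sq (inv ρ) ≡⟨ solve 2 (λ ρ i → ρ :* con true :* (i :* i) := (ρ :* i) :* i) refl ρ (inv ρ) ⟩
      ρ · inv ρ · inv ρ ≡⟨ cong (_· inv ρ) (inverseʳ (λ ρ≡0 → Tr-nonzero Tr-ρ (trans (cong inv ρ≡0) inv-0))) ⟩
      1# · inv ρ ≡⟨ *-identityˡ _ ⟩
      inv ρ ∎)) Tr-ρ)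
    where open ≡-Reasoning

  fixed-three-sum : ∀ {r} → Fixed n r → r ≢ 0# →
    ThreeSum r
  fixed-three-sum {r} r-fix r≢0 with (r ⊕ 1#) ≟ 0#
  ... | yes eq = 1# ∷ [] , circle-1 ∷ [] , s≤s z≤n , trans (+-identityʳ 1#) (sym (⊕-≡0⇒≡ eq))
  ... | no r+1≢0 = via (auxiliary-element r-fix r≢0 r+1≢0)
    where
    join : ∀ {ρ} → TwoTerm 1# ρ r →
      TwoTerm 1# 1# ρ →
      ThreeSum r
    join (z , h , z-circle , h-circle , r≡) (x , y , x-circle , y-circle , ρ≡) =
        z ∷ x · h ∷ y · h ∷ []
      , z-circle ∷ circle-· x-circle h-circle ∷ circle-· y-circle h-circle ∷ []
      , ≤-refl
      , sym (trans r≡ (trans (cong (λ u → 1# · z ⊕ u · h) ρ≡)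
          (solve 4 (λ z h x y → con true :* z :+ (con true :* x :+ con true :* y) :* h
            := z :+ (x :* h :+ (y :* h :+ con false))) refl z h x y)))
    via : (∃ λ ρ → Fixed n ρ × Tr n (r · 1# · sq (inv (r ⊕ 1# ⊕ ρ))) ≡ 1# × Tr n (inv ρ) ≡ 1#) →
      ThreeSum r
    via (ρ , ρ-fix , Tr-r , Tr-ρ) =
      join (decompose r-fix (fixed-1 n) ρ-fix Tr-r) (trace-inv⇒two-sum ρ-fix Tr-ρ)

  sumK-scale : ∀ h L → sumK (map (h ·_) L) ≡ h · sumK L
  sumK-scale h [] = sym (zeroʳ h)
  sumK-scale h (x ∷ L) = trans (cong (h · x ⊕_) (sumK-scale h L)) (sym (distribˡ h x (sumK L)))

  -- Polar decomposition w = r h with r ∈ 𝔽_q, r² = w w̄ and h on the circle.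
  three-sum : ∀ w → ThreeSum w
  three-sum w with w ≟ 0#
  ... | yes refl = [] , [] , z≤n , refl
  ... | no w≢0 = scale (fixed-three-sum r-fix r≢0)
    where
    open ≡-Reasoning
    N r h : Carrier
    N = w · fr n w
    -- The square root of N: on 𝔽_{2^{2n}}, squaring is inverted by its own (2n - 1)-fold iterate.
    r = fr (ℕ.pred (n + n)) N
    h = w · inv r
    sq-r : sq r ≡ N
    sq-r = trans (cong (λ k → fr k N) (Nat.suc-pred (n + n) {{ℕ.>-nonZero (≤-trans n>0 (m≤m+n n n))}})) (fixed-all N)
    N≢0 : N ≢ 0#
    N≢0 = *-nonzero w≢0 (fr-nonzero n w≢0)
    r≢0 : r ≢ 0#
    r≢0 eq = N≢0 (trans (sym sq-r) (trans (cong sq eq) (zeroˡ 0#)))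
    r-fix : Fixed n r
    r-fix = sq-injective (begin
      sq (fr n r) ≡⟨ fr-sq n r ⟨
      fr n (sq r) ≡⟨ cong (fr n) sq-r ⟩
      fr n (w · fr n w) ≡⟨ fr-· n w (fr n w) ⟩
      fr n w · fr n (fr n w) ≡⟨ cong (fr n w ·_) (fr-involutive w) ⟩
      fr n w · w ≡⟨ *-comm _ w ⟩
      N ≡⟨ sq-r ⟨
      sq r ∎)
    h-circle : OnCircle h
    h-circle = begin
      w · inv r · fr n (w · inv r) ≡⟨ cong (w · inv r ·_) (trans (fr-· n w _) (cong (fr n w ·_) (fixed-inv n r-fix))) ⟩
      w · inv r · (fr n w · inv r) ≡⟨ solve 3 (λ w i v → w :* i :* (v :* i) := (w :* v) :* (i :* i)) refl w (inv r) (fr n w) ⟩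
      N · sq (inv r) ≡⟨ cong (_· sq (inv r)) sq-r ⟨
      sq r · sq (inv r) ≡⟨ solve 2 (λ r i → (r :* r) :* (i :* i) := (r :* i) :* (r :* i)) refl r (inv r) ⟩
      sq (r · inv r) ≡⟨ trans (cong sq (inverseʳ r≢0)) (*-identityˡ 1#) ⟩
      1# ∎
    scale : ThreeSum r →
      ThreeSum w
    scale (L , L-circle , len , sum≡) = map (h ·_) L
      , All.tabulate on-circle
      , subst (_≤ 3) (sym (length-map (h ·_) L)) len
      , (begin
          sumK (map (h ·_) L) ≡⟨ sumK-scale h L ⟩
          h · sumK L ≡⟨ cong (h ·_) sum≡ ⟩
          w · inv r · r ≡⟨ *-assoc w _ _ ⟩
          w · (inv r · r) ≡⟨ cong (w ·_) (inverseˡ r≢0) ⟩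
          w · 1# ≡⟨ *-identityʳ w ⟩
          w ∎)
      where
      on-circle : ∀ {x} → x ∈ map (h ·_) L → OnCircle x
      on-circle x∈ with ∈-map⁻ (h ·_) x∈
      ... | y , y∈ , refl = circle-· h-circle (All.lookup L-circle y∈)

-- Existence of good elements by averaging character sums.

-- Of the m + 2 coefficients at a further point, exactly 2 create no new pole.
module Costs (m : ℕ) (cost : ℕ → ℕ) where

  -- The total error over all coefficient families at l remaining points: `poleCost l g` when g + 1
  -- poles are already present, `startCost l` when there is none. A sum without poles is exact,
  -- hence the 0.
  poleCost : ℕ → ℕ → ℕ
  poleCost zero    g = cost g
  poleCost (suc l) g = 2 * poleCost l g + m * poleCost l (suc g)

  startCost : ℕ → ℕ
  startCost zero = 0
  startCost (suc l) = 2 * startCost l + m * poleCost l 0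

module Existence (K : FiniteField) (char2 : HasChar2 K)
  (n : ℕ) (n>0 : 0 < n) (size≡ : FiniteField.size K ≡ 2 ^ (n + n))
  (e : ℕ) (n' : ℕ) (n≡ : n ≡ n' * e) where
  open Syndromes K char2 n n>0 size≡ public

  F0 : List Carrier
  F0 = Fix e

  e⇒n : ∀ {x} → Fixed e x → Fixed n x
  e⇒n {x} p = subst (λ m → Fixed m x) (sym n≡) (fr-fixed-* e n' p)

  -- Off 𝔽_{q0} no denominator x + c with c ∈ 𝔽_{q0} vanishes.
  InX : Carrier → Set
  InX x = Fixed n x × ¬ Fixed e x

  X : List Carrier
  X = filter (λ x → ¬? (fr e x ≟ x)) (Fix n)

  X-unique : Unique X
  X-unique = Uniq.filter⁺ _ (Fix-unique n)

  ∈-X⁻ : ∀ {x} → x ∈ X → InX x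
  ∈-X⁻ x∈ with ∈-filter⁻ (λ x → ¬? (fr e x ≟ x)) {xs = Fix n} x∈
  ... | x∈n , ¬fix = ∈-Fix⁻ n x∈n , ¬fix

  length-X : length (Fix n) ≤ length X + length F0
  length-X = subst (length (Fix n) ≤_) (length-++ X) (unique-⊆⇒length≤ (Fix-unique n) sub)
    where
    sub : ∀ {z} → z ∈ Fix n → z ∈ X ++ F0
    sub {z} z∈ with fr e z ≟ z
    ... | yes p = ∈-++⁺ʳ X (∈-Fix⁺ e p)
    ... | no ¬p = ∈-++⁺ˡ (∈-filter⁺ (λ x → ¬? (fr e x ≟ x)) z∈ ¬p)

  term : Carrier → Carrier → Carrier → Carrier
  term b c x = b · (x · sq (inv (x ⊕ c)))

  term-fixed : ∀ {b c x} → Fixed n b → Fixed n c → Fixed n x → Fixed n (term b c x)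
  term-fixed b-fix c-fix x-fix = fixed-· n b-fix (fixed-· n x-fix
    (trans (fr-sq n _) (cong sq (fixed-inv n (fixed-⊕ n x-fix c-fix)))))

  Good : Carrier → Set
  Good x = ∀ {b c} → Fixed e b → Fixed e c → Tr n (term b c x) ≡ 0#

  -- charSum cs x v = Σ χ(v + Σ_{c ∈ cs} b_c x/(x+c)²) over all families (b_c) in 𝔽_{q0}.
  charSum : List Carrier → Carrier → Carrier → ℤ
  charSum []       x v = χ v
  charSum (c ∷ cs) x v = ∑ F0 (λ b → charSum cs x (v ⊕ term b c x))

  charSum-⊕ : ∀ {cs} → All (Fixed e) cs → ∀ {x v w} → Fixed n x → Fixed n v → Fixed n w →
    charSum cs x (v ⊕ w) ≡ charSum cs x v *ℤ χ w
  charSum-⊕ []                 x-fix v-fix w-fix = χ-⊕ v-fix w-fix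
  charSum-⊕ {c ∷ cs} (c-fix ∷ cs-fix) {x} {v} {w} x-fix v-fix w-fix = trans
    (∑-cong F0 (λ {b} b∈ → trans (cong (charSum cs x) (solve 3 (λ v w t → v :+ w :+ t := v :+ t :+ w) refl v w (term b c x)))
      (charSum-⊕ cs-fix x-fix (fixed-⊕ n v-fix (term-fixed (e⇒n (∈-Fix⁻ e b∈)) (e⇒n c-fix) x-fix)) w-fix)))
    (∑-distribʳ-* F0 (λ b → charSum cs x (v ⊕ term b c x)) (χ w))

  -- The sum over b_c factors out, and it runs over a nontrivial additive character of 𝔽_{q0}.
  charSum-bad : ∀ {cs} → All (Fixed e) cs → ∀ {x b c} → Fixed n x → c ∈ cs → Fixed e b →
    Tr n (term b c x) ≢ 0# → ∀ {v} → Fixed n v → charSum cs x v ≡ ℤ.0ℤ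
  charSum-bad {c ∷ cs} (c-fix ∷ cs-fix) {x} {b} x-fix (here refl) b-fix Tr≢0 {v} v-fix = begin
      ∑ F0 (λ b → charSum cs x (v ⊕ term b c x)) ≡⟨ ∑-cong F0 factor ⟩
      ∑ F0 (λ b → χ (term b c x) *ℤ charSum cs x v) ≡⟨ ∑-distribʳ-* F0 (λ b → χ (term b c x)) (charSum cs x v) ⟩
      ∑ F0 (λ b → χ (term b c x)) *ℤ charSum cs x v ≡⟨ cong (_*ℤ charSum cs x v) (∑-χ-linear e _ e⇒n h-fix (b , b-fix , Tr≢0)) ⟩
      ℤ.0ℤ *ℤ charSum cs x v ≡⟨ Int.*-zeroˡ (charSum cs x v) ⟩
      ℤ.0ℤ ∎
    where
    open ≡-Reasoning
    h-fix : Fixed n (x · sq (inv (x ⊕ c)))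
    h-fix = subst (Fixed n) (*-identityˡ _) (term-fixed (fixed-1 n) (e⇒n c-fix) x-fix)
    factor : ∀ {b} → b ∈ F0 → charSum cs x (v ⊕ term b c x) ≡ χ (term b c x) *ℤ charSum cs x v
    factor {b} b∈ = trans (charSum-⊕ cs-fix x-fix v-fix (term-fixed (e⇒n (∈-Fix⁻ e b∈)) (e⇒n c-fix) x-fix))
      (Int.*-comm (charSum cs x v) (χ (term b c x)))
  charSum-bad (c-fix ∷ cs-fix) x-fix (there c∈) b-fix Tr≢0 v-fix = ∑-zero F0 (λ b∈ →
    charSum-bad cs-fix x-fix c∈ b-fix Tr≢0 (fixed-⊕ n v-fix (term-fixed (e⇒n (∈-Fix⁻ e b∈)) (e⇒n c-fix) x-fix)))

  total : List Carrier → (Carrier → Carrier) → ℤ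
  total cs F = ∑ X (λ x → charSum cs x (F x))

  total-∷ : ∀ c cs F → total (c ∷ cs) F ≡ ∑ F0 (λ b → total cs (λ x → F x ⊕ term b c x))
  total-∷ c cs F = ∑-swap X F0 (λ x b → charSum cs x (F x ⊕ term b c x))

  -- Simple poles modulo trace-zero functions.

  √ : Carrier → Carrier
  √ = fr (ℕ.pred n)

  √-sq : ∀ {v} → Fixed n v → sq (√ v) ≡ v
  √-sq {v} v-fix = trans (cong (λ k → fr k v) (Nat.suc-pred n {{ℕ.>-nonZero n>0}})) v-fix

  √-fixed : ∀ {v} → Fixed n v → Fixed n (√ v)
  √-fixed {v} v-fix = sq-injective (trans (sym (fr-sq n _)) (trans (cong (fr n) (√-sq v-fix)) (trans v-fix (sym (√-sq v-fix)))))

  -- b x/(x+c)² = b/(x+c) + bc/(x+c)², and the last term has the same trace as its square root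
  -- √(bc)/(x+c). This is the coefficient of the simple pole that results; it vanishes when b² = bc.
  residue : Carrier → Carrier → Carrier
  residue b c = b ⊕ √ (b · c)

  residue-fixed : ∀ {b c} → Fixed n b → Fixed n c → Fixed n (residue b c)
  residue-fixed b-fix c-fix = fixed-⊕ n b-fix (√-fixed (fixed-· n b-fix c-fix))

  residue-≡0 : ∀ {b c} → Fixed n b → Fixed n c → residue b c ≡ 0# → b ≡ 0# ⊎ b ≡ c
  residue-≡0 {b} {c} b-fix c-fix eq with *-zero-split {b} {b ⊕ c}
    (trans (solve 2 (λ b c → b :* (b :+ c) := b :* b :+ b :* c) refl b c)
      (≡⇒⊕-≡0 (trans (cong sq (⊕-≡0⇒≡ eq)) (√-sq (fixed-· n b-fix c-fix)))))
  ... | inj₁ p = inj₁ p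
  ... | inj₂ p = inj₂ (⊕-≡0⇒≡ p)

  Tr-term : ∀ {b c x} → Fixed n b → Fixed n c → Fixed n x → x ≢ c →
    Tr n (term b c x) ≡ Tr n (residue b c · inv (x ⊕ c))
  Tr-term {b} {c} {x} b-fix c-fix x-fix x≢c = begin
      Tr n (b · (x · sq i))
        ≡⟨ cong (Tr n) (solve 4 (λ b x c i → b :* (x :* (i :* i)) := b :* (((x :+ c) :* i) :* i) :+ (b :* c) :* (i :* i)) refl b x c i) ⟩
      Tr n (b · ((x ⊕ c) · i · i) ⊕ (b · c) · sq i)
        ≡⟨ cong₂ (λ u v → Tr n (b · (u · i) ⊕ v · sq i)) (inverseʳ (λ eq → x≢c (⊕-≡0⇒≡ eq))) (sym (√-sq (fixed-· n b-fix c-fix))) ⟩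
      Tr n (b · (1# · i) ⊕ sq r · sq i)
        ≡⟨ cong (Tr n) (solve 3 (λ b i r → b :* (con true :* i) :+ (r :* r) :* (i :* i) := b :* i :+ (r :* i) :* (r :* i)) refl b i r) ⟩
      Tr n (b · i ⊕ sq (r · i))
        ≡⟨ trans (Tr-⊕ n _ _) (cong (Tr n (b · i) ⊕_) (Tr-fixed-sq n (fixed-· n (√-fixed (fixed-· n b-fix c-fix))
             (fixed-inv n (fixed-⊕ n x-fix c-fix))))) ⟩
      Tr n (b · i) ⊕ Tr n (r · i)
        ≡⟨ trans (sym (Tr-⊕ n _ _)) (cong (Tr n) (sym (distribʳ i b r))) ⟩
      Tr n (residue b c · i) ∎
    where
    open ≡-Reasoning
    i r : Carrier
    i = inv (x ⊕ c)
    r = √ (b · c)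

  X≢ : ∀ {x c} → InX x → Fixed e c → x ≢ c
  X≢ (_ , ¬fix) c-fix refl = ¬fix c-fix

  Trivial : (Carrier → Carrier) → Set
  Trivial F = ∀ {x} → InX x → Fixed n (F x) × Tr n (F x) ≡ 0#

  trivial-term : ∀ {b c} → b ≡ 0# ⊎ b ≡ c → Fixed e c → Trivial (term b c)
  trivial-term {c = c} (inj₁ refl) c-fix {x} (x-fix , _) =
    term-fixed (fixed-0 n) (e⇒n c-fix) x-fix , trans (cong (Tr n) (zeroˡ _)) (Tr-0 n)
  trivial-term {c = c} (inj₂ refl) c-fix {x} x∈@(x-fix , _) = term-fixed (e⇒n c-fix) (e⇒n c-fix) x-fix
    , trans (Tr-term (e⇒n c-fix) (e⇒n c-fix) x-fix (X≢ x∈ c-fix))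
        (trans (cong (λ u → Tr n (u · inv (x ⊕ c))) (≡⇒⊕-≡0 (sym (sq-injective (√-sq (fixed-· n (e⇒n c-fix) (e⇒n c-fix)))))))
          (trans (cong (Tr n) (zeroˡ _)) (Tr-0 n)))

  trivial-⊕ : ∀ {F G} → Trivial F → Trivial G → Trivial (λ x → F x ⊕ G x)
  trivial-⊕ F-triv G-triv x∈ = fixed-⊕ n (proj₁ (F-triv x∈)) (proj₁ (G-triv x∈))
    , trans (Tr-⊕ n _ _) (trans (cong₂ _⊕_ (proj₂ (F-triv x∈)) (proj₂ (G-triv x∈))) (+-identityˡ 0#))

  -- Up to trace-zero functions, F is N/D in the coordinate t = 1/(x + c0), which moves a
  -- genuine pole c0 of F to infinity.
  record Pole (c0 : Carrier) (g : ℕ) (F : Carrier → Carrier) : Set where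
    field
      D N φ : Carrier → Carrier
      D-deg : Degree g D
      N-deg : Degree (suc g) N
      F-fixed : ∀ {x} → InX x → Fixed n (F x)
      φ-fixed : ∀ {x} → InX x → Fixed n (φ x)
      D-fixed : ∀ {x} → InX x → Fixed n (D (inv (x ⊕ c0)))
      D≢0 : ∀ {x} → InX x → D (inv (x ⊕ c0)) ≢ 0#
      quotient : ∀ {x} → InX x → φ x · D (inv (x ⊕ c0)) ≡ N (inv (x ⊕ c0))
      trace : ∀ {x} → InX x → Tr n (F x) ≡ Tr n (φ x)

  pole-trivial : ∀ {c0 g F G} → Pole c0 g F → Trivial G → Pole c0 g (λ x → F x ⊕ G x)
  pole-trivial P G-triv = record
    { Pole P
    ; F-fixed = λ x∈ → fixed-⊕ n (Pole.F-fixed P x∈) (proj₁ (G-triv x∈))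
    ; trace = λ x∈ → trans (Tr-⊕ n _ _) (trans (cong₂ _⊕_ (Pole.trace P x∈) (proj₂ (G-triv x∈))) (+-identityʳ _))
    }

  pole-start : ∀ {b c F} → Trivial F → Fixed e b → Fixed e c → residue b c ≢ 0# → Pole c 0 (λ x → F x ⊕ term b c x)
  pole-start {b} {c} {F} F-triv b-fix c-fix β≢0 = record
    { D = λ _ → 1#
    ; N = λ t → residue b c · t
    ; φ = λ x → residue b c · inv (x ⊕ c)
    ; D-deg = 1# , 1≢0 , const (λ _ → refl)
    ; N-deg = residue b c · 1# , *-nonzero β≢0 1≢0 , poly-scale (residue b c) poly-id
    ; F-fixed = λ x∈ → fixed-⊕ n (proj₁ (F-triv x∈)) (term-fixed (e⇒n b-fix) (e⇒n c-fix) (proj₁ x∈))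
    ; φ-fixed = λ x∈ → fixed-· n (residue-fixed (e⇒n b-fix) (e⇒n c-fix)) (fixed-inv n (fixed-⊕ n (proj₁ x∈) (e⇒n c-fix)))
    ; D-fixed = λ _ → fixed-1 n
    ; D≢0 = λ _ → 1≢0
    ; quotient = λ _ → *-identityʳ _
    ; trace = λ x∈ → trans (Tr-⊕ n _ _) (trans (cong₂ _⊕_ (proj₂ (F-triv x∈))
        (Tr-term (e⇒n b-fix) (e⇒n c-fix) (proj₁ x∈) (X≢ x∈ c-fix))) (+-identityˡ _))
    }

  -- 1/(x+c) = t ε / (t + ε) with t = 1/(x+c0) and ε = 1/(c0+c).
  module _ {c0 c : Carrier} (c0-fix : Fixed e c0) (c-fix : Fixed e c) (c≢c0 : c ≢ c0) where
    private
      ε : Carrier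
      ε = inv (c0 ⊕ c)
      δ≢0 : c0 ⊕ c ≢ 0#
      δ≢0 eq = c≢c0 (sym (⊕-≡0⇒≡ eq))
      ε-fix : Fixed n ε
      ε-fix = fixed-inv n (fixed-⊕ n (e⇒n c0-fix) (e⇒n c-fix))

    shifted-coordinate : ∀ {x} → InX x → inv (x ⊕ c0) ⊕ ε ≡ inv (x ⊕ c0) · ε · (x ⊕ c)
    shifted-coordinate {x} x∈ = begin
        t ⊕ ε
          ≡⟨ solve 2 (λ t ε → t :+ ε := t :* con true :+ ε :* con true) refl t ε ⟩
        t · 1# ⊕ ε · 1#
          ≡⟨ cong₂ (λ u v → t · u ⊕ ε · v) (sym (inverseʳ δ≢0)) (sym (inverseʳ (λ eq → X≢ x∈ c0-fix (⊕-≡0⇒≡ eq)))) ⟩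
        t · ((c0 ⊕ c) · ε) ⊕ ε · ((x ⊕ c0) · t)
          ≡⟨ solve 5 (λ t ε x c0 c → t :* ((c0 :+ c) :* ε) :+ ε :* ((x :+ c0) :* t) := t :* ε :* (x :+ c)) refl t ε x c0 c ⟩
        t · ε · (x ⊕ c) ∎
      where
      open ≡-Reasoning
      t : Carrier
      t = inv (x ⊕ c0)

    -- The denominator gains the factor t + ε. The new contribution βεtD to the numerator has degree
    -- at most g + 1, below the g + 2 of N(t + ε), so the pole at infinity persists.
    pole-add : ∀ {b g F} → Fixed e b → Pole c0 g F → Pole c0 (suc g) (λ x → F x ⊕ term b c x)
    pole-add {b} {g} {F} b-fix P = record
      { D = λ t → D t · (t ⊕ ε)
      ; N = λ t → N t · (t ⊕ ε) ⊕ β · ε · (t · D t)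
      ; φ = λ x → φ x ⊕ β · inv (x ⊕ c)
      ; D-deg = degree-cast (Nat.+-comm g 1) (degree-· D-deg linear)
      ; N-deg = degree-⊕-lower (n<1+n (suc g)) (degree-cast (Nat.+-comm (suc g) 1) (degree-· N-deg linear))
          (β · ε · proj₁ D-deg , poly-scale (β · ε) (poly-shift (proj₂ (proj₂ D-deg))))
      ; F-fixed = λ x∈ → fixed-⊕ n (F-fixed x∈) (term-fixed (e⇒n b-fix) (e⇒n c-fix) (proj₁ x∈))
      ; φ-fixed = λ x∈ → fixed-⊕ n (φ-fixed x∈) (fixed-· n β-fix (fixed-inv n (fixed-⊕ n (proj₁ x∈) (e⇒n c-fix))))
      ; D-fixed = λ x∈ → fixed-· n (D-fixed x∈) (fixed-⊕ n (fixed-inv n (fixed-⊕ n (proj₁ x∈) (e⇒n c0-fix))) ε-fix)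
      ; D≢0 = λ {x} x∈ → *-nonzero (D≢0 x∈) (subst (_≢ 0#) (sym (shifted-coordinate x∈))
          (*-nonzero (*-nonzero (inv-nonzero (λ eq → X≢ x∈ c0-fix (⊕-≡0⇒≡ eq))) (inv-nonzero δ≢0)) (x+c≢0 x∈)))
      ; quotient = λ {x} x∈ → quotient' x∈ (inv (x ⊕ c0)) (inv (x ⊕ c)) refl (inverseʳ (x+c≢0 x∈))
      ; trace = λ x∈ → trans (Tr-⊕ n _ _) (trans (cong₂ _⊕_ (trace x∈)
          (Tr-term (e⇒n b-fix) (e⇒n c-fix) (proj₁ x∈) (X≢ x∈ c-fix))) (sym (Tr-⊕ n _ _)))
      }
      where
      open Pole P
      open ≡-Reasoning
      β : Carrier
      β = residue b c
      β-fix : Fixed n β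
      β-fix = residue-fixed (e⇒n b-fix) (e⇒n c-fix)
      linear : Degree 1 (λ t → t ⊕ ε)
      linear = degree-⊕-lower (s≤s z≤n) (1# , 1≢0 , poly-id) (ε , const (λ _ → refl))
      x+c≢0 : ∀ {x} → InX x → x ⊕ c ≢ 0#
      x+c≢0 x∈ eq = X≢ x∈ c-fix (⊕-≡0⇒≡ eq)
      quotient' : ∀ {x} → InX x → ∀ t i → inv (x ⊕ c0) ≡ t → (x ⊕ c) · i ≡ 1# →
        (φ x ⊕ β · i) · (D t · (t ⊕ ε)) ≡ N t · (t ⊕ ε) ⊕ β · ε · (t · D t)
      quotient' {x} x∈ t i refl xi = begin
        (φ x ⊕ β · i) · (D t · (t ⊕ ε))
          ≡⟨ solve 5 (λ p b i d s → (p :+ b :* i) :* (d :* s) := (p :* d) :* s :+ b :* d :* (s :* i)) refl (φ x) β i (D t) (t ⊕ ε) ⟩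
        φ x · D t · (t ⊕ ε) ⊕ β · D t · ((t ⊕ ε) · i)
          ≡⟨ cong₂ (λ u v → u · (t ⊕ ε) ⊕ β · D t · v) (quotient x∈)
               (trans (cong (_· i) (shifted-coordinate x∈)) (trans (*-assoc (t · ε) (x ⊕ c) i) (cong (t · ε ·_) xi))) ⟩
        N t · (t ⊕ ε) ⊕ β · D t · (t · ε · 1#)
          ≡⟨ solve 5 (λ k b d t ε → k :+ b :* d :* (t :* ε :* con true) := k :+ b :* ε :* (t :* d)) refl (N t · (t ⊕ ε)) β (D t) t ε ⟩
        N t · (t ⊕ ε) ⊕ β · ε · (t · D t) ∎

  -- From point counts to lower bounds for the sums.

  sign-count : ∀ (h : Carrier → Carrier) xs →
    ∑ xs (λ x → sign (h x)) +ℤ + (2 * length (filter (λ x → ¬? (h x ≟ 0#)) xs)) ≡ + length xs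
  sign-count h [] = refl
  sign-count h (x ∷ xs) with h x ≟ 0#
  ... | yes _ = trans (Int.+-assoc ℤ.1ℤ (∑ xs (λ x → sign (h x))) (+ (2 * length (filter (λ x → ¬? (h x ≟ 0#)) xs))))
      (cong (ℤ.1ℤ +ℤ_) (sign-count h xs))
  ... | no  _ = begin
      ℤ.-1ℤ +ℤ s +ℤ + (2 * suc k) ≡⟨ cong (λ m → ℤ.-1ℤ +ℤ s +ℤ + m) (Nat.*-suc 2 k) ⟩
      ℤ.-1ℤ +ℤ s +ℤ (+ 2 +ℤ + (2 * k)) ≡⟨ rearrange s (+ (2 * k)) ⟩
      ℤ.1ℤ +ℤ (s +ℤ + (2 * k)) ≡⟨ cong (ℤ.1ℤ +ℤ_) (sign-count h xs) ⟩
      + suc (length xs) ∎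
    where
    open ≡-Reasoning
    s = ∑ xs (λ x → sign (h x))
    k = length (filter (λ x → ¬? (h x ≟ 0#)) xs)
    rearrange : ∀ s m → ℤ.-1ℤ +ℤ s +ℤ (+ 2 +ℤ m) ≡ ℤ.1ℤ +ℤ (s +ℤ m)
    rearrange = ℤ-ring

  exceptional : (Carrier → Carrier) → List Carrier
  exceptional F = filter (λ x → ¬? (Tr n (F x) ≟ 0#)) X

  exceptional-bound⇒ : ∀ F k → 2 * length (exceptional F) ≤ length X + k → ℤ.- (+ k) ℤ.≤ total [] F
  exceptional-bound⇒ F k le = Int.≤-trans (Int.≤-reflexive (identity (+ k) (+ length X)))
      (Int.≤-trans (Int.+-monoʳ-≤ (+ length X) (Int.neg-mono-≤ (ℤ.+≤+ le)))
        (Int.≤-reflexive (trans (cong (_+ℤ ℤ.- (+ (2 * length (exceptional F)))) (sym (sign-count (λ x → Tr n (F x)) X)))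
          (cancel (total [] F) _))))
    where
    identity : ∀ k x → ℤ.- k ≡ x +ℤ ℤ.- (x +ℤ k)
    identity = ℤ-ring
    cancel : ∀ s m → s +ℤ m +ℤ ℤ.- m ≡ s
    cancel = ℤ-ring

  -- With z = Dy, the equation y² + y = N/D becomes z² = Dz + DN, where DN has degree g + (g + 1) as
  -- Stepanov's method requires. Where the trace is 1, Frobenius exchanges y and y + 1, so the point
  -- is inert.
  pole-exceptional : ∀ {c0 g F} → Fixed e c0 → Pole c0 g F → ∀ {a b} → n ≡ suc a + suc b → a ≤ b →
    suc g * suc g < 2 ^ a + 2 ^ a → suc (length (exceptional F)) ≤ 2 ^ a + 2 ^ suc b * (2 ^ a + g)
  pole-exceptional {c0} {g} {F} c0-fix P {a} {b} n≡ab a≤b large =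
    subst (λ m → suc m ≤ 2 ^ a + 2 ^ suc b * (2 ^ a + g)) (length-map coordinate (exceptional F))
      (stepanov (degree⇒deg≤ D-deg) (degree-cast (Nat.+-suc g g) (degree-· D-deg N-deg)) a≤b large
        (Uniq.map⁺ (λ eq → trans (⊕-shift (inv-injective eq)) (solve 2 (λ y c → y :+ c :+ c := y) refl _ c0))
          (Uniq.filter⁺ _ X-unique)) points)
    where
    open Pole P
    open ≡-Reasoning
    coordinate : Carrier → Carrier
    coordinate x = inv (x ⊕ c0)
    inert : ∀ {x} → InX x → ∀ t → coordinate x ≡ t → (∃ λ y → sq y ⊕ y ≡ φ x × fr n y ≡ y ⊕ 1#) →
      InertPoint n D (λ t → D t · N t) t
    inert {x} x∈ t refl (y , y-eq , y-inert) = fixed-inv n (fixed-⊕ n (proj₁ x∈) (e⇒n c0-fix)) , D≢0 x∈ , D-fixed x∈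
      , D t · y
      , (begin
          sq (D t · y) ≡⟨ solve 2 (λ d y → (d :* y) :* (d :* y) := d :* (d :* y) :+ d :* ((y :* y :+ y) :* d)) refl (D t) y ⟩
          D t · (D t · y) ⊕ D t · ((sq y ⊕ y) · D t) ≡⟨ cong (λ u → D t · (D t · y) ⊕ D t · u) (trans (cong (_· D t) y-eq) (quotient x∈)) ⟩
          D t · (D t · y) ⊕ D t · N t ∎)
      , (begin
          fr n (D t · y) ≡⟨ fr-· n (D t) y ⟩
          fr n (D t) · fr n y ≡⟨ cong₂ _·_ (D-fixed x∈) y-inert ⟩
          D t · (y ⊕ 1#) ≡⟨ solve 2 (λ d y → d :* (y :+ con true) := d :* y :+ d) refl (D t) y ⟩
          D t · y ⊕ D t ∎)
    points : ∀ {t} → t ∈ map coordinate (exceptional F) → InertPoint (suc a + suc b) D (λ t → D t · N t) t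
    points t∈ with ∈-map⁻ coordinate t∈
    ... | x , x∈ , refl with ∈-filter⁻ (λ x → ¬? (Tr n (F x) ≟ 0#)) {xs = X} x∈
    ...   | x∈X , Tr≢0 = subst (λ m → InertPoint m D (λ t → D t · N t) (coordinate x)) n≡ab
              (inert (∈-X⁻ x∈X) (coordinate x) refl (inert-root (φ-fixed (∈-X⁻ x∈X)) (one (Tr-binary n (φ-fixed (∈-X⁻ x∈X))))))
      where
      one : Tr n (φ x) ≡ 0# ⊎ Tr n (φ x) ≡ 1# → Tr n (φ x) ≡ 1#
      one (inj₁ eq) = ⊥-elim (Tr≢0 (trans (trace (∈-X⁻ x∈X)) eq))
      one (inj₂ eq) = eq

  ∑-lower : ∀ xs (f : Carrier → ℤ) b → (∀ {x} → x ∈ xs → ℤ.- (+ b) ℤ.≤ f x) → ℤ.- (+ (length xs * b)) ℤ.≤ ∑ xs f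
  ∑-lower xs f b le = Int.≤-trans (Int.≤-reflexive (begin
      ℤ.- (+ (length xs * b)) ≡⟨ cong ℤ.-_ (Int.pos-* (length xs) b) ⟩
      ℤ.- (+ length xs *ℤ + b) ≡⟨ Int.neg-distribʳ-* (+ length xs) (+ b) ⟩
      + length xs *ℤ ℤ.- (+ b) ≡⟨ ∑-const xs (ℤ.- (+ b)) ⟨
      ∑ xs (λ _ → ℤ.- (+ b)) ∎)) (∑-mono-≤ xs le)
    where open ≡-Reasoning

  module Recursion (m : ℕ) (cost : ℕ → ℕ)
    (cost-bound : ∀ {c0 g F} → Fixed e c0 → Pole c0 g F → 2 * length (exceptional F) ≤ length X + cost g) where

    open Costs m cost

    Split : Carrier → Set
    Split c = ∃ λ rest → F0 ↭ 0# ∷ c ∷ rest × Unique (0# ∷ c ∷ rest) × length rest ≡ m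

    -- Isolates the coefficients 0 and c, which create no pole at c; they need a better estimate
    -- than the m others.
    split-sum : ∀ {c} → Split c → (f : Carrier → ℤ) → ∀ b → (∀ {x} → Fixed e x → x ≢ 0# → x ≢ c → ℤ.- (+ b) ℤ.≤ f x) →
      f 0# +ℤ (f c +ℤ ℤ.- (+ (m * b))) ℤ.≤ ∑ F0 f
    split-sum {c} (rest , perm , (0∉ ∷ c∉ ∷ _) , refl) f b le = Int.≤-trans
      (Int.+-monoʳ-≤ (f 0#) (Int.+-monoʳ-≤ (f c) (∑-lower rest f b (λ x∈ →
        le (∈-Fix⁻ e (∈-resp-↭ (↭-sym perm) (there (there x∈))))
          (λ x≡0 → All.lookup 0∉ (there x∈) (sym x≡0)) (λ x≡c → All.lookup c∉ x∈ (sym x≡c))))))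
      (Int.≤-reflexive (sym (∑-↭ f perm)))

    double-neg : ∀ p r → ℤ.- (+ (2 * p + r)) ≡ ℤ.- (+ p) +ℤ (ℤ.- (+ p) +ℤ ℤ.- (+ r))
    double-neg p r = trans (cong ℤ.-_ (trans (Int.pos-+ (2 * p) r) (cong (_+ℤ + r) (Int.pos-* 2 p)))) (identity (+ p) (+ r))
      where
      identity : ∀ p r → ℤ.- (+ 2 *ℤ p +ℤ r) ≡ ℤ.- p +ℤ (ℤ.- p +ℤ ℤ.- r)
      identity = ℤ-ring

    total-pole : ∀ {cs} → All (Fixed e) cs → All Split cs → ∀ {c0 g F} → Fixed e c0 → All (_≢ c0) cs →
      Pole c0 g F → ℤ.- (+ poleCost (length cs) g) ℤ.≤ total cs F
    total-pole [] _ {g = g} {F} c0-fix _ P = exceptional-bound⇒ F (cost g) (cost-bound c0-fix P)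
    total-pole {c ∷ cs} (c-fix ∷ cs-fix) (split ∷ splits) {c0} {g} {F} c0-fix (c≢c0 ∷ cs≢) P = begin
        ℤ.- (+ poleCost (suc l) g)
          ≡⟨ double-neg (poleCost l g) (m * poleCost l (suc g)) ⟩
        ℤ.- (+ poleCost l g) +ℤ (ℤ.- (+ poleCost l g) +ℤ ℤ.- (+ (m * poleCost l (suc g))))
          ≤⟨ Int.+-mono-≤ (same (inj₁ refl)) (Int.+-monoˡ-≤ _ (same (inj₂ refl))) ⟩
        f 0# +ℤ (f c +ℤ ℤ.- (+ (m * poleCost l (suc g))))
          ≤⟨ split-sum split f (poleCost l (suc g)) (λ b-fix _ _ →
               total-pole cs-fix splits c0-fix cs≢ (pole-add c0-fix c-fix c≢c0 b-fix P)) ⟩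
        ∑ F0 f
          ≡⟨ total-∷ c cs F ⟨
        total (c ∷ cs) F ∎
      where
      open Int.≤-Reasoning
      l : ℕ
      l = length cs
      f : Carrier → ℤ
      f b = total cs (λ x → F x ⊕ term b c x)
      same : ∀ {b} → b ≡ 0# ⊎ b ≡ c → ℤ.- (+ poleCost l g) ℤ.≤ f b
      same b≡ = total-pole cs-fix splits c0-fix cs≢ (pole-trivial P (trivial-term b≡ c-fix))

    total-[]-trivial : ∀ {F} → Trivial F → total [] F ≡ + length X
    total-[]-trivial {F} F-triv = trans (∑-cong X (λ x∈ → sign-0 (proj₂ (F-triv (∈-X⁻ x∈)))))
      (trans (∑-const X ℤ.1ℤ) (Int.*-identityʳ (+ length X)))

    pole-start' : ∀ {b c F} → Trivial F → Fixed e b → Fixed e c → b ≢ 0# → b ≢ c → Pole c 0 (λ x → F x ⊕ term b c x)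
    pole-start' F-triv b-fix c-fix b≢0 b≢c = pole-start F-triv b-fix c-fix λ eq → decide (residue-≡0 (e⇒n b-fix) (e⇒n c-fix) eq)
      where
      decide : _ → ⊥
      decide (inj₁ b≡0) = b≢0 b≡0
      decide (inj₂ b≡c) = b≢c b≡c

    total-trivial : ∀ {cs} → All (Fixed e) cs → All Split cs → Unique cs → ∀ {F} → Trivial F →
      + (2 ^ length cs * length X) +ℤ ℤ.- (+ startCost (length cs)) ℤ.≤ total cs F
    total-trivial [] _ _ {F} F-triv = Int.≤-reflexive (trans (Int.+-identityʳ _)
      (trans (cong +_ (Nat.+-identityʳ (length X))) (sym (total-[]-trivial F-triv))))
    total-trivial {c ∷ cs} (c-fix ∷ cs-fix) (split ∷ splits) (c∉ ∷ u) {F} F-triv = begin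
        + (2 * 2 ^ l * length X) +ℤ ℤ.- (+ (2 * startCost l + m * poleCost l 0))
          ≡⟨ cong₂ _+ℤ_ (trans (cong +_ (Nat.*-assoc 2 (2 ^ l) (length X))) (Int.pos-* 2 (2 ^ l * length X)))
               (double-neg (startCost l) (m * poleCost l 0)) ⟩
        + 2 *ℤ + (2 ^ l * length X) +ℤ (ℤ.- (+ startCost l) +ℤ (ℤ.- (+ startCost l) +ℤ ℤ.- (+ (m * poleCost l 0))))
          ≡⟨ identity (+ (2 ^ l * length X)) (ℤ.- (+ startCost l)) _ ⟩
        A +ℤ (A +ℤ ℤ.- (+ (m * poleCost l 0)))
          ≤⟨ Int.+-mono-≤ (same (inj₁ refl)) (Int.+-monoˡ-≤ _ (same (inj₂ refl))) ⟩
        f 0# +ℤ (f c +ℤ ℤ.- (+ (m * poleCost l 0)))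
          ≤⟨ split-sum split f (poleCost l 0) (λ b-fix b≢0 b≢c → total-pole cs-fix splits c-fix
               (All.map (λ c≢x x≡c → c≢x (sym x≡c)) c∉) (pole-start' F-triv b-fix c-fix b≢0 b≢c)) ⟩
        ∑ F0 f
          ≡⟨ total-∷ c cs F ⟨
        total (c ∷ cs) F ∎
      where
      open Int.≤-Reasoning
      l : ℕ
      l = length cs
      A : ℤ
      A = + (2 ^ l * length X) +ℤ ℤ.- (+ startCost l)
      f : Carrier → ℤ
      f b = total cs (λ x → F x ⊕ term b c x)
      same : ∀ {b} → b ≡ 0# ⊎ b ≡ c → A ℤ.≤ f b
      same b≡ = total-trivial cs-fix splits u (trivial-⊕ F-triv (trivial-term b≡ c-fix))
      identity : ∀ x s r → + 2 *ℤ x +ℤ (s +ℤ (s +ℤ r)) ≡ x +ℤ s +ℤ (x +ℤ s +ℤ r)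
      identity = ℤ-ring

    -- Without a good element every `charSum` over X would vanish, so it is enough that the main
    -- term exceeds the costs. The point c = 0 is split off because there the coefficients 0 and c
    -- coincide: the other m + 1 all start a pole.
    good-element : length F0 ≡ suc (suc m) →
      startCost (suc m) + suc m * poleCost (suc m) 0 < 2 ^ suc m * length X →
      ∃ λ r → InX r × Good r
    good-element len bound = start (extract (Fix-unique e) (∈-Fix⁺ e (fixed-0 e)))
      where
      GoodOn : Carrier → Set
      GoodOn x = All (λ c → All (λ b → Tr n (term b c x) ≡ 0#) F0) F0

      goodOn? : Decidable GoodOn
      goodOn? x = All.all? (λ c → All.all? (λ b → Tr n (term b c x) ≟ 0#) F0) F0

      start : (∃ λ cs → F0 ↭ 0# ∷ cs × Unique (0# ∷ cs)) → ∃ λ r → InX r × Good r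
      start (cs , perm , unique@(0∉ ∷ cs-unique)) = search (Any.any? goodOn? X)
        where
        length-cs : length cs ≡ suc m
        length-cs = Nat.suc-injective (trans (sym (↭-length perm)) len)

        fixed-0∷cs : ∀ {c} → c ∈ 0# ∷ cs → Fixed e c
        fixed-0∷cs c∈ = ∈-Fix⁻ e (∈-resp-↭ (↭-sym perm) c∈)

        cs-fix : All (Fixed e) cs
        cs-fix = All.tabulate (λ c∈ → fixed-0∷cs (there c∈))

        splits : All Split cs
        splits = All.tabulate λ {c} c∈ → split c (extract cs-unique c∈)
          where
          split : ∀ c → (∃ λ rest → cs ↭ c ∷ rest × Unique (c ∷ rest)) → Split c
          split c (rest , perm' , u) = rest , ↭trans perm (↭prep 0# perm')
            , (All.tabulate (λ x∈ → All.lookup 0∉ (∈-resp-↭ (↭-sym perm') x∈)) ∷ u)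
            , Nat.suc-injective (trans (sym (↭-length perm')) length-cs)

        zero-trivial : Trivial (λ _ → 0#)
        zero-trivial _ = fixed-0 n , Tr-0 n

        f : Carrier → ℤ
        f b = total cs (λ x → 0# ⊕ term b 0# x)

        k : ℕ
        k = poleCost (suc m) 0

        total-lower : + (2 ^ suc m * length X) +ℤ ℤ.- (+ startCost (suc m)) +ℤ ℤ.- (+ (suc m * k)) ℤ.≤ total (0# ∷ cs) (λ _ → 0#)
        total-lower = begin
            + (2 ^ suc m * length X) +ℤ ℤ.- (+ startCost (suc m)) +ℤ ℤ.- (+ (suc m * k))
              ≡⟨ cong (λ l → + (2 ^ l * length X) +ℤ ℤ.- (+ startCost l) +ℤ ℤ.- (+ (l * k))) (sym length-cs) ⟩
            + (2 ^ length cs * length X) +ℤ ℤ.- (+ startCost (length cs)) +ℤ ℤ.- (+ (length cs * k))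
              ≤⟨ Int.+-mono-≤ (total-trivial cs-fix splits cs-unique (trivial-⊕ zero-trivial (trivial-term (inj₁ refl) (fixed-0 e))))
                   (∑-lower cs f k pole) ⟩
            ∑ (0# ∷ cs) f ≡⟨ ∑-↭ f perm ⟨
            ∑ F0 f ≡⟨ total-∷ 0# cs (λ _ → 0#) ⟨
            total (0# ∷ cs) (λ _ → 0#) ∎
          where
          open Int.≤-Reasoning
          pole : ∀ {b} → b ∈ cs → ℤ.- (+ k) ℤ.≤ f b
          pole {b} b∈ = subst (λ l → ℤ.- (+ poleCost l 0) ℤ.≤ f b) length-cs
            (total-pole cs-fix splits (fixed-0 e) (All.map (λ 0≢x x≡0 → 0≢x (sym x≡0)) 0∉)
              (pole-start' zero-trivial (fixed-0∷cs (there b∈)) (fixed-0 e) b≢0 b≢0))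
            where
            b≢0 : b ≢ 0#
            b≢0 b≡0 = All.lookup 0∉ b∈ (sym b≡0)

        total-positive : ℤ.0ℤ ℤ.< total (0# ∷ cs) (λ _ → 0#)
        total-positive = Int.<-≤-trans
          (subst (ℤ.0ℤ ℤ.<_) (rearrange (+ (2 ^ suc m * length X)) (+ startCost (suc m)) (+ (suc m * k)))
            (0<difference bound))
          total-lower
          where
          0<difference : ∀ {a b} → a < b → ℤ.0ℤ ℤ.< + b - + a
          0<difference {a} {b} a<b = subst (ℤ._< + b - + a) (Int.+-inverseʳ (+ a)) (Int.+-monoˡ-< (ℤ.- (+ a)) (ℤ.+<+ a<b))
          rearrange : ∀ x s p → x - (s +ℤ p) ≡ x +ℤ ℤ.- s +ℤ ℤ.- p
          rearrange = ℤ-ring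

        search : Dec (Any GoodOn X) → ∃ λ r → InX r × Good r
        search (yes found) with find found
        ... | r , r∈ , good = r , ∈-X⁻ r∈ , λ b-fix c-fix → All.lookup (All.lookup good (∈-Fix⁺ e c-fix)) (∈-Fix⁺ e b-fix)
        search (no none) = ⊥-elim (Int.<-irrefl (sym vanishes) total-positive)
          where
          vanishes : total (0# ∷ cs) (λ _ → 0#) ≡ ℤ.0ℤ
          vanishes = ∑-zero X λ {x} x∈ → bad x∈ (find (¬All⇒Any¬ (λ c → All.all? (λ b → Tr n (term b c x) ≟ 0#) F0) F0 (λ good → none (lose x∈ good))))
            where
            bad : ∀ {x} → x ∈ X → (∃ λ c → c ∈ F0 × ¬ All (λ b → Tr n (term b c x) ≡ 0#) F0) → charSum (0# ∷ cs) x 0# ≡ ℤ.0ℤ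
            bad {x} x∈ (c , c∈ , ¬all) with find (¬All⇒Any¬ (λ b → Tr n (term b c x) ≟ 0#) F0 ¬all)
            ... | b , b∈ , Tr≢0 = charSum-bad (fixed-0 e ∷ cs-fix) (proj₁ (∈-X⁻ x∈)) (∈-resp-↭ perm c∈) (∈-Fix⁻ e b∈) Tr≢0 (fixed-0 n)

-- Words, syndromes and distances.

unique-map-filter : ∀ {A B : Set} (g : A → B) {P : A → Set} (P? : Decidable P) {xs} →
  Unique (map g xs) → Unique (map g (filter P? xs))
unique-map-filter g P? {[]}     _ = []
unique-map-filter g P? {x ∷ xs} (x∉ ∷ u) with P? x
... | no _ = unique-map-filter g P? u
... | yes _ = All.tabulate fresh ∷ unique-map-filter g P? u
  where
  fresh : ∀ {y} → y ∈ map g (filter P? xs) → g x ≢ y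
  fresh y∈ with ∈-map⁻ g y∈
  ... | z , z∈ , refl = All.lookup x∉ (∈-map⁺ g (proj₁ (∈-filter⁻ P? {xs = xs} z∈)))

module _ {A B : Set} (f : A → Maybe B) (g : B → A) (section : ∀ {x y} → f x ≡ just y → g y ≡ x) where

  ∈-mapMaybe⁻ : ∀ xs {y} → y ∈ mapMaybe f xs → g y ∈ xs
  ∈-mapMaybe⁻ (x ∷ xs) y∈ with f x in eq
  ∈-mapMaybe⁻ (x ∷ xs) (here refl) | just y = here (section eq)
  ∈-mapMaybe⁻ (x ∷ xs) (there y∈)  | just _ = there (∈-mapMaybe⁻ xs y∈)
  ∈-mapMaybe⁻ (x ∷ xs) y∈          | nothing = there (∈-mapMaybe⁻ xs y∈)

  ∈-mapMaybe⁺ : ∀ {xs x y} → x ∈ xs → f x ≡ just y → y ∈ mapMaybe f xs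
  ∈-mapMaybe⁺ {x ∷ xs} (here refl) eq with f x
  ∈-mapMaybe⁺ {x ∷ xs} (here refl) refl | just y = here refl
  ∈-mapMaybe⁺ {z ∷ xs} (there x∈) eq with f z
  ... | just _ = there (∈-mapMaybe⁺ x∈ eq)
  ... | nothing = ∈-mapMaybe⁺ x∈ eq

  mapMaybe-unique : ∀ {xs} → Unique xs → Unique (map g (mapMaybe f xs))
  mapMaybe-unique [] = []
  mapMaybe-unique {x ∷ xs} (x∉ ∷ u) with f x in eq
  ... | nothing = mapMaybe-unique u
  ... | just y = All.tabulate fresh ∷ mapMaybe-unique u
    where
    fresh : ∀ {z} → z ∈ map g (mapMaybe f xs) → g y ≢ z
    fresh z∈ gy≡z with ∈-map⁻ g z∈
    ... | w , w∈ , refl = All.lookup x∉ (∈-mapMaybe⁻ xs w∈) (trans (sym (section eq)) gy≡z)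

module Covering (K : FiniteField) (char2 : HasChar2 K)
  (n : ℕ) (n>0 : 0 < n) (size≡ : FiniteField.size K ≡ 2 ^ (n + n))
  (e : ℕ) (n' : ℕ) (n≡ : n ≡ n' * e) (q0 q : ℕ) (q0≡ : q0 ≡ 2 ^ e) (q≡ : q ≡ 2 ^ n) where
  open Existence K char2 n n>0 size≡ e n' n≡ public
  module C = Code K q0 q

  code-pow : ∀ x k → C.pow x k ≡ pow x k
  code-pow x zero = refl
  code-pow x (suc k) = cong (x ·_) (code-pow x k)

  pow-q0 : ∀ x → C.pow x q0 ≡ fr e x
  pow-q0 x = trans (code-pow x q0) (trans (cong (pow x) q0≡) (pow-2^ e x))

  pow-q+1 : ∀ x → C.pow x (suc q) ≡ x · fr n x
  pow-q+1 x = cong (x ·_) (trans (code-pow x q) (trans (cong (pow x) q≡) (pow-2^ n x)))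

  scalar-fixed : (a : C.Fq0) → Fixed e (proj₁ a)
  scalar-fixed (a , p) = trans (sym (pow-q0 a)) p

  circle : (h : C.H) → OnCircle (proj₁ h)
  circle (x , p) = trans (sym (pow-q+1 x)) p

  private
    -- Recovers by unification the selector hidden in the definition of Hlist.
    selector : ∃ λ f → mapMaybe f C.elements ≡ C.Hlist
    selector = _ , refl

    select : Carrier → Maybe C.H
    select = proj₁ selector

    select-section : ∀ {x h} → select x ≡ just h → proj₁ h ≡ x
    select-section {x} eq with C.pow x (suc q) ≟ 1#
    select-section {x} refl | yes p = refl

    select-just : ∀ (h : C.H) → select (proj₁ h) ≡ just h
    select-just (x , p) with C.pow x (suc q) ≟ 1#
    ... | yes p' = cong (λ p → just (x , p)) (≡-irrelevant p' p)
    ... | no ¬p = ⊥-elim (¬p p)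

  ∈-Hlist : ∀ h → h ∈ C.Hlist
  ∈-Hlist h = ∈-mapMaybe⁺ select proj₁ select-section (∈-elements (proj₁ h)) (select-just h)

  Hlist-unique : Unique (map proj₁ C.Hlist)
  Hlist-unique = mapMaybe-unique select proj₁ select-section elements-unique

  syndrome : C.Word → Carrier
  syndrome c = sumK (map (λ h → proj₁ (c h) · proj₁ h) C.Hlist)

  0-word : C.Word
  0-word _ = 0# , trans (pow-q0 0#) (fr-0 e)

  suc-scalar : C.Fq0 → C.Fq0
  suc-scalar a = proj₁ a ⊕ 1# , trans (pow-q0 _) (fixed-⊕ e (scalar-fixed a) (fixed-1 e))

  -- All coefficients in `three-sum` are 1, so adding 1 at the listed coordinates corrects a
  -- syndrome; an element listed twice is bumped twice and cancels, as it does in the sum.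
  bump : Carrier → C.Word → C.Word
  bump x v h with proj₁ h ≟ x
  ... | yes _ = suc-scalar (v h)
  ... | no  _ = v h

  δ : Carrier → Carrier → Carrier
  δ x y with y ≟ x
  ... | yes _ = x
  ... | no  _ = 0#

  bump-· : ∀ x v h → proj₁ (bump x v h) · proj₁ h ≡ proj₁ (v h) · proj₁ h ⊕ δ x (proj₁ h)
  bump-· x v h with proj₁ h ≟ x
  ... | yes refl = solve 2 (λ a x → (a :+ con true) :* x := a :* x :+ x) refl _ _
  ... | no _ = sym (+-identityʳ _)

  bump-≢ : ∀ x v h → proj₁ h ≢ x → proj₁ (bump x v h) ≡ proj₁ (v h)
  bump-≢ x v h h≢x with proj₁ h ≟ x
  ... | yes h≡x = ⊥-elim (h≢x h≡x)
  ... | no _ = refl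

  sum-δ-∉ : ∀ x (hs : List C.H) → ¬ x ∈ map proj₁ hs → sumK (map (λ h → δ x (proj₁ h)) hs) ≡ 0#
  sum-δ-∉ x []       _ = refl
  sum-δ-∉ x (h ∷ hs) x∉ with proj₁ h ≟ x
  ... | yes refl = ⊥-elim (x∉ (here refl))
  ... | no _ = trans (+-identityˡ _) (sum-δ-∉ x hs (λ p → x∉ (there p)))

  sum-δ : ∀ x (hs : List C.H) → Unique (map proj₁ hs) → x ∈ map proj₁ hs → sumK (map (λ h → δ x (proj₁ h)) hs) ≡ x
  sum-δ x (h ∷ hs) (h∉ ∷ u) x∈ with proj₁ h ≟ x | x∈
  ... | yes refl | _ = trans (cong (x ⊕_) (sum-δ-∉ x hs (λ p → All.lookup h∉ p refl))) (+-identityʳ x)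
  ... | no h≢x   | here eq = ⊥-elim (h≢x (sym eq))
  ... | no _     | there p = trans (+-identityˡ _) (sum-δ x hs u p)

  sumK-⊕ : ∀ {A : Set} (f g : A → Carrier) hs →
    sumK (map (λ h → f h ⊕ g h) hs) ≡ sumK (map f hs) ⊕ sumK (map g hs)
  sumK-⊕ f g [] = sym (+-identityˡ 0#)
  sumK-⊕ f g (h ∷ hs) = trans (cong (f h ⊕ g h ⊕_) (sumK-⊕ f g hs))
    (solve 4 (λ a b c d → a :+ b :+ (c :+ d) := (a :+ c) :+ (b :+ d)) refl (f h) (g h) _ _)

  sumK-cong : ∀ {A : Set} {f g : A → Carrier} → (∀ h → f h ≡ g h) → ∀ hs → sumK (map f hs) ≡ sumK (map g hs)
  sumK-cong eq hs = cong sumK (map-cong eq hs)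

  syndrome-bump : ∀ {x} v → OnCircle x → syndrome (bump x v) ≡ syndrome v ⊕ x
  syndrome-bump {x} v x-circle = trans (sumK-cong (bump-· x v) C.Hlist)
    (trans (sumK-⊕ (λ h → proj₁ (v h) · proj₁ h) (λ h → δ x (proj₁ h)) C.Hlist)
      (cong (syndrome v ⊕_) (sum-δ x C.Hlist Hlist-unique
        (∈-map⁺ proj₁ (∈-Hlist (x , trans (pow-q+1 x) x-circle))))))

  bumps : List Carrier → C.Word → C.Word
  bumps L v = foldr bump v L

  syndrome-bumps : ∀ {L} v → All OnCircle L → syndrome (bumps L v) ≡ syndrome v ⊕ sumK L
  syndrome-bumps v [] = sym (+-identityʳ _)
  syndrome-bumps {x ∷ L} v (x-circle ∷ L-circle) = trans (syndrome-bump (bumps L v) x-circle)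
    (trans (cong (_⊕ x) (syndrome-bumps v L-circle))
      (solve 3 (λ a b x → a :+ b :+ x := a :+ (x :+ b)) refl (syndrome v) (sumK L) x))

  bumps-∉ : ∀ L v h → ¬ proj₁ h ∈ L → proj₁ (bumps L v h) ≡ proj₁ (v h)
  bumps-∉ []      v h _ = refl
  bumps-∉ (x ∷ L) v h h∉ = trans (bump-≢ x (bumps L v) h (λ eq → h∉ (here eq))) (bumps-∉ L v h (λ p → h∉ (there p)))

  dist-bumps : ∀ L v → C.dist v (bumps L v) ≤ length L
  dist-bumps L v = subst (_≤ length L) (length-map proj₁ changed)
    (unique-⊆⇒length≤ (unique-map-filter proj₁ changed? Hlist-unique) within)
    where
    changed? : Decidable (λ h → proj₁ (v h) ≢ proj₁ (bumps L v h))
    changed? h = ¬? (proj₁ (v h) ≟ proj₁ (bumps L v h))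
    changed : List C.H
    changed = filter changed? C.Hlist
    within : ∀ {x} → x ∈ map proj₁ changed → x ∈ L
    within x∈ with ∈-map⁻ proj₁ x∈
    ... | h , h∈ , refl with proj₁ h ∈? L
    ...   | yes h∈L = h∈L
    ...   | no h∉L = ⊥-elim (proj₂ (∈-filter⁻ changed? {xs = C.Hlist} h∈) (sym (bumps-∉ L v h h∉L)))

  covered : ∀ v → ∃ λ c → C.InCode c × C.dist v c ≤ 3
  covered v = correct (three-sum (syndrome v))
    where
    correct : ThreeSum (syndrome v) → ∃ λ c → C.InCode c × C.dist v c ≤ 3
    correct (L , L-circle , len , sum≡) = bumps L v
      , trans (syndrome-bumps v L-circle) (≡⇒⊕-≡0 (sym sum≡))
      , ≤-trans (dist-bumps L v) len

  -- Goodness with coefficient a at the point a + b contradicts `two-term⇒trace`; r + a + b is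
  -- nonzero because r lies outside 𝔽_{q0}.
  two-term-bad : ∀ {r a b x y} → InX r → Good r → Fixed e a → Fixed e b → OnCircle x → OnCircle y → r ≢ a · x ⊕ b · y
  two-term-bad {r} {a} {b} (r-fix , r∉) good a-fix b-fix x-circle y-circle r≡ =
    two-term⇒trace r-fix (e⇒n a-fix) (e⇒n b-fix) x-circle y-circle r≡
      (λ eq → r∉ (subst (Fixed e) (sym (⊕-≡0⇒≡ eq)) (fixed-⊕ e a-fix b-fix)))
      (good a-fix (fixed-⊕ e a-fix b-fix))

  sum-filter : ∀ (v c : C.Word) hs →
    sumK (map (λ h → (proj₁ (v h) ⊕ proj₁ (c h)) · proj₁ h) hs) ≡
    sumK (map (λ h → (proj₁ (v h) ⊕ proj₁ (c h)) · proj₁ h) (filter (λ h → ¬? (proj₁ (v h) ≟ proj₁ (c h))) hs))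
  sum-filter v c [] = refl
  sum-filter v c (h ∷ hs) with proj₁ (v h) ≟ proj₁ (c h)
  ... | yes eq = trans (cong₂ _⊕_ (trans (cong (_· proj₁ h) (≡⇒⊕-≡0 eq)) (zeroˡ _)) (sum-filter v c hs)) (+-identityˡ _)
  ... | no _ = cong (_ ⊕_) (sum-filter v c hs)

  -- Coordinates where v and c agree contribute nothing, so r is a combination of the circle
  -- elements where they differ. One or two of them, padded with coefficient 0, contradict
  -- `two-term-bad`; none would give r = 0 ∈ 𝔽_{q0}.
  far : ∀ {r} → InX r → Good r → ∀ v → syndrome v ≡ r → ∀ c → C.InCode c → 3 ≤ C.dist v c
  far {r} r∈ good v syn≡ c c∈ = weight (filter (λ h → ¬? (proj₁ (v h) ≟ proj₁ (c h))) C.Hlist)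
      (trans (sym (sum-filter v c C.Hlist)) (trans (sumK-cong (λ h → distribʳ (proj₁ h) _ _) C.Hlist)
        (trans (sumK-⊕ (λ h → proj₁ (v h) · proj₁ h) (λ h → proj₁ (c h) · proj₁ h) C.Hlist)
          (trans (cong₂ _⊕_ syn≡ c∈) (+-identityʳ r)))))
    where
    d : C.H → Carrier
    d h = proj₁ (v h) ⊕ proj₁ (c h)
    d-fix : ∀ h → Fixed e (d h)
    d-fix h = fixed-⊕ e (scalar-fixed (v h)) (scalar-fixed (c h))
    weight : ∀ hs → sumK (map (λ h → d h · proj₁ h) hs) ≡ r → 3 ≤ length hs
    weight [] eq = ⊥-elim (proj₂ r∈ (subst (Fixed e) eq (fixed-0 e)))
    weight (h ∷ []) eq = ⊥-elim (two-term-bad r∈ good (d-fix h) (fixed-0 e) (circle h) circle-1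
      (trans (sym eq) (cong (d h · proj₁ h ⊕_) (sym (zeroˡ 1#)))))
    weight (h ∷ h' ∷ []) eq = ⊥-elim (two-term-bad r∈ good (d-fix h) (d-fix h') (circle h) (circle h')
      (trans (sym eq) (cong (d h · proj₁ h ⊕_) (+-identityʳ _))))
    weight (_ ∷ _ ∷ _ ∷ _) _ = s≤s (s≤s (s≤s z≤n))

  syndrome-0-word : syndrome 0-word ≡ 0#
  syndrome-0-word = zeros C.Hlist
    where
    zeros : ∀ (hs : List C.H) → sumK (map (λ h → 0# · proj₁ h) hs) ≡ 0#
    zeros [] = refl
    zeros (h ∷ hs) = trans (cong₂ _⊕_ (zeroˡ _) (zeros hs)) (+-identityˡ 0#)

  covering-radius-3 : (∃ λ r → InX r × Good r) → C.CoveringRadius 3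
  covering-radius-3 (r , r∈ , good) = covered , reach (three-sum r)
    where
    reach : ThreeSum r → ∃ λ v → ∀ c → C.InCode c → 3 ≤ C.dist v c
    reach (L , L-circle , _ , sum≡) = bumps L 0-word , far r∈ good (bumps L 0-word)
      (trans (syndrome-bumps 0-word L-circle) (trans (cong (_⊕ sumK L) syndrome-0-word) (trans (+-identityˡ _) sum≡)))

-- The numerical condition: costs against the hypothesis.

*-^ : ∀ a b k → (a * b) ^ k ≡ a ^ k * b ^ k
*-^ a b zero = refl
*-^ a b (suc k) = trans (cong (a * b *_) (*-^ a b k)) (interchange a b (a ^ k) (b ^ k))
  where
  interchange : ∀ a b c d → a * b * (c * d) ≡ a * c * (b * d)
  interchange = ℕ-ring

-- Applied to q0, which is given only as an even number: it divides the order of K, and that order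
-- is a power of 2.
divides-2^⇒power : ∀ N {d} → d ∣ 2 ^ N → ∃ λ e → d ≡ 2 ^ e
divides-2^⇒power zero    {d} d∣1 = 0 , ∣1⇒≡1 d∣1
divides-2^⇒power (suc N) {d} (divides c eq) with euclidsLemma c d (toWitness {a? = prime? 2} tt) (divides (2 ^ N) (trans (sym eq) (Nat.*-comm 2 (2 ^ N))))
... | inj₁ (divides c' refl) = divides-2^⇒power N (divides c' (Nat.*-cancelʳ-≡ (2 ^ N) (c' * d) 2 (begin
    2 ^ N * 2 ≡⟨ Nat.*-comm (2 ^ N) 2 ⟩
    2 * 2 ^ N ≡⟨ eq ⟩
    c' * 2 * d ≡⟨ identity c' d ⟩
    c' * d * 2 ∎)))
  where
  open ≡-Reasoning
  identity : ∀ c d → c * 2 * d ≡ c * d * 2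
  identity = ℕ-ring
... | inj₂ (divides d' refl) with divides-2^⇒power N {d'} (divides c (Nat.*-cancelʳ-≡ (2 ^ N) (c * d') 2 (begin
    2 ^ N * 2 ≡⟨ Nat.*-comm (2 ^ N) 2 ⟩
    2 * 2 ^ N ≡⟨ eq ⟩
    c * (d' * 2) ≡⟨ Nat.*-assoc c d' 2 ⟨
    c * d' * 2 ∎)))
  where open ≡-Reasoning
...   | e , refl = suc e , Nat.*-comm (2 ^ e) 2

-- The most even splitting q = Q'Q''. Both exponents are positive because Stepanov's bound is stated
-- with Q'/2 and Q''/2.
halves : ∀ n → ∃ λ a → ∃ λ b → suc (suc n) ≡ suc a + suc b × a ≤ b × b ≤ suc a
halves zero = 0 , 0 , refl , z≤n , z≤n
halves (suc zero) = 0 , 1 , refl , z≤n , s≤s z≤n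
halves (suc (suc n)) with halves n
... | a , b , eq , a≤b , b≤a = suc a , suc b , cong suc (trans (cong suc eq) (sym (cong suc (Nat.+-suc a (suc b))))) , s≤s a≤b , s≤s b≤a

-- The error of one sum with g + 1 poles. Twice Stepanov's bound is P + q + 2gR, and q ≤ x + q0.
-- Where (g + 1)² ≥ P the method does not apply and the trivial error x stands in.
leafCost : (P R q0 x : ℕ) → ℕ → ℕ
leafCost P R q0 x g with suc g * suc g Nat.<? P
... | yes _ = P + q0 + 2 * (g * R)
... | no  _ = x

leafCost-large : ∀ {P R q0 x} g → suc g * suc g < P → leafCost P R q0 x g ≡ P + q0 + 2 * (g * R)
leafCost-large {P} g lt with suc g * suc g Nat.<? P
... | yes _ = refl
... | no ¬lt = ⊥-elim (¬lt lt)

module _ {m C : ℕ} {cost : ℕ → ℕ} where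
  open Costs m cost

  private
    geometric : ∀ m y C → 2 * (y * C) + m * (y * C) ≡ (2 + m) * y * C
    geometric = ℕ-ring

  -- There are (2 + m)^l families of remaining coefficients, each costing at most C, since the
  -- number of poles grows by at most l.
  poleCost≤ : ∀ l g G → g + l ≤ G → (∀ {g} → g ≤ G → cost g ≤ C) → poleCost l g ≤ (2 + m) ^ l * C
  poleCost≤ zero    g G le cost≤ = ≤-trans (cost≤ (≤-trans (m≤m+n g 0) le)) (≤-reflexive (sym (Nat.*-identityˡ C)))
  poleCost≤ (suc l) g G le cost≤ = begin
      2 * poleCost l g + m * poleCost l (suc g)
    ≤⟨ +-mono-≤
         (*-monoʳ-≤ 2 (poleCost≤ l g G (≤-trans (+-monoʳ-≤ g (n≤1+n l)) le) cost≤))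
         (*-monoʳ-≤ m (poleCost≤ l (suc g) G (≤-trans (≤-reflexive (sym (Nat.+-suc g l))) le) cost≤)) ⟩
      2 * ((2 + m) ^ l * C) + m * ((2 + m) ^ l * C)
    ≡⟨ geometric m ((2 + m) ^ l) C ⟩
      (2 + m) ^ suc l * C ∎
    where open Nat.≤-Reasoning

  -- The term 2^l C on the left is what the 2^l families without a pole save.
  startCost≤ : ∀ l G → l ≤ G → (∀ {g} → g ≤ G → cost g ≤ C) → startCost l + 2 ^ l * C ≤ (2 + m) ^ l * C
  startCost≤ zero    G le cost≤ = ≤-refl
  startCost≤ (suc l) G le cost≤ = begin
      2 * startCost l + m * poleCost l 0 + 2 * 2 ^ l * C
    ≡⟨ identity1 (startCost l) (m * poleCost l 0) (2 ^ l) C ⟩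
      2 * (startCost l + 2 ^ l * C) + m * poleCost l 0
    ≤⟨ +-mono-≤ (*-monoʳ-≤ 2 (startCost≤ l G l≤G cost≤)) (*-monoʳ-≤ m (poleCost≤ l 0 G l≤G cost≤)) ⟩
      2 * ((2 + m) ^ l * C) + m * ((2 + m) ^ l * C)
    ≡⟨ geometric m ((2 + m) ^ l) C ⟩
      (2 + m) ^ suc l * C ∎
    where
    open Nat.≤-Reasoning
    l≤G : l ≤ G
    l≤G = ≤-trans (n≤1+n l) le
    identity1 : ∀ s p y C → 2 * s + p + 2 * y * C ≡ 2 * (s + y * C) + p
    identity1 = ℕ-ring

-- x stands for the number of elements of 𝔽_q ∖ 𝔽_{q0}, and q0 = m + 2.
Sufficient : (P R m x : ℕ) → Set
Sufficient P R m x = startCost (suc m) + suc m * poleCost (suc m) 0 < 2 ^ suc m * x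
  where open Costs m (leafCost P R (2 + m) x)

-- For q0 = 2 both coefficients at c = 1 are trivial, so only b_0 can create a pole and g = 0
-- throughout.
sufficient-2 : ∀ {P R x} → 2 ≤ P → 4 ≤ R → P * R ≤ x + 2 → Sufficient P R 0 x
sufficient-2 {P} {R} {x} 2≤P 4≤R q≤ = subst (λ c → 0 + 1 * (2 * c + 0) < 2 * 1 * x) (sym (leafCost-large {P} {R} {2} {x} 0 2≤P))
  (begin-strict
    0 + 1 * (2 * (P + 2 + 2 * (0 * R)) + 0) ≡⟨ identity P ⟩
    2 * (P + 2) <⟨ Nat.*-monoʳ-< 2 small ⟩
    2 * x ∎)
  where
  open Nat.≤-Reasoning
  identity : ∀ P → 0 + 1 * (2 * (P + 2 + 2 * 0) + 0) ≡ 2 * (P + 2)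
  identity = ℕ-ring
  small : P + 2 < x
  small = +-cancelʳ-≤ 2 _ _ (begin
    suc (P + 2) + 2 ≡⟨ identity3 P ⟩
    P + 5 ≤⟨ +-monoʳ-≤ P (≤-trans (n≤1+n 5) (*-monoˡ-≤ 3 2≤P)) ⟩
    P + P * 3 ≡⟨ identity4 P ⟩
    P * 4 ≤⟨ *-monoʳ-≤ P 4≤R ⟩
    P * R ≤⟨ q≤ ⟩
    x + 2 ∎)
    where
    identity3 : ∀ P → suc (P + 2) + 2 ≡ P + 5
    identity3 = ℕ-ring
    identity4 : ∀ P → P + P * 3 ≡ P * 4
    identity4 = ℕ-ring

-- Of the 4⁴ families, 8 have no pole and 48, 96, 80, 24 have 1, 2, 3, 4 poles. Divided by 8, the
-- cost is 31P + 82R + 124; the remaining 15R out of 128R ≤ PR absorbs the constants.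
sufficient-4 : ∀ {P R x} → 128 ≤ P → P ≤ R → P * R ≤ x + 4 → Sufficient P R 2 x
sufficient-4 {P} {R} {x} 128≤P P≤R q≤ = begin-strict
    Costs.startCost 2 c 3 + 3 * Costs.poleCost 2 c 3 0
      ≡⟨ unfolded (c 0) (c 1) (c 2) (c 3) ⟩
    48 * c 0 + 96 * c 1 + 80 * c 2 + 24 * c 3
      ≡⟨ cong₂ _+_ (cong₂ _+_ (cong₂ (λ u v → 48 * u + 96 * v)
           (leaf 0 (s≤s (s≤s z≤n))) (leaf 1 (toWitness {a? = 5 Nat.≤? 128} tt)))
           (cong (80 *_) (leaf 2 (toWitness {a? = 10 Nat.≤? 128} tt)))) (cong (24 *_) (leaf 3 (toWitness {a? = 17 Nat.≤? 128} tt))) ⟩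
    48 * (P + 4 + 2 * (0 * R)) + 96 * (P + 4 + 2 * (1 * R)) + 80 * (P + 4 + 2 * (2 * R)) + 24 * (P + 4 + 2 * (3 * R))
      ≡⟨ collect P R ⟩
    8 * (31 * P + 82 * R + 124)
      <⟨ Nat.*-monoʳ-< 8 small ⟩
    8 * x ∎
  where
  open Nat.≤-Reasoning
  c : ℕ → ℕ
  c = leafCost P R 4 x
  leaf : ∀ g → suc g * suc g < 128 → c g ≡ P + 4 + 2 * (g * R)
  leaf g lt = leafCost-large {P} {R} {4} {x} g (Nat.<-≤-trans lt 128≤P)
  unfolded : ∀ c0 c1 c2 c3 →
    2 * (2 * (2 * 0 + 2 * c0) + 2 * (2 * c0 + 2 * c1)) + 2 * (2 * (2 * c0 + 2 * c1) + 2 * (2 * c1 + 2 * c2)) +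
    3 * (2 * (2 * (2 * c0 + 2 * c1) + 2 * (2 * c1 + 2 * c2)) + 2 * (2 * (2 * c1 + 2 * c2) + 2 * (2 * c2 + 2 * c3)))
    ≡ 48 * c0 + 96 * c1 + 80 * c2 + 24 * c3
  unfolded = ℕ-ring
  collect : ∀ P R → 48 * (P + 4 + 2 * (0 * R)) + 96 * (P + 4 + 2 * (1 * R)) + 80 * (P + 4 + 2 * (2 * R)) + 24 * (P + 4 + 2 * (3 * R))
    ≡ 8 * (31 * P + 82 * R + 124)
  collect = ℕ-ring
  small : 31 * P + 82 * R + 124 < x
  small = +-cancelʳ-≤ 4 _ _ (begin
    suc (31 * P + 82 * R + 124) + 4 ≡⟨ identity1 P R ⟩
    31 * P + (82 * R + 129) ≤⟨ +-mono-≤ (*-monoʳ-≤ 31 P≤R) (+-monoʳ-≤ (82 * R)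
                                            (≤-trans (toWitness {a? = 129 Nat.≤? 15 * 128} tt) (*-monoʳ-≤ 15 (≤-trans 128≤P P≤R)))) ⟩
    31 * R + (82 * R + 15 * R) ≡⟨ identity2 R ⟩
    128 * R ≤⟨ *-monoˡ-≤ R 128≤P ⟩
    P * R ≤⟨ q≤ ⟩
    x + 4 ∎)
    where
    identity1 : ∀ P R → suc (31 * P + 82 * R + 124) + 4 ≡ 31 * P + (82 * R + 129)
    identity1 = ℕ-ring
    identity2 : ∀ R → 31 * R + (82 * R + 15 * R) ≡ 128 * R
    identity2 = ℕ-ring

-- Every family is charged the cost C < 2 q0 R of the largest g = q0 - 1. Division by 2^{q0-1} turns
-- q0^{q0-1} into A = (q0/2)^{q0-1}, which leaves 2 q0² A R ≤ PR. The saving 2^{q0-1} C on families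
-- without poles makes the inequality strict.
sufficient-large : ∀ {P R m x h A} → 2 + m ≡ 2 * h → A ≡ h ^ suc m → 0 < h →
  2 * ((2 + m) * (2 + m)) * A ≤ P → P ≤ R → P * R ≤ x + (2 + m) → Sufficient P R m x
sufficient-large {P} {R} {m} {x} {h} {A} q0≡ A≡ h>0 large P≤R q≤ = Nat.+-cancelʳ-< (2 ^ suc m * C) _ _ (begin-strict
    startCost (suc m) + suc m * poleCost (suc m) 0 + 2 ^ suc m * C
      ≡⟨ identity1 (startCost (suc m)) (suc m * poleCost (suc m) 0) (2 ^ suc m * C) ⟩
    startCost (suc m) + 2 ^ suc m * C + suc m * poleCost (suc m) 0
      ≤⟨ +-mono-≤ (startCost≤ (suc m) (suc m) ≤-refl cost≤)
           (*-monoʳ-≤ (suc m) (poleCost≤ (suc m) 0 (suc m) ≤-refl cost≤)) ⟩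
    q0 ^ suc m * C + suc m * (q0 ^ suc m * C)
      ≡⟨ identity2 m (q0 ^ suc m) C ⟩
    q0 ^ suc m * (q0 * C)
      ≡⟨ cong (_* (q0 * C)) (trans (cong (_^ suc m) q0≡) (trans (*-^ 2 h (suc m)) (cong (2 ^ suc m *_) (sym A≡)))) ⟩
    2 ^ suc m * A * (q0 * C)
      ≡⟨ identity3 (2 ^ suc m) A (q0 * C) ⟩
    2 ^ suc m * (q0 * C * A)
      ≤⟨ *-monoʳ-≤ (2 ^ suc m) main ⟩
    2 ^ suc m * x
      <⟨ m<m+n (2 ^ suc m * x) (*-mono-≤ (m^n>0 2 (suc m)) C>0) ⟩
    2 ^ suc m * x + 2 ^ suc m * C ∎)
  where
  open Nat.≤-Reasoning
  q0 C : ℕ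
  q0 = 2 + m
  C = P + q0 + 2 * (suc m * R)
  open Costs m (leafCost P R q0 x)
  A>0 : 0 < A
  A>0 = subst (0 <_) (sym A≡) (m^n>0 h {{ℕ.>-nonZero h>0}} (suc m))
  q0²<P : q0 * q0 < P
  q0²<P = begin-strict
    q0 * q0 <⟨ m<m+n (q0 * q0) (s≤s z≤n) ⟩
    q0 * q0 + q0 * q0 ≡⟨ identity q0 ⟩
    2 * (q0 * q0) * 1 ≤⟨ *-monoʳ-≤ (2 * (q0 * q0)) A>0 ⟩
    2 * (q0 * q0) * A ≤⟨ large ⟩
    P ∎
    where
    identity : ∀ q → q * q + q * q ≡ 2 * (q * q) * 1
    identity = ℕ-ring
  C>0 : 0 < C
  C>0 = ≤-trans (≤-trans (s≤s z≤n) q0²<P) (≤-trans (m≤m+n P q0) (m≤m+n (P + q0) _))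
  cost≤ : ∀ {g} → g ≤ suc m → leafCost P R q0 x g ≤ C
  cost≤ {g} g≤ = ≤-trans (≤-reflexive (leafCost-large {P} {R} {q0} {x} g
      (Nat.≤-<-trans (*-mono-≤ (s≤s g≤) (s≤s g≤)) q0²<P)))
    (+-monoʳ-≤ (P + q0) (*-monoʳ-≤ 2 (*-monoˡ-≤ R g≤)))
  C<2q0R : C + 1 ≤ 2 * (q0 * R)
  C<2q0R = begin
    P + q0 + 2 * (suc m * R) + 1 ≡⟨ identity m P R ⟩
    P + suc q0 + 2 * (suc m * R) ≤⟨ +-monoˡ-≤ _ (+-mono-≤ P≤R (≤-trans (s≤s (Nat.m≤m*n q0 q0)) (≤-trans q0²<P P≤R))) ⟩
    R + R + 2 * (suc m * R) ≡⟨ identity' m R ⟩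
    2 * (q0 * R) ∎
    where
    identity : ∀ m P R → P + (2 + m) + 2 * (suc m * R) + 1 ≡ P + suc (2 + m) + 2 * (suc m * R)
    identity = ℕ-ring
    identity' : ∀ m R → R + R + 2 * (suc m * R) ≡ 2 * ((2 + m) * R)
    identity' = ℕ-ring
  main : q0 * C * A ≤ x
  main = +-cancelʳ-≤ q0 _ _ (begin
    q0 * C * A + q0 ≤⟨ +-monoʳ-≤ (q0 * C * A) (Nat.m≤m*n q0 A {{ℕ.>-nonZero A>0}}) ⟩
    q0 * C * A + q0 * A ≡⟨ identity q0 C A ⟩
    q0 * (C + 1) * A ≤⟨ *-monoˡ-≤ A (*-monoʳ-≤ q0 C<2q0R) ⟩
    q0 * (2 * (q0 * R)) * A ≡⟨ identity' q0 R A ⟩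
    2 * (q0 * q0) * A * R ≤⟨ *-monoˡ-≤ R large ⟩
    P * R ≤⟨ q≤ ⟩
    x + q0 ∎)
    where
    identity : ∀ q C A → q * C * A + q * A ≡ q * (C + 1) * A
    identity = ℕ-ring
    identity' : ∀ q R A → q * (2 * (q * R)) * A ≡ 2 * (q * q) * A * R
    identity' = ℕ-ring
  identity1 : ∀ s p y → s + p + y ≡ s + y + p
  identity1 = ℕ-ring
  identity2 : ∀ m y C → y * C + suc m * (y * C) ≡ y * ((2 + m) * C)
  identity2 = ℕ-ring
  identity3 : ∀ y A c → y * A * c ≡ y * (c * A)
  identity3 = ℕ-ring

module _ {q0 A T q W V : ℕ} (q≡ : q ≡ q0 * (T * T)) (W≡ : W + 7 * q0 ≡ 2 * q0 ^ 2 + 3) (V≡ : V + 2 ≡ 4 * q0)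
  (q0²≤ : q0 ^ 2 ≤ A * V) (W>0 : 0 < W) (A>0 : 0 < A) (T>0 : 0 < T) where

  private
    B : ℕ
    B = T * A * W

    b≡ : (+ T *ℤ + A) *ℤ ((+ (2 * q0 ^ 2) - + (7 * q0)) +ℤ + 3) ≡ + B
    b≡ = begin
      (+ T *ℤ + A) *ℤ ((+ (2 * q0 ^ 2) - + (7 * q0)) +ℤ + 3)
        ≡⟨ cong ((+ T *ℤ + A) *ℤ_) (trans (move (+ (2 * q0 ^ 2)) (+ (7 * q0)))
             (trans (cong (λ u → u - + (7 * q0)) (trans (sym (Int.pos-+ (2 * q0 ^ 2) 3)) (trans (cong +_ (sym W≡)) (Int.pos-+ W (7 * q0)))))
               (cancel (+ W) (+ (7 * q0))))) ⟩
      (+ T *ℤ + A) *ℤ + W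
        ≡⟨ trans (cong (_*ℤ + W) (sym (Int.pos-* T A))) (sym (Int.pos-* (T * A) W)) ⟩
      + B ∎
      where
      open ≡-Reasoning
      move : ∀ x y → (x - y) +ℤ + 3 ≡ (x +ℤ + 3) - y
      move = ℤ-ring
      cancel : ∀ x y → (x +ℤ y) - y ≡ x
      cancel = ℤ-ring

    a : ℤ
    a = (+ q - + A *ℤ (+ (4 * q0) - + 2)) +ℤ + (q0 ^ 2)

    a≤q : a ℤ.≤ + q
    a≤q = begin
      (+ q - + A *ℤ (+ (4 * q0) - + 2)) +ℤ + (q0 ^ 2)
        ≡⟨ cong (λ u → (+ q - + A *ℤ u) +ℤ + (q0 ^ 2)) (trans (cong (λ u → u - + 2) (trans (cong +_ (sym V≡)) (Int.pos-+ V 2))) (cancel (+ V))) ⟩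
      (+ q - + A *ℤ + V) +ℤ + (q0 ^ 2)
        ≤⟨ Int.+-monoʳ-≤ (+ q - + A *ℤ + V) (ℤ.+≤+ q0²≤) ⟩
      (+ q - + A *ℤ + V) +ℤ + (A * V)
        ≡⟨ cong ((+ q - + A *ℤ + V) +ℤ_) (Int.pos-* A V) ⟩
      (+ q - + A *ℤ + V) +ℤ + A *ℤ + V
        ≡⟨ cancel' (+ q) (+ A *ℤ + V) ⟩
      + q ∎
      where
      open Int.≤-Reasoning
      cancel : ∀ x → (x +ℤ + 2) - + 2 ≡ x
      cancel = ℤ-ring
      cancel' : ∀ x y → (x - y) +ℤ y ≡ x
      cancel' = ℤ-ring

    conclude : ∀ a → a ℤ.≤ + q → sqrtMulLt q0 (+ B) a → (A * W) * (A * W) < q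
    conclude a a≤q (_ , inj₁ (ℤ.+≤+ B≤0)) = ⊥-elim (<⇒≱ (*-mono-≤ (*-mono-≤ T>0 A>0) W>0) B≤0)
    conclude a a≤q (inj₂ lt , inj₂ gt) = ⊥-elim (Int.<-asym lt gt)
    conclude (+ a) (ℤ.+≤+ a≤q) (inj₁ _ , inj₂ gt) = Nat.*-cancelˡ-< q _ _ (begin-strict
      q * (A * W * (A * W)) ≡⟨ cong (_* (A * W * (A * W))) q≡ ⟩
      q0 * (T * T) * (A * W * (A * W)) ≡⟨ rearrange q0 T A W ⟩
      q0 * (B * B) <⟨ Int.drop‿+<+ (subst₂ ℤ._<_ (trans (cong (+ q0 *ℤ_) (sym (Int.pos-* B B))) (sym (Int.pos-* q0 (B * B)))) (sym (Int.pos-* a a)) gt) ⟩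
      a * a ≤⟨ *-mono-≤ a≤q a≤q ⟩
      q * q ∎)
      where
      open Nat.≤-Reasoning
      rearrange : ∀ q0 T A W → q0 * (T * T) * (A * W * (A * W)) ≡ q0 * (T * A * W * (T * A * W))
      rearrange = ℕ-ring
    conclude (ℤ.-[1+ a ]) a≤q (inj₁ () , _)

  -- With √q = T√q0 the hypothesis says √q A W < q - A V + q0². The right side is at most q because
  -- q0² ≤ A V, so squaring and dividing by q gives A² W² < q.
  sqrt-hypothesis⇒ : sqrtMulLt q0 ((+ T *ℤ + A) *ℤ ((+ (2 * q0 ^ 2) - + (7 * q0)) +ℤ + 3))
      ((+ q - + A *ℤ (+ (4 * q0) - + 2)) +ℤ + (q0 ^ 2)) → (A * W) * (A * W) < q
  sqrt-hypothesis⇒ h = conclude a a≤q (subst (λ b → sqrtMulLt q0 b a) b≡ h)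

2^-cancel-< : ∀ {i j} → 2 ^ i < 2 ^ j → i < j
2^-cancel-< {i} {j} lt = Nat.≰⇒> (λ j≤i → <⇒≱ lt (^-monoʳ-≤ 2 j≤i))

half-bound : ∀ {a b c} → c + c ≤ suc a + suc b → b ≤ suc a → c ≤ suc a
half-bound {a} {b} {c} le b≤ = ≮⇒≥ λ a<c → <⇒≱ (begin-strict
    suc a + suc b ≤⟨ +-monoʳ-≤ (suc a) (s≤s b≤) ⟩
    suc a + suc (suc a) <⟨ Nat.+-monoˡ-< (suc (suc a)) (n<1+n (suc a)) ⟩
    suc (suc a) + suc (suc a) ≤⟨ +-mono-≤ a<c a<c ⟩
    c + c ∎) le
  where open Nat.≤-Reasoning

-- The exponent of q is an odd multiple of d, so exceeding (2j + 1)d means reaching (2j + 3)d.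
odd-multiple : ∀ {d k j c} → c ≤ (2 * k + 1) * d → (2 * j + 1) * d < c → suc j ≤ k
odd-multiple {d} {k} {j} c≤ <c = ≮⇒≥ λ k<sj → <⇒≱ <c
  (≤-trans c≤ (*-monoˡ-≤ d (+-monoˡ-≤ 1 (*-monoʳ-≤ 2 (≤-pred k<sj)))))

-- W = 2q0² − 7q0 + 3 and A² W² < q, where q0 = 2^{e+1} = m + 2 and A = (q0/2)^{q0−1}.
Facts : (e m W q : ℕ) → Set
Facts e m W q = W + 7 * 2 ^ suc e ≡ 2 * (2 ^ suc e) ^ 2 + 3 × ((2 ^ e) ^ suc m * W) * ((2 ^ e) ^ suc m * W) < q

-- P = 2^{a+1} and R = 2^{b+1} with P R = q and P ≤ R ≤ 2P.
sufficient : ∀ e k a b x W m → 1 ≤ k → suc a + suc b ≡ (2 * k + 1) * suc e → a ≤ b → b ≤ suc a →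
  2 ^ suc e ≡ 2 + m → 2 ^ (suc a + suc b) ≤ x + 2 ^ suc e →
  (1 ≤ e → Facts e m W (2 ^ (suc a + suc b))) →
  Sufficient (2 ^ suc a) (2 ^ suc b) m x
sufficient e k a b x W m 1≤k sum≡ a≤b b≤ q0≡ q≤ facts = by-cases e m sum≡ q0≡ q≤ facts
  where
  P R : ℕ
  P = 2 ^ suc a
  R = 2 ^ suc b
  PR≡ : P * R ≡ 2 ^ (suc a + suc b)
  PR≡ = sym (^-distribˡ-+-* 2 (suc a) (suc b))
  P≤R : P ≤ R
  P≤R = ^-monoʳ-≤ 2 (s≤s a≤b)
  product≤ : ∀ {q0 m} → q0 ≡ 2 + m → 2 ^ (suc a + suc b) ≤ x + q0 → P * R ≤ x + (2 + m)
  product≤ refl = ≤-trans (≤-reflexive PR≡)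
  by-cases : ∀ e m → suc a + suc b ≡ (2 * k + 1) * suc e → 2 ^ suc e ≡ 2 + m → 2 ^ (suc a + suc b) ≤ x + 2 ^ suc e →
    (1 ≤ e → Facts e m W (2 ^ (suc a + suc b))) → Sufficient P R m x
  by-cases 0 .0 sum≡ refl q≤ _ = sufficient-2 (^-monoʳ-≤ 2 (s≤s (z≤n {a}))) (^-monoʳ-≤ 2 2≤sb) (product≤ refl q≤)
    where
    2≤sb : 2 ≤ suc b
    2≤sb = ≮⇒≥ λ sb<2 → <⇒≱ (≤-trans (s≤s (+-mono-≤ (s≤s (≤-trans a≤b (≤-pred (≤-pred sb<2)))) (≤-pred sb<2))) (3≤ k 1≤k)) (≤-reflexive (sym sum≡))
      where
      3≤ : ∀ k → 1 ≤ k → 3 ≤ (2 * k + 1) * 1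
      3≤ k 1≤k = *-monoˡ-≤ 1 (+-monoˡ-≤ 1 (*-monoʳ-≤ 2 1≤k))
  -- q0 = 4: A = 8 and W = 7 give q > 2^11; the exponent 2s with s odd is then at least 14, so P ≥
  -- 2^7.
  by-cases 1 .2 sum≡ refl q≤ facts = sufficient-4 (^-monoʳ-≤ 2 7≤) P≤R (product≤ refl q≤)
    where
    W≡7 : W ≡ 7
    W≡7 = Nat.+-cancelʳ-≡ 28 W 7 (proj₁ (facts (s≤s z≤n)))
    12≤ : 12 ≤ suc a + suc b
    12≤ = 2^-cancel-< {11} (Nat.≤-<-trans (toWitness {a? = 2 ^ 11 Nat.≤? 8 * 7 * (8 * 7)} tt)
      (subst (λ w → 8 * w * (8 * w) < 2 ^ (suc a + suc b)) W≡7 (proj₂ (facts (s≤s z≤n)))))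
    3≤k : 3 ≤ k
    3≤k = odd-multiple {2} {k} {2} (subst (12 ≤_) sum≡ 12≤) (toWitness {a? = 11 Nat.≤? 12} tt)
    7≤ : 7 ≤ suc a
    7≤ = half-bound (subst (14 ≤_) (sym sum≡) (*-monoˡ-≤ 2 (+-monoˡ-≤ 1 (*-monoʳ-≤ 2 3≤k)))) b≤
  -- q0 = 8: A = 2^14 and W = 75 give q > 2^40; the exponent 3s with s odd is then at least 45, so P
  -- ≥ 2^21 = 2 q0² A.
  by-cases 2 .6 sum≡ refl q≤ facts = sufficient-large {h = 4} {A = 4 ^ 7} refl refl (s≤s z≤n) (^-monoʳ-≤ 2 21≤) P≤R (product≤ refl q≤)
    where
    W≡75 : W ≡ 75
    W≡75 = Nat.+-cancelʳ-≡ 56 W 75 (proj₁ (facts (s≤s z≤n)))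
    41≤ : 41 ≤ suc a + suc b
    41≤ = 2^-cancel-< {40} (Nat.≤-<-trans (toWitness {a? = 2 ^ 40 Nat.≤? 4 ^ 7 * 75 * (4 ^ 7 * 75)} tt)
      (subst (λ w → 4 ^ 7 * w * (4 ^ 7 * w) < 2 ^ (suc a + suc b)) W≡75 (proj₂ (facts (s≤s z≤n)))))
    7≤k : 7 ≤ k
    7≤k = odd-multiple {3} {k} {6} (subst (41 ≤_) sum≡ 41≤) (toWitness {a? = 40 Nat.≤? 41} tt)
    21≤ : 21 ≤ suc a
    21≤ = half-bound (subst (42 ≤_) (sym sum≡) (≤-trans (toWitness {a? = 42 Nat.≤? 45} tt)
      (*-monoˡ-≤ 3 (+-monoˡ-≤ 1 (*-monoʳ-≤ 2 7≤k))))) b≤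
  by-cases e@(suc (suc (suc e'))) m sum≡ q0≡ q≤ facts =
    sufficient-large {h = 2 ^ e} {A = A} (sym q0≡) refl (2^>0 e) large P≤R (product≤ q0≡ q≤)
    where
    A q0 t S : ℕ
    A = (2 ^ e) ^ suc m
    q0 = 2 + m
    t = (suc e + suc e) + e * suc m
    S = q0 * q0 * A
    S≡ : S ≡ 2 ^ t
    S≡ = begin
      q0 * q0 * A ≡⟨ cong₂ (λ u v → u * u * v) (sym q0≡) (^-*-assoc 2 e (suc m)) ⟩
      2 ^ suc e * 2 ^ suc e * 2 ^ (e * suc m) ≡⟨ cong (_* 2 ^ (e * suc m)) (^-distribˡ-+-* 2 (suc e) (suc e)) ⟨
      2 ^ (suc e + suc e) * 2 ^ (e * suc m) ≡⟨ ^-distribˡ-+-* 2 (suc e + suc e) (e * suc m) ⟨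
      2 ^ t ∎
      where open ≡-Reasoning
    16≤q0 : 16 ≤ q0
    16≤q0 = subst (16 ≤_) q0≡ (^-monoʳ-≤ 2 (s≤s (s≤s (s≤s (s≤s (z≤n {e'}))))))
    -- From 7q0 ≤ (7/16) q0² for q0 ≥ 16. The factor 25/16 suffices because 25² = 625 exceeds 2 ·
    -- 16² = 512, the 2 being the possible ratio of R to P.
    25q0²≤16W : 25 * (q0 * q0) ≤ 16 * W
    25q0²≤16W = +-cancelʳ-≤ (112 * q0) _ _ (begin
      25 * (q0 * q0) + 112 * q0 ≤⟨ +-monoʳ-≤ (25 * (q0 * q0)) (≤-trans (≤-reflexive (Nat.*-assoc 7 16 q0)) (*-monoʳ-≤ 7 (*-monoˡ-≤ q0 16≤q0))) ⟩
      25 * (q0 * q0) + 7 * (q0 * q0) ≤⟨ ≤-by 48 (identity1 q0) ⟩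
      16 * (2 * q0 ^ 2 + 3) ≡⟨ cong (λ u → 16 * (2 * u ^ 2 + 3)) q0≡ ⟨
      16 * (2 * (2 ^ suc e) ^ 2 + 3) ≡⟨ cong (16 *_) (proj₁ (facts (s≤s z≤n))) ⟨
      16 * (W + 7 * 2 ^ suc e) ≡⟨ cong (λ u → 16 * (W + 7 * u)) q0≡ ⟩
      16 * (W + 7 * q0) ≡⟨ identity2 W q0 ⟩
      16 * W + 112 * q0 ∎)
      where
      open Nat.≤-Reasoning
      identity1 : ∀ q → 25 * (q * q) + 7 * (q * q) + 48 ≡ 16 * (2 * (q * (q * 1)) + 3)
      identity1 = ℕ-ring
      identity2 : ∀ W q → 16 * (W + 7 * q) ≡ 16 * W + 112 * q
      identity2 = ℕ-ring
    -- If P ≤ q0² A, then (A W)² < q ≤ 2 P² ≤ 2 q0⁴ A², whereas W ≥ (25/16) q0².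
    t≤a : suc t ≤ suc a
    t≤a = ≮⇒≥ λ a<t → Nat.<-irrefl refl (begin-strict
      512 * (S * S) ≤⟨ ≤-by (113 * (S * S)) (identity1 S) ⟩
      25 * S * (25 * S) ≡⟨ cong (λ u → u * u) (identity2 q0 A) ⟩
      25 * (q0 * q0) * A * (25 * (q0 * q0) * A) ≤⟨ *-mono-≤ (*-monoˡ-≤ A 25q0²≤16W) (*-monoˡ-≤ A 25q0²≤16W) ⟩
      16 * W * A * (16 * W * A) ≡⟨ identity3 W A ⟩
      256 * (A * W * (A * W)) <⟨ Nat.*-monoʳ-< 256 (proj₂ (facts (s≤s z≤n))) ⟩
      256 * 2 ^ (suc a + suc b) ≡⟨ cong (256 *_) PR≡ ⟨
      256 * (P * R) ≤⟨ *-monoʳ-≤ 256 (*-mono-≤ (P≤S a<t) (≤-trans R≤2P (*-monoʳ-≤ 2 (P≤S a<t)))) ⟩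
      256 * (S * (2 * S)) ≡⟨ identity4 S ⟩
      512 * (S * S) ∎)
      where
      open Nat.≤-Reasoning
      P≤S : suc a < suc t → P ≤ S
      P≤S a<t = subst (P ≤_) (sym S≡) (^-monoʳ-≤ 2 (≤-pred a<t))
      R≤2P : R ≤ 2 * P
      R≤2P = ^-monoʳ-≤ 2 (s≤s b≤)
      identity1 : ∀ S → 512 * (S * S) + 113 * (S * S) ≡ 25 * S * (25 * S)
      identity1 = ℕ-ring
      identity2 : ∀ q A → 25 * (q * q * A) ≡ 25 * (q * q) * A
      identity2 = ℕ-ring
      identity3 : ∀ W A → 16 * W * A * (16 * W * A) ≡ 256 * (A * W * (A * W))
      identity3 = ℕ-ring
      identity4 : ∀ S → 256 * (S * (2 * S)) ≡ 512 * (S * S)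
      identity4 = ℕ-ring
    large : 2 * (q0 * q0) * A ≤ P
    large = ≤-trans (≤-reflexive (trans (Nat.*-assoc 2 (q0 * q0) A) (cong (2 *_) S≡))) (^-monoʳ-≤ 2 t≤a)

-- The truncated difference is exact for q ≥ 4 by `weight-bound`. At q = 2 it is a placeholder, as
-- `Facts` is only supplied for e ≥ 1.
weight : ℕ → ℕ
weight q = 2 * q ^ 2 + 3 ∸ 7 * q

weight-bound : ∀ {q} → 4 ≤ q → suc (7 * q) ≤ 2 * q ^ 2 + 3
weight-bound {q} 4≤q = begin
    suc (7 * q) ≤⟨ ≤-by (q + 2) (identity1 q) ⟩
    2 * (4 * q) + 3 ≤⟨ +-monoˡ-≤ 3 (*-monoʳ-≤ 2 (*-monoˡ-≤ q 4≤q)) ⟩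
    2 * (q * q) + 3 ≡⟨ cong (λ u → 2 * (q * u) + 3) (sym (Nat.*-identityʳ q)) ⟩
    2 * q ^ 2 + 3 ∎
  where
  open Nat.≤-Reasoning
  identity1 : ∀ q → suc (7 * q) + (q + 2) ≡ 2 * (4 * q) + 3
  identity1 = ℕ-ring

hypothesis-facts : ∀ e k q0 m m' → q0 ≡ 2 ^ suc e → m ≡ 2 ^ e → 2 ^ suc e ≡ 2 + m' → 1 ≤ e →
  sqrtMulLt q0
    ((+ (q0 ^ k) *ℤ + (m ^ (q0 ∸ 1))) *ℤ ((+ (2 * q0 ^ 2) - + (7 * q0)) +ℤ + 3))
    ((+ (q0 ^ (2 * k + 1)) - + (m ^ (q0 ∸ 1)) *ℤ (+ (4 * q0) - + 2)) +ℤ + (q0 ^ 2)) →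
  Facts e m' (weight q0) (q0 ^ (2 * k + 1))
hypothesis-facts e k q0 m m' refl refl q0≡ 1≤e hyp = W≡ ,
    subst (λ j → ((2 ^ e) ^ j * W) * ((2 ^ e) ^ j * W) < q0 ^ (2 * k + 1)) (cong (_∸ 1) q0≡)
      (sqrt-hypothesis⇒ {q0} {A} {q0 ^ k} {q0 ^ (2 * k + 1)} {W} {4 * q0 ∸ 2} q≡ W≡
        (Nat.m∸n+n≡m {4 * q0} {2} (≤-trans (s≤s (s≤s z≤n)) (≤-trans 4≤q0 (Nat.m≤n*m q0 4))))
        q0²≤ (Nat.m<n⇒0<n∸m (weight-bound 4≤q0))
        (m^n>0 (2 ^ e) {{Nat.m^n≢0 2 e}} (q0 ∸ 1)) (m^n>0 q0 {{Nat.m^n≢0 2 (suc e)}} k) hyp)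
  where
  W A : ℕ
  W = weight q0
  A = (2 ^ e) ^ (q0 ∸ 1)
  4≤q0 : 4 ≤ q0
  4≤q0 = ^-monoʳ-≤ 2 (s≤s 1≤e)
  W≡ : W + 7 * q0 ≡ 2 * q0 ^ 2 + 3
  W≡ = Nat.m∸n+n≡m (≤-trans (n≤1+n (7 * q0)) (weight-bound 4≤q0))
  q≡ : q0 ^ (2 * k + 1) ≡ q0 * (q0 ^ k * q0 ^ k)
  q≡ = begin
    q0 ^ (2 * k + 1) ≡⟨ cong (q0 ^_) (identity k) ⟩
    q0 * q0 ^ (k + k) ≡⟨ cong (q0 *_) (^-distribˡ-+-* q0 k k) ⟩
    q0 * (q0 ^ k * q0 ^ k) ∎
    where
    open ≡-Reasoning
    identity : ∀ k → 2 * k + 1 ≡ suc (k + k)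
    identity = ℕ-ring
  q0≤A : q0 ≤ A
  q0≤A = subst (q0 ≤_) (sym (^-*-assoc 2 e (q0 ∸ 1))) (^-monoʳ-≤ 2 (begin
    1 + e ≤⟨ +-monoˡ-≤ e 1≤e ⟩
    e + e ≤⟨ ≤-by e (identity e) ⟩
    e * 3 ≤⟨ *-monoʳ-≤ e (Nat.∸-monoˡ-≤ 1 4≤q0) ⟩
    e * (q0 ∸ 1) ∎))
    where
    open Nat.≤-Reasoning
    identity : ∀ e → e + e + e ≡ e * 3
    identity = ℕ-ring
  q0²≤ : q0 ^ 2 ≤ A * (4 * q0 ∸ 2)
  q0²≤ = *-mono-≤ q0≤A (Nat.m+n≤o⇒m≤o∸n (q0 * 1) (begin
    q0 * 1 + 2 ≡⟨ cong (_+ 2) (Nat.*-identityʳ q0) ⟩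
    q0 + 2 ≤⟨ +-monoʳ-≤ q0 (≤-trans (s≤s (s≤s z≤n)) 4≤q0) ⟩
    q0 + q0 ≤⟨ ≤-by (2 * q0) (identity q0) ⟩
    4 * q0 ∎))
    where
    open Nat.≤-Reasoning
    identity : ∀ q → q + q + 2 * q ≡ 4 * q
    identity = ℕ-ring

-- Assembly: from Stepanov's bound and the hypothesis to the covering radius.

module Assembly (K : FiniteField) (char2 : HasChar2 K)
  (e k m : ℕ) (1≤k : 1 ≤ k) (m≡ : 2 ^ suc e ≡ 2 + m)
  (size≡ : FiniteField.size K ≡ 2 ^ ((2 * k + 1) * suc e + (2 * k + 1) * suc e)) where

  private
    n : ℕ
    n = (2 * k + 1) * suc e

    3≤n : 3 ≤ n
    3≤n = *-mono-≤ (+-monoˡ-≤ 1 (*-monoʳ-≤ 2 1≤k)) (s≤s (z≤n {e}))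

    n>0 : 0 < n
    n>0 = ≤-trans (s≤s z≤n) 3≤n

  covering-radius : ∀ {q0 q} → q0 ≡ 2 ^ suc e → q ≡ 2 ^ n →
    ∀ W → (1 ≤ e → Facts e m W (2 ^ n)) →
    Code.CoveringRadius K q0 q 3
  covering-radius {q0} {q} q0≡ q≡ W facts = by-halves (halves (n ∸ 2))
    where
    open Covering K char2 n n>0 size≡ (suc e) (2 * k + 1) refl q0 q q0≡ q≡
    length-F0 : length F0 ≡ 2 + m
    length-F0 = trans (Nat.≤-antisym (length-Fix≤ (suc e) (s≤s z≤n))
      (length-Fix≥ (suc e) (2 * k + (2 * k + 1)) (s≤s z≤n) (identity k (suc e)))) m≡
      where
      identity : ∀ k d → (2 * k + 1) * d + (2 * k + 1) * d ≡ suc (2 * k + (2 * k + 1)) * d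
      identity = ℕ-ring
    q≤X+q0 : 2 ^ n ≤ length X + (2 + m)
    q≤X+q0 = ≤-trans (length-Fix≥ n 1 n>0 (cong (λ u → n + u) (sym (Nat.+-identityʳ n))))
      (subst (λ u → length (Fix n) ≤ length X + u) length-F0 length-X)
    by-halves : (∃ λ a → ∃ λ b → suc (suc (n ∸ 2)) ≡ suc a + suc b × a ≤ b × b ≤ suc a) → C.CoveringRadius 3
    by-halves (a , b , halves≡ , a≤b , b≤) = covering-radius-3 (Recursion.good-element m cost cost-bound length-F0
        (sufficient e k a b (length X) W m 1≤k (sym n≡ab) a≤b b≤ m≡
          (subst₂ (λ u v → 2 ^ u ≤ length X + v) n≡ab (sym m≡) q≤X+q0)
          (λ 1≤e → subst (λ u → Facts e m W (2 ^ u)) n≡ab (facts 1≤e))))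
      where
      n≡ab : n ≡ suc a + suc b
      n≡ab = trans (sym (Nat.m+[n∸m]≡n (≤-trans (n≤1+n 2) 3≤n))) halves≡
      P R : ℕ
      P = 2 ^ suc a
      R = 2 ^ suc b
      cost : ℕ → ℕ
      cost = leafCost P R (2 + m) (length X)
      cost-bound : ∀ {c0 g F} → Fixed (suc e) c0 → Pole c0 g F → 2 * length (exceptional F) ≤ length X + cost g
      cost-bound {c0} {g} {F} c0-fix pole with suc g * suc g Nat.<? P
      ... | no _ = begin
          2 * length (exceptional F) ≤⟨ *-monoʳ-≤ 2 (length-filter _ X) ⟩
          2 * length X ≡⟨ cong (λ u → length X + u) (Nat.+-identityʳ (length X)) ⟩
          length X + length X ∎
        where open Nat.≤-Reasoning
      ... | yes large = begin
          2 * length (exceptional F)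
            ≤⟨ *-monoʳ-≤ 2 (≤-trans (n≤1+n _) (pole-exceptional c0-fix pole n≡ab a≤b (subst (suc g * suc g <_) (2^suc a) large))) ⟩
          2 * (2 ^ a + R * (2 ^ a + g))
            ≡⟨ identity1 (2 ^ a) R g ⟩
          2 ^ a + 2 ^ a + (2 ^ a + 2 ^ a) * R + 2 * (g * R)
            ≡⟨ cong (λ u → u + u * R + 2 * (g * R)) (2^suc a) ⟨
          P + P * R + 2 * (g * R)
            ≤⟨ +-monoˡ-≤ (2 * (g * R)) (+-monoʳ-≤ P (≤-trans (≤-reflexive PR≡) q≤X+q0)) ⟩
          P + (length X + (2 + m)) + 2 * (g * R)
            ≡⟨ identity2 P (length X) (2 + m) (2 * (g * R)) ⟩
          length X + (P + (2 + m) + 2 * (g * R)) ∎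
        where
        open Nat.≤-Reasoning
        PR≡ : P * R ≡ 2 ^ n
        PR≡ = trans (sym (^-distribˡ-+-* 2 (suc a) (suc b))) (cong (2 ^_) (sym n≡ab))
        identity1 : ∀ h R g → 2 * (h + R * (h + g)) ≡ h + h + (h + h) * R + 2 * (g * R)
        identity1 = ℕ-ring
        identity2 : ∀ P x q y → P + (x + q) + y ≡ x + (P + q + y)
        identity2 = ℕ-ring

theoremx4 : (q0 m k : ℕ) → q0 ≡ 2 * m → 1 ≤ k →
    (K : FiniteField) → FiniteField.size K ≡ (q0 ^ (2 * k + 1)) ^ 2 →
    sqrtMulLt q0
    ((+ (q0 ^ k) *ℤ + (m ^ (q0 ∸ 1))) *ℤ ((+ (2 * q0 ^ 2) - + (7 * q0)) +ℤ + 3))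
    ((+ (q0 ^ (2 * k + 1)) - + (m ^ (q0 ∸ 1)) *ℤ (+ (4 * q0) - + 2)) +ℤ + (q0 ^ 2)) →
    Code.CoveringRadius K q0 (q0 ^ (2 * k + 1)) 3
theoremx4 q0 m k q0≡ 1≤k K size≡ hyp = from-power (divides-2^⇒power (proj₁ power) (subst (q0 ∣_) (proj₂ power) q0∣size))
  where
  s : ℕ
  s = 2 * k + 1
  q0∣size : q0 ∣ FiniteField.size K
  q0∣size = subst (q0 ∣_) (sym size≡) (∣-trans (subst (λ j → q0 ∣ q0 ^ j) (Nat.+-comm 1 (2 * k)) (m∣m*n (q0 ^ (2 * k)))) (m∣m*n _))
  char2 : HasChar2 K
  char2 with ∣-trans (divides m (trans q0≡ (Nat.*-comm 2 m))) q0∣size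
  ... | divides c eq = Field.even-size⇒char2 K c (trans eq (trans (Nat.*-comm c 2) (cong (λ u → c + u) (Nat.+-identityʳ c))))
  power : ∃ λ N → FiniteField.size K ≡ 2 ^ N
  power = Char2.size-power-of-2 K char2
  from-power : (∃ λ e → q0 ≡ 2 ^ e) → Code.CoveringRadius K q0 (q0 ^ (2 * k + 1)) 3
  from-power (zero , q0≡1) = ⊥-elim (1≢2* m (trans (sym q0≡1) q0≡))
    where
    1≢2* : ∀ m → 1 ≢ 2 * m
    1≢2* (suc m) eq with trans eq (Nat.*-suc 2 m)
    ... | ()
  from-power (suc e , q0≡2^) = Assembly.covering-radius K char2 e k m' 1≤k q0≡m' size≡' q0≡2^ q≡ (weight q0)
      (λ 1≤e → subst (Facts e m' (weight q0)) q≡ (hypothesis-facts e k q0 m m' q0≡2^ m≡ q0≡m' 1≤e hyp))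
    where
    n m' : ℕ
    n = s * suc e
    m' = 2 ^ suc e ∸ 2
    q0≡m' : 2 ^ suc e ≡ 2 + m'
    q0≡m' = sym (Nat.m+[n∸m]≡n (^-monoʳ-≤ 2 (s≤s (z≤n {e}))))
    m≡ : m ≡ 2 ^ e
    m≡ = Nat.*-cancelˡ-≡ m (2 ^ e) 2 (trans (sym q0≡) q0≡2^)
    q≡ : q0 ^ s ≡ 2 ^ n
    q≡ = trans (cong (_^ s) q0≡2^) (trans (^-*-assoc 2 (suc e) s) (cong (2 ^_) (Nat.*-comm (suc e) s)))
    size≡' : FiniteField.size K ≡ 2 ^ (n + n)
    size≡' = trans size≡ (trans (cong (_^ 2) q≡) (trans (cong (2 ^ n *_) (Nat.*-identityʳ (2 ^ n))) (sym (^-distribˡ-+-* 2 n n))))
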